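{- Suppose that $s$ and $k$ are natural numbers with $k\ge 3$ and $s\ge k^2-k+1$. Then for each $\varepsilon>0$, one has $$J_{s,k}(X)\ll X^{2s-\frac12k(k+1)+\varepsilon}.$$
   Context: For natural numbers $s,k$ and a real number $X$, $J_{s,k}(X)$ denotes the number of integral solutions of the system $x_1^j+\ldots+x_s^j=y_1^j+\ldots+y_s^j$ $(1\le j\le k)$ with $1\le x_i,y_i\le X$ $(1\le i\le s)$. The notation $A\ll B$ means $|A|\le CB$ for all sufficiently large $X$, where the implicit constant $C$ may depend on $s$, $k$ and $\varepsilon$ only. -}

module Defs where

import Algebra.Definitions.RawSemiring
open import Data.Integer as ℤ using (ℤ; +_; -[1+_])
open import Data.List using (List; length)
open import Data.List.Membership.Propositional using (_∈_)
open import Data.List.Relation.Unary.Unique.Propositional using (Unique)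
open import Data.Nat as ℕ using (ℕ; suc)
open import Data.Product using (∃; ∃₂; ∃-syntax; Σ-syntax; _×_; _,_)
open import Data.Rational as ℚ using (ℚ; 0ℚ; 1ℚ; _+_; _-_; _*_; -_; _<_; _≤_; _/_; ↥_; ↧ₙ_)
import Data.Rational.Properties as ℚ
open import Data.Sum using (_⊎_)
open import Data.Vec as Vec using (Vec)
open import Data.Vec.Relation.Unary.All using (All)
open import Function using (_∘_)
open import Function.Bundles using (_⇔_)
open import Relation.Binary.PropositionalEquality
  using (_≡_; sym; trans; cong; subst)
open import Relation.Nullary using (¬_)

-- Two-sided located Dedekind cuts: Below q is "q < x" and Above q is "x < q".
record ℝ : Set₁ where
  field
    Below Above : ℚ → Set
    below-inhabited : ∃ Below
    above-inhabited : ∃ Above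
    below-closed : ∀ {p q} → p < q → Below q → Below p
    above-closed : ∀ {p q} → p < q → Above p → Above q
    below-open : ∀ {p} → Below p → ∃[ q ] p < q × Below q
    above-open : ∀ {q} → Above q → ∃[ p ] p < q × Above p
    disjoint : ∀ {q} → Below q → ¬ Above q
    located : ∀ {p q} → p < q → Below p ⊎ Above q

infix 4 _<ʳ_ _ʳ<_ _≤ʳ_

_<ʳ_ : ℚ → ℝ → Set
q <ʳ x = ℝ.Below x q

_ʳ<_ : ℝ → ℚ → Set
x ʳ< q = ℝ.Above x q

_≤ʳ_ : ℚ → ℝ → Set
q ≤ʳ x = ¬ (x ʳ< q)

private
  sub-mono : ∀ c {p q} → p < q → p - c < q - c
  sub-mono c = ℚ.+-monoˡ-< (- c)

  c+p-c : ∀ c p → (c + p) - c ≡ p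
  c+p-c c p = trans (cong (_- c) (ℚ.+-comm c p))
    (trans (ℚ.+-assoc p c (- c))
      (trans (cong (λ z → p + z) (ℚ.+-inverseʳ c)) (ℚ.+-identityʳ p)))

  c+[p-c] : ∀ c p → c + (p - c) ≡ p
  c+[p-c] c p = trans (sym (ℚ.+-assoc c p (- c))) (c+p-c c p)

infixl 6 _+ʳ_

_+ʳ_ : ℚ → ℝ → ℝ
c +ʳ x = record
  { Below = λ q → q - c <ʳ x
  ; Above = λ q → x ʳ< q - c
  ; below-inhabited = let p , b = below-inhabited in c + p , subst Below (sym (c+p-c c p)) b
  ; above-inhabited = let p , a = above-inhabited in c + p , subst Above (sym (c+p-c c p)) a
  ; below-closed = below-closed ∘ sub-mono c
  ; above-closed = above-closed ∘ sub-mono c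
  ; below-open = λ {p} b → let q , p<q , b′ = below-open b in
      c + q , subst (_< c + q) (c+[p-c] c p) (ℚ.+-monoʳ-< c p<q)
            , subst Below (sym (c+p-c c q)) b′
  ; above-open = λ {q} a → let p , p<q , a′ = above-open a in
      c + p , subst (c + p <_) (c+[p-c] c q) (ℚ.+-monoʳ-< c p<q)
            , subst Above (sym (c+p-c c p)) a′
  ; disjoint = disjoint
  ; located = located ∘ sub-mono c
  }
  where open ℝ x

infixr 8 _^_

_^_ : ℚ → ℕ → ℚ
_^_ = Algebra.Definitions.RawSemiring._^_ ℚ.+-*-rawSemiring

-- x ^ (n / d) < r for rational x > 0, cleared of roots by raising to the
-- power d > 0 and of negative powers by multiplying through.
_^ℚ_<_ : ℚ → ℚ → ℚ → Set
x ^ℚ t < r = 0ℚ < r × cleared (↥ t)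
  where
  cleared : ℤ → Set
  cleared (+ n)    = x ^ n < r ^ ↧ₙ t
  cleared -[1+ n ] = 1ℚ < r ^ ↧ₙ t * x ^ suc n

-- x ^ θ < r for real x > 0 and real θ: the power extends continuously from
-- rational base and exponent, so x ^ θ < r holds exactly when, for some q < r,
-- all rational powers in some open box around (x , θ) are below q.
_^ʳ_<_ : ℝ → ℝ → ℚ → Set
x ^ʳ θ < r =
  ∃₂ λ a b → 0ℚ < a × a <ʳ x × x ʳ< b ×
  ∃₂ λ c d → c <ʳ θ × θ ʳ< d ×
  ∃[ q ] q < r ×
  (∀ u t → a < u → u < b → c < t → t < d → u ^ℚ t < q)

-- n ≤ C x^θ for C > 0, as an inequality against the upper cut of x^θ.
_≤_·_^ʳ_ : ℕ → ℚ → ℝ → ℝ → Set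
n ≤ C · x ^ʳ θ = ∀ r → x ^ʳ θ < r → + n / 1 ≤ C * r

powerSum : ∀ {s} → ℕ → Vec ℤ s → ℤ
powerSum j x = Vec.foldr′ ℤ._+_ (+ 0) (Vec.map (ℤ._^ j) x)

InRange : ∀ {s} → ℝ → Vec ℤ s → Set
InRange X = All λ a → + 1 ℤ.≤ a × a / 1 ≤ʳ X

Solution : (s k : ℕ) → ℝ → Vec ℤ s × Vec ℤ s → Set
Solution s k X (x , y) =
  (∀ j → 1 ℕ.≤ j → j ℕ.≤ k → powerSum j x ≡ powerSum j y) ×
  InRange X x × InRange X y

-- J s k X N says that J_{s,k}(X) = N. It is a relation because the integer
-- part of a real number is not a computable function.
J : (s k : ℕ) → ℝ → ℕ → Set
J s k X N = Σ[ xs ∈ List (Vec ℤ s × Vec ℤ s) ]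
  Unique xs × (∀ p → p ∈ xs ⇔ Solution s k X p) × length xs ≡ N

-- f X N is read as F(X) = N. The constants C and X₀ may depend on whatever
-- f and θ depend on, but not on X.
_≪X^_ : (ℝ → ℕ → Set) → ℝ → Set₁
f ≪X^ θ = Σ[ C ∈ ℚ ] 0ℚ < C × Σ[ X₀ ∈ ℚ ] (∀ X → X₀ ≤ʳ X → ∀ N → f X N → N ≤ C · X ^ʳ θ)

{-# OPTIONS --safe #-}
-- The number of solutions is a moment of order 2s, and as k² − k + 1 ≥ k (k + 1) / 2
-- it suffices to treat the critical order k (k + 1). This moment is bounded by p-adic
-- decoupling for a fixed prime p > k, after Guo, Li, Yung and Zorin-Kranich. By
-- induction on k, the moment of a set of integers is compared with the moments of
-- its intersections with residue classes modulo p ^ N, for all curves close to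
-- the moment curve. If two classes are distinct modulo p, the frequencies of the
-- class of η modulo p ^ b vanish modulo p ^ ((k − r + 1) b) in the last r coordinates
-- of the osculating frame at η. So the inequality of degree r < k decouples the other
-- class down to the scale (k − r + 1) b / r, and Hölder's inequality then exchanges the
-- roles of the two classes. Iteration gains an arbitrarily large power of p ^ b over the
-- trivial bound. As even moments count solutions, the Hölder inequalities follow
-- from Cauchy–Schwarz in the semiring ℕ[G] alone.
module Submission where

-- Between p ^ N classes, square-root cancellation would lose p ^ (s N) with s = k (k + 1) / 2; the
-- triangle inequality loses p ^ (2 s N). The excess is written p ^ (m N / q) with q fixed, so that
-- all inequalities stay in ℕ after raising to the power q. Then m descends from s q by one at a
-- time while the gain, which is proportional to m, exceeds the errors. Decoupling one class must
-- not see the other, so the other is moved into a weight L. What is required of a set is only that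
-- each coincidence counted by its weighted moment makes the sums along a curve congruent modulo p ^
-- (k N). This passes to subsets, to rescaled classes and to lower degrees with a larger weight. A
-- coincidence acts as a linear functional vanishing on constants, and new curves come from
-- elimination in the module of functions which all these functionals send to multiples of a power
-- of p. The gain arises at the bottom of each round: once the exponent of one class is zero, the
-- mixed moment is the moment of a class at scale p ^ -b, and the inequality to be improved is
-- applied over N - b scales instead of N.

-- Powers of natural numbers and log-convex sequences.

module PowerInequalities where

  open import Data.Nat
  open import Data.Nat.Properties
  open import Data.Nat.Tactic.RingSolver using (solve-∀)
  open import Relation.Binary.PropositionalEquality
  open import Relation.Nullary using (yes; no; contradiction)

  ^-cancelʳ-≤ : ∀ n {x y} → 1 ≤ n → x ^ n ≤ y ^ n → x ≤ y
  ^-cancelʳ-≤ n@(suc _) {x} {y} _ le with x ≤? y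
  ... | yes x≤y = x≤y
  ... | no x≰y = contradiction le (<⇒≱ (^-monoˡ-< n (≰⇒> x≰y)))

  *-cancel-≤-pos : ∀ {x y} c → 1 ≤ c → c * x ≤ c * y → x ≤ y
  *-cancel-≤-pos (suc c) _ = *-cancelˡ-≤ (suc c)

  distrib-^-* : ∀ a b n → (a * b) ^ n ≡ a ^ n * b ^ n
  distrib-^-* a b zero = refl
  distrib-^-* a b (suc n) rewrite distrib-^-* a b n = lem a b (a ^ n) (b ^ n)
    where
    lem : ∀ a b x y → a * b * (x * y) ≡ a * x * (b * y)
    lem = solve-∀

  ^-pos : ∀ {x} n → 1 ≤ x → 1 ≤ x ^ n
  ^-pos {suc x} n _ = m^n>0 (suc x) n

  square-mono⁻¹ : ∀ {x y} → x * x ≤ y * y → x ≤ y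
  square-mono⁻¹ {x} {y} le = ^-cancelʳ-≤ 2 (s≤s z≤n)
    (subst₂ _≤_ (cong (x *_) (sym (*-identityʳ x))) (cong (y *_) (sym (*-identityʳ y))) le)

  cancel-power : ∀ Q n X → Q ^ n * Q ≤ Q ^ n * X → Q ≤ X
  cancel-power zero n X _ = z≤n
  cancel-power Q@(suc _) n X = *-cancel-≤-pos (Q ^ n) (m^n>0 Q n)

  module LogConvex (M : ℕ → ℕ) where

    private
      -- In the step to `suc j`, raise the last convexity inequality to the power `suc j`, insert
      -- the previous case and cancel `M (suc j) ^ j`. If `M (suc j)` vanishes, so does the left
      -- side.
      adjacent : ∀ j → (∀ i → i < j → M (suc i) * M (suc i) ≤ M i * M (2 + i)) →
        M j ^ suc j ≤ M 0 * M (suc j) ^ j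
      adjacent zero _ = ≤-refl
      adjacent (suc j) lc with M (suc j) in eq
      ... | zero = z≤n
      ... | suc m = *-cancel-≤-pos (suc m ^ j) (m^n>0 (suc m) j) (begin
        suc m ^ j * (suc m * (suc m * suc m ^ j))       ≡⟨ lem₁ (suc m) (suc m ^ j) ⟩
        (suc m * suc m) * (suc m ^ j * suc m ^ j)       ≡⟨ cong (suc m * suc m *_) (distrib-^-* (suc m) (suc m) j) ⟨
        (suc m * suc m) ^ suc j                         ≤⟨ ^-monoˡ-≤ (suc j) (subst (λ z → z * z ≤ M j * M (2 + j)) eq (lc j ≤-refl)) ⟩
        (M j * M (2 + j)) ^ suc j                       ≡⟨ distrib-^-* (M j) (M (2 + j)) (suc j) ⟩
        M j ^ suc j * M (2 + j) ^ suc j                 ≤⟨ *-monoˡ-≤ (M (2 + j) ^ suc j) ih ⟩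
        M 0 * suc m ^ j * M (2 + j) ^ suc j             ≡⟨ lem₂ (M 0) (suc m ^ j) (M (2 + j) ^ suc j) ⟩
        suc m ^ j * (M 0 * M (2 + j) ^ suc j)           ∎)
        where
        open ≤-Reasoning
        ih = subst (λ z → M j ^ suc j ≤ M 0 * z ^ j) eq (adjacent j (λ i i<j → lc i (m≤n⇒m≤1+n i<j)))
        lem₁ : ∀ a b → b * (a * (a * b)) ≡ a * a * (b * b)
        lem₁ = solve-∀
        lem₂ : ∀ a b c → a * b * c ≡ b * (a * c)
        lem₂ = solve-∀

    -- A log-convex sequence lies below the geometric chord between its endpoints. The induction
    -- moves the right endpoint by one, using `adjacent` at the old endpoint after raising to the
    -- power `j + d` to clear roots.
    interpolate : ∀ j d → (∀ i → 2 + i ≤ j + d → M (suc i) * M (suc i) ≤ M i * M (2 + i)) →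
      M j ^ (j + d) ≤ M 0 ^ d * M (j + d) ^ j
    interpolate j zero lc rewrite +-identityʳ j = ≤-reflexive (sym (+-identityʳ _))
    interpolate j (suc d) lc with j + d in eq
    ... | zero rewrite m+n≡0⇒m≡0 j eq | m+n≡0⇒n≡0 j eq = ≤-reflexive (sym (*-identityʳ _))
    ... | n@(suc n′) = ^-cancelʳ-≤ n (s≤s z≤n) (begin
      (M j ^ (j + suc d)) ^ n                    ≡⟨ cong (λ z → (M j ^ z) ^ n) (trans (+-suc j d) (cong suc eq)) ⟩
      (M j ^ suc n) ^ n                          ≡⟨ ^-comm (M j) (suc n) n ⟩
      (M j ^ n) ^ suc n                          ≤⟨ ^-monoˡ-≤ (suc n) ih ⟩
      (M 0 ^ d * M n ^ j) ^ suc n                ≡⟨ distrib-^-* (M 0 ^ d) (M n ^ j) (suc n) ⟩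
      (M 0 ^ d) ^ suc n * (M n ^ j) ^ suc n      ≡⟨ cong ((M 0 ^ d) ^ suc n *_) (^-comm (M n) j (suc n)) ⟩
      (M 0 ^ d) ^ suc n * (M n ^ suc n) ^ j      ≤⟨ *-monoʳ-≤ ((M 0 ^ d) ^ suc n) (^-monoˡ-≤ j adj) ⟩
      (M 0 ^ d) ^ suc n * (M 0 * M (suc n) ^ n) ^ j ≡⟨ cong ((M 0 ^ d) ^ suc n *_) (distrib-^-* (M 0) (M (suc n) ^ n) j) ⟩
      (M 0 ^ d) ^ suc n * (M 0 ^ j * (M (suc n) ^ n) ^ j) ≡⟨ *-assoc ((M 0 ^ d) ^ suc n) (M 0 ^ j) _ ⟨
      (M 0 ^ d) ^ suc n * M 0 ^ j * (M (suc n) ^ n) ^ j ≡⟨ cong₂ _*_ expo (^-comm (M (suc n)) n j) ⟩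
      (M 0 ^ suc d) ^ n * (M (suc n) ^ j) ^ n    ≡⟨ distrib-^-* (M 0 ^ suc d) (M (suc n) ^ j) n ⟨
      (M 0 ^ suc d * M (suc n) ^ j) ^ n          ≡⟨ cong (λ z → (M 0 ^ suc d * M z ^ j) ^ n) (trans (+-suc j d) (cong suc eq)) ⟨
      (M 0 ^ suc d * M (j + suc d) ^ j) ^ n      ∎)
      where
      open ≤-Reasoning
      ^-comm : ∀ x a b → (x ^ a) ^ b ≡ (x ^ b) ^ a
      ^-comm x a b = trans (^-*-assoc x a b) (trans (cong (x ^_) (*-comm a b)) (sym (^-*-assoc x b a)))
      ih : M j ^ n ≤ M 0 ^ d * M n ^ j
      ih = subst (λ z → M j ^ z ≤ M 0 ^ d * M z ^ j) eq
        (interpolate j d (λ i h → lc i (≤-trans h (+-monoʳ-≤ j (n≤1+n d)))))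
      adj : M n ^ suc n ≤ M 0 * M (suc n) ^ n
      adj = adjacent n (λ i i<n → lc i (≤-trans (s≤s i<n) (≤-reflexive (sym (trans (+-suc j d) (cong suc eq))))))
      lem : ∀ j d → d * suc (j + d) + j ≡ suc d * (j + d)
      lem = solve-∀
      expo : (M 0 ^ d) ^ suc n * M 0 ^ j ≡ (M 0 ^ suc d) ^ n
      expo = trans (cong (_* M 0 ^ j) (^-*-assoc (M 0) d (suc n)))
        (trans (sym (^-distribˡ-+-* (M 0) (d * suc n) j))
        (trans (cong (M 0 ^_) (subst (λ z → d * suc z + j ≡ suc d * z) eq (lem j d)))
        (sym (^-*-assoc (M 0) (suc d) n))))

  private
    ^-^-comm : ∀ x a b → (x ^ a) ^ b ≡ (x ^ b) ^ a
    ^-^-comm x a b = trans (^-*-assoc x a b) (trans (cong (x ^_) (*-comm a b)) (sym (^-*-assoc x b a)))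

  -- Two bounds with the same right side combine by weighted geometric means; the power `i + j`
  -- makes the weights integral. This is how Hölder inequalities between moments become transfers of
  -- bounds.
  interpolated : ∀ q i j {A B K D p α₁ α₂ α Y} → 1 ≤ i + j → K ^ (i + j) ≤ A ^ i * B ^ j → (i + j) * α ≡ i * α₁ + j * α₂ →
    D * (p ^ α₁ * A ^ q) ≤ Y → D * (p ^ α₂ * B ^ q) ≤ Y → D * (p ^ α * K ^ q) ≤ Y
  interpolated q i j {A} {B} {K} {D} {p} {α₁} {α₂} {α} {Y} 1≤ K≤ α≡ bA bB = ^-cancelʳ-≤ (i + j) 1≤ (begin
    (D * (p ^ α * K ^ q)) ^ (i + j)
      ≡⟨ trans (distrib-^-* D _ (i + j)) (cong (D ^ (i + j) *_) (distrib-^-* (p ^ α) (K ^ q) (i + j))) ⟩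
    D ^ (i + j) * ((p ^ α) ^ (i + j) * (K ^ q) ^ (i + j))
      ≡⟨ cong₂ (λ u v → D ^ (i + j) * (u * v)) (trans (^-*-assoc p α (i + j)) (cong (p ^_) (trans (*-comm α (i + j)) α≡))) (^-^-comm K q (i + j)) ⟩
    D ^ (i + j) * (p ^ (i * α₁ + j * α₂) * (K ^ (i + j)) ^ q)
      ≤⟨ *-monoʳ-≤ (D ^ (i + j)) (*-monoʳ-≤ (p ^ (i * α₁ + j * α₂)) (^-monoˡ-≤ q K≤)) ⟩
    D ^ (i + j) * (p ^ (i * α₁ + j * α₂) * (A ^ i * B ^ j) ^ q)
      ≡⟨ cong₂ _*_ (^-distribˡ-+-* D i j) (cong₂ _*_ (trans (^-distribˡ-+-* p (i * α₁) (j * α₂)) (cong₂ _*_ (power α₁ i) (power α₂ j)))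
           (trans (distrib-^-* (A ^ i) (B ^ j) q) (cong₂ _*_ (^-^-comm A i q) (^-^-comm B j q)))) ⟩
    D ^ i * D ^ j * ((p ^ α₁) ^ i * (p ^ α₂) ^ j * ((A ^ q) ^ i * (B ^ q) ^ j))
      ≡⟨ lem (D ^ i) (D ^ j) ((p ^ α₁) ^ i) ((p ^ α₂) ^ j) ((A ^ q) ^ i) ((B ^ q) ^ j) ⟩
    D ^ i * ((p ^ α₁) ^ i * (A ^ q) ^ i) * (D ^ j * ((p ^ α₂) ^ j * (B ^ q) ^ j))
      ≡⟨ cong₂ _*_ (collect α₁ A i) (collect α₂ B j) ⟨
    (D * (p ^ α₁ * A ^ q)) ^ i * (D * (p ^ α₂ * B ^ q)) ^ j
      ≤⟨ *-mono-≤ (^-monoˡ-≤ i bA) (^-monoˡ-≤ j bB) ⟩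
    Y ^ i * Y ^ j
      ≡⟨ ^-distribˡ-+-* Y i j ⟨
    Y ^ (i + j) ∎)
    where
    open ≤-Reasoning
    power : ∀ α i → p ^ (i * α) ≡ (p ^ α) ^ i
    power α i = trans (cong (p ^_) (*-comm i α)) (sym (^-*-assoc p α i))
    collect : ∀ α A i → (D * (p ^ α * A ^ q)) ^ i ≡ D ^ i * ((p ^ α) ^ i * (A ^ q) ^ i)
    collect α A i = trans (distrib-^-* D _ i) (cong (D ^ i *_) (distrib-^-* (p ^ α) (A ^ q) i))
    lem : ∀ a b c d e f → a * b * (c * d * (e * f)) ≡ a * (c * e) * (b * (d * f))
    lem = solve-∀

-- Hölder and triangle inequalities for moments in a trace semiring.

module TraceSemirings where

  open import Algebra.Bundles using (CommutativeSemiring)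
  import Algebra.Properties.Semiring.Exp
  import Algebra.Solver.Ring.NaturalCoefficients.Default
  open import Data.List using (List; []; _∷_; length; map; foldr)
  open import Data.List.Relation.Unary.All as All using (All; []; _∷_)
  open import Data.List.Relation.Unary.Any using (here; there)
  open import Data.List.Membership.Propositional using (_∈_)
  open import Data.Nat as ℕ using (ℕ; zero; suc; _≤_; z≤n; _∸_)
  import Data.Nat.Properties as ℕ
  open import Data.Nat.Tactic.RingSolver using () renaming (solve-∀ to ℕ-solve-∀)
  open import Data.Product using (∃; ∃₂; _×_; _,_; proj₁; proj₂)
  open import Data.Sum as Sum using (_⊎_; inj₁; inj₂)
  open import Level using (0ℓ)
  import Relation.Binary.PropositionalEquality as ≡
  open ≡ using (_≡_)
  open import Relation.Binary.PropositionalEquality using (subst)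
  open import Relation.Nullary using (¬_)
  open PowerInequalities

  -- Commutative semirings modelled on trigonometric polynomials with nonnegative
  -- integer coefficients; τ plays the role of the integral over the torus.
  record TraceSemiring : Set₁ where
    field
      commutativeSemiring : CommutativeSemiring 0ℓ 0ℓ
    open CommutativeSemiring commutativeSemiring public
    field
      conj      : Carrier → Carrier
      conj-cong : ∀ {a b} → a ≈ b → conj a ≈ conj b
      conj-+    : ∀ a b → conj (a + b) ≈ conj a + conj b
      conj-*    : ∀ a b → conj (a * b) ≈ conj a * conj b
      conj-1#   : conj 1# ≈ 1#
      conj-0#   : conj 0# ≈ 0#
      conj-conj : ∀ a → conj (conj a) ≈ a
      τ         : Carrier → ℕ
      τ-cong    : ∀ {a b} → a ≈ b → τ a ≡ τ b
      τ-+       : ∀ a b → τ (a + b) ≡ τ a ℕ.+ τ b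
      cauchy-schwarz : ∀ a b → τ (a * conj b) ℕ.* τ (a * conj b) ≤ τ (a * conj a) ℕ.* τ (b * conj b)

  -- a ∋ g says that g occurs among the frequencies of a.
  record GroupTrace {G : Set} (_∙_ : G → G → G) (ε : G) : Set₁ where
    field
      traceSemiring : TraceSemiring
    open TraceSemiring traceSemiring public
    infix 4 _∋_
    field
      point    : G → Carrier
      _∋_      : Carrier → G → Set
      ∋-0#     : ∀ {x} → ¬ 0# ∋ x
      ∋-1#     : ∀ {x} → 1# ∋ x → x ≡ ε
      ∋-point  : ∀ {g x} → point g ∋ x → x ≡ g
      ∋-+      : ∀ a b {x} → a + b ∋ x → a ∋ x ⊎ b ∋ x
      ∋-*      : ∀ a b {x} → a * b ∋ x → ∃₂ λ u v → a ∋ u × b ∋ v × x ≡ u ∙ v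
      disjoint : ∀ a b → (∀ {x} → a ∋ x → ¬ b ∋ x) → τ (a * conj b) ≡ 0
      nsq-point : ∀ g → point g * conj (point g) ≈ 1#
      τ-1#     : τ 1# ≡ 1

  maximal : ∀ {A : Set} (φ : A → ℕ) x xs → ∃ λ y → y ∈ x ∷ xs × All (λ z → φ z ≤ φ y) (x ∷ xs)
  maximal φ x [] = x , here ≡.refl , ℕ.≤-refl ∷ []
  maximal φ x (x′ ∷ xs) with maximal φ x′ xs
  ... | y , y∈ , ps with ℕ.≤-total (φ x) (φ y)
  ...   | inj₁ le = y , there y∈ , le ∷ ps
  ...   | inj₂ ge = x , here ≡.refl , ℕ.≤-refl ∷ All.map (λ p → ℕ.≤-trans p ge) ps

  module TraceLemmas (T : TraceSemiring) where
    open TraceSemiring T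
    open Algebra.Properties.Semiring.Exp semiring public
      using (_^_; ^-congˡ; ^-homo-*)
    private module Solver = Algebra.Solver.Ring.NaturalCoefficients.Default commutativeSemiring
    open Solver using (solve; _:+_; _:*_; _:=_)

    nsq : Carrier → Carrier
    nsq a = a * conj a

    nsq-cong : ∀ {a b} → a ≈ b → nsq a ≈ nsq b
    nsq-cong e = *-cong e (conj-cong e)

    nsq-* : ∀ a b → nsq (a * b) ≈ nsq a * nsq b
    nsq-* a b = trans (*-congˡ (conj-* a b))
      (solve 4 (λ a b c d → a :* b :* (c :* d) := a :* c :* (b :* d)) refl a b (conj a) (conj b))

    conj-nsq : ∀ a → conj (nsq a) ≈ nsq a
    conj-nsq a = trans (conj-* a (conj a)) (trans (*-congˡ (conj-conj a)) (*-comm (conj a) a))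

    nsq-1# : nsq 1# ≈ 1#
    nsq-1# = trans (*-identityˡ (conj 1#)) conj-1#

    nsq-^ : ∀ a n → nsq (a ^ n) ≈ nsq a ^ n
    nsq-^ a zero = nsq-1#
    nsq-^ a (suc n) = trans (nsq-* a (a ^ n)) (*-congˡ (nsq-^ a n))

    τ-0# : τ 0# ≡ 0
    τ-0# = ℕ.+-cancelˡ-≡ (τ 0#) (τ 0#) 0
      (≡.trans (≡.sym (τ-+ 0# 0#)) (≡.trans (τ-cong (+-identityˡ 0#)) (≡.sym (ℕ.+-identityʳ (τ 0#)))))

    infix 4 _⊑_
    -- Coefficientwise order: as coefficients are natural numbers, `τ` and all moments are monotone
    -- in it. It stands in for pointwise bounds on absolute values.
    _⊑_ : Carrier → Carrier → Set
    a ⊑ b = ∃ λ c → b ≈ a + c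

    ⊑-refl : ∀ {a} → a ⊑ a
    ⊑-refl {a} = 0# , sym (+-identityʳ a)

    ⊑-reflexive : ∀ {a b} → a ≈ b → a ⊑ b
    ⊑-reflexive {a} e = 0# , trans (sym e) (sym (+-identityʳ a))

    ⊑-trans : ∀ {a b c} → a ⊑ b → b ⊑ c → a ⊑ c
    ⊑-trans {a} (d , e) (d′ , e′) = d + d′ , trans e′ (trans (+-congʳ e) (+-assoc a d d′))

    *-mono-⊑ : ∀ {a b c d} → a ⊑ b → c ⊑ d → a * c ⊑ b * d
    *-mono-⊑ {a} {b} {c} {d} (x , e) (y , e′) = a * y + x * c + x * y , trans (*-cong e e′)
      (solve 4 (λ a c x y → (a :+ x) :* (c :+ y) := a :* c :+ (a :* y :+ x :* c :+ x :* y)) refl a c x y)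

    ^-mono-⊑ : ∀ {a b} n → a ⊑ b → a ^ n ⊑ b ^ n
    ^-mono-⊑ zero _ = ⊑-refl
    ^-mono-⊑ (suc n) le = *-mono-⊑ le (^-mono-⊑ n le)

    conj-mono-⊑ : ∀ {a b} → a ⊑ b → conj a ⊑ conj b
    conj-mono-⊑ {a} (c , e) = conj c , trans (conj-cong e) (conj-+ a c)

    nsq-mono-⊑ : ∀ {a b} → a ⊑ b → nsq a ⊑ nsq b
    nsq-mono-⊑ le = *-mono-⊑ le (conj-mono-⊑ le)

    τ-mono : ∀ {a b} → a ⊑ b → τ a ≤ τ b
    τ-mono {a} (c , e) = subst (τ a ≤_) (≡.sym (≡.trans (τ-cong e) (τ-+ a c))) (ℕ.m≤m+n (τ a) (τ c))

    cs-selfadjoint : ∀ h k c → conj h ≈ h → conj k ≈ k →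
      τ (h * k * nsq c) ℕ.* τ (h * k * nsq c) ≤ τ (h * h * nsq c) ℕ.* τ (k * k * nsq c)
    cs-selfadjoint h k c h* k* =
      ≡.subst₂ _≤_ (≡.cong₂ ℕ._*_ (τ-cong e₁) (τ-cong e₁)) (≡.cong₂ ℕ._*_ (τ-cong (e₂ h h*)) (τ-cong (e₂ k k*)))
        (cauchy-schwarz (h * c) (k * c))
      where
      e₁ : h * c * conj (k * c) ≈ h * k * nsq c
      e₁ = trans (*-congˡ (trans (conj-* k c) (*-congʳ k*)))
        (solve 4 (λ h k c d → h :* c :* (k :* d) := h :* k :* (c :* d)) refl h k c (conj c))
      e₂ : ∀ h → conj h ≈ h → h * c * conj (h * c) ≈ h * h * nsq c
      e₂ h h* = trans (*-congˡ (trans (conj-* h c) (*-congʳ h*)))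
        (solve 3 (λ h c d → h :* c :* (h :* d) := h :* h :* (c :* d)) refl h c (conj c))

    -- The integral of |f|^(2u) |g|^(2v) |w|²; the weight `w` collects everything held fixed.
    mixed : Carrier → Carrier → Carrier → ℕ → ℕ → ℕ
    mixed f g w u v = τ (nsq f ^ u * nsq g ^ v * nsq w)

    private
      -- Cauchy-Schwarz for |f|² c and |g|² c with c = f^u g^v w.
      mixed-logconvex : ∀ f g w u v →
        mixed f g w (suc u) (suc v) ℕ.* mixed f g w (suc u) (suc v) ≤
        mixed f g w u (2 ℕ.+ v) ℕ.* mixed f g w (2 ℕ.+ u) v
      mixed-logconvex f g w u v = ≡.subst₂ _≤_
        (≡.cong₂ ℕ._*_ (τ-cong e₁) (τ-cong e₁))
        (≡.trans (≡.cong₂ ℕ._*_ (τ-cong e₂) (τ-cong e₃)) (ℕ.*-comm (mixed f g w (2 ℕ.+ u) v) _))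
        (cs-selfadjoint (nsq f) (nsq g) c (conj-nsq f) (conj-nsq g))
        where
        c = f ^ u * g ^ v * w
        ec : nsq c ≈ nsq f ^ u * nsq g ^ v * nsq w
        ec = trans (nsq-* (f ^ u * g ^ v) w) (*-congʳ (trans (nsq-* (f ^ u) (g ^ v)) (*-cong (nsq-^ f u) (nsq-^ g v))))
        e₁ : nsq f * nsq g * nsq c ≈ nsq f ^ suc u * nsq g ^ suc v * nsq w
        e₁ = trans (*-congˡ ec) (solve 5 (λ h k x y z → h :* k :* (x :* y :* z) := h :* x :* (k :* y) :* z)
          refl (nsq f) (nsq g) (nsq f ^ u) (nsq g ^ v) (nsq w))
        e₂ : nsq f * nsq f * nsq c ≈ nsq f ^ (2 ℕ.+ u) * nsq g ^ v * nsq w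
        e₂ = trans (*-congˡ ec) (solve 4 (λ h x y z → h :* h :* (x :* y :* z) := h :* (h :* x) :* y :* z)
          refl (nsq f) (nsq f ^ u) (nsq g ^ v) (nsq w))
        e₃ : nsq g * nsq g * nsq c ≈ nsq f ^ u * nsq g ^ (2 ℕ.+ v) * nsq w
        e₃ = trans (*-congˡ ec) (solve 4 (λ k x y z → k :* k :* (x :* y :* z) := x :* (k :* (k :* y)) :* z)
          refl (nsq g) (nsq f ^ u) (nsq g ^ v) (nsq w))

    -- Along a segment of exponents with constant sum the mixed moments are log-convex, so
    -- `interpolate` applies between the two ends.
    hölder : ∀ f g w x y j d →
      mixed f g w (j ℕ.+ x) (d ℕ.+ y) ℕ.^ (j ℕ.+ d) ≤
      mixed f g w x (j ℕ.+ d ℕ.+ y) ℕ.^ d ℕ.* mixed f g w (j ℕ.+ d ℕ.+ x) y ℕ.^ j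
    hölder f g w x y j d = ≡.subst₂ _≤_
      (≡.cong (λ z → mixed f g w (j ℕ.+ x) (z ℕ.+ y) ℕ.^ (j ℕ.+ d)) (ℕ.m+n∸m≡n j d))
      (≡.cong (λ z → M 0 ℕ.^ d ℕ.* mixed f g w (j ℕ.+ d ℕ.+ x) (z ℕ.+ y) ℕ.^ j) (ℕ.n∸n≡0 (j ℕ.+ d)))
      (LogConvex.interpolate M j d lc)
      where
      M : ℕ → ℕ
      M i = mixed f g w (i ℕ.+ x) (j ℕ.+ d ∸ i ℕ.+ y)
      lc : ∀ i → 2 ℕ.+ i ≤ j ℕ.+ d → M (suc i) ℕ.* M (suc i) ≤ M i ℕ.* M (2 ℕ.+ i)
      -- The rewrites express the truncated differences in `M` at i, 1 + i and 2 + i as successors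
      -- of `j + d ∸ (2 + i)`, the form that `mixed-logconvex` takes.
      lc i le rewrite ≡.sym (ℕ.m+[n∸m]≡n le) | ℕ.m+n∸m≡n i (j ℕ.+ d ∸ (2 ℕ.+ i))
                    | ≡.sym (ℕ.+-suc i (j ℕ.+ d ∸ (2 ℕ.+ i))) | ℕ.m+n∸m≡n i (suc (j ℕ.+ d ∸ (2 ℕ.+ i)))
                    | ≡.sym (ℕ.+-suc i (suc (j ℕ.+ d ∸ (2 ℕ.+ i)))) | ℕ.m+n∸m≡n i (2 ℕ.+ (j ℕ.+ d ∸ (2 ℕ.+ i)))
        = mixed-logconvex f g w (i ℕ.+ x) (j ℕ.+ d ∸ (2 ℕ.+ i) ℕ.+ y)

    sumR : List Carrier → Carrier
    sumR = foldr _+_ 0#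

    Bounded : Carrier → ℕ → Carrier → Set
    Bounded w B f = τ (nsq f * nsq w) ≤ B

    private
      cross-bound : ∀ {w B f g} → Bounded w B f → Bounded w B g → τ (f * conj g * nsq w) ≤ B
      cross-bound {w} {B} {f} {g} p q = square-mono⁻¹ (ℕ.≤-trans
        (≡.subst₂ _≤_ (≡.cong₂ ℕ._*_ (τ-cong e₁) (τ-cong e₁)) (≡.cong₂ ℕ._*_ (τ-cong (nsq-* f w)) (τ-cong (nsq-* g w)))
          (cauchy-schwarz (f * w) (g * w)))
        (ℕ.*-mono-≤ p q))
        where
        e₁ : f * w * conj (g * w) ≈ f * conj g * nsq w
        e₁ = trans (*-congˡ (conj-* g w))
          (solve 4 (λ f w x y → f :* w :* (x :* y) := f :* x :* (w :* y)) refl f w (conj g) (conj w))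

      row-bound : ∀ {w B f} gs → Bounded w B f → All (Bounded w B) gs →
        τ (f * conj (sumR gs) * nsq w) ≤ length gs ℕ.* B
      row-bound {w} {B} {f} [] p [] = ℕ.≤-reflexive (≡.trans
        (τ-cong (trans (*-congʳ (trans (*-congˡ conj-0#) (zeroʳ f))) (zeroˡ (nsq w)))) τ-0#)
      row-bound {w} {B} {f} (g ∷ gs) p (q ∷ qs) = subst (_≤ length (g ∷ gs) ℕ.* B)
        (≡.sym (≡.trans (τ-cong (trans (*-congʳ (*-congˡ (conj-+ g (sumR gs))))
          (solve 4 (λ f x y z → f :* (x :+ y) :* z := f :* x :* z :+ f :* y :* z) refl f (conj g) (conj (sumR gs)) (nsq w))))
          (τ-+ _ _)))
        (ℕ.+-mono-≤ (cross-bound p q) (row-bound gs p qs))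

      total-bound : ∀ {w B gs} fs → All (Bounded w B) fs → All (Bounded w B) gs →
        τ (sumR fs * conj (sumR gs) * nsq w) ≤ length fs ℕ.* (length gs ℕ.* B)
      total-bound {w} {B} {gs} [] [] qs = ℕ.≤-reflexive (≡.trans
        (τ-cong (trans (*-congʳ (zeroˡ _)) (zeroˡ (nsq w)))) τ-0#)
      total-bound {w} {B} {gs} (f ∷ fs) (p ∷ ps) qs = subst (_≤ length (f ∷ fs) ℕ.* (length gs ℕ.* B))
        (≡.sym (≡.trans (τ-cong (solve 4 (λ f x y z → (f :+ x) :* y :* z := f :* y :* z :+ x :* y :* z)
          refl f (sumR fs) (conj (sumR gs)) (nsq w))) (τ-+ _ _)))
        (ℕ.+-mono-≤ (row-bound gs p qs) (total-bound fs ps qs))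

    -- Expand the square into pairs; Cauchy-Schwarz bounds every cross term by `B`, so the cost is
    -- the squared number of summands.
    triangle : ∀ {w B F} fs → F ≈ sumR fs → All (Bounded w B) fs → Bounded w (length fs ℕ.* length fs ℕ.* B) F
    triangle {w} {B} fs e ps = ℕ.≤-trans (ℕ.≤-reflexive (τ-cong (*-congʳ (nsq-cong e))))
      (ℕ.≤-trans (total-bound fs ps ps) (ℕ.≤-reflexive (≡.sym (ℕ.*-assoc (length fs) (length fs) B))))

    mixed₀ : ∀ f g w v → mixed f g w 0 v ≡ τ (nsq g ^ v * nsq w)
    mixed₀ f g w v = τ-cong (*-congʳ (*-identityˡ (nsq g ^ v)))

    mixed₀′ : ∀ f g w u → mixed f g w u 0 ≡ τ (nsq f ^ u * nsq w)
    mixed₀′ f g w u = τ-cong (*-congʳ (*-identityʳ (nsq f ^ u)))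

    nsq-^* : ∀ f n w → nsq (f ^ n * w) ≈ nsq f ^ n * nsq w
    nsq-^* f n w = trans (nsq-* (f ^ n) w) (*-congʳ (nsq-^ f n))

    -- Minkowski's inequality with the largest summand. `triangle` with weight `F ^ v * w` leaves
    -- one summand f; Hölder bounds its term by powers of the left side Q and of `B`, and `Q ^ v`
    -- cancels.
    power-triangle : ∀ {w B F} fs v → F ≈ sumR fs → All (λ f → τ (nsq f ^ suc v * nsq w) ≤ B) fs →
      τ (nsq F ^ suc v * nsq w) ≤ (length fs ℕ.* length fs) ℕ.^ suc v ℕ.* B
    power-triangle {w} {B} {F} [] v e [] = ℕ.≤-trans (ℕ.≤-reflexive (≡.trans (τ-cong
      (trans (*-congʳ (trans (*-congʳ (trans (*-congʳ e) (zeroˡ _))) (zeroˡ _))) (zeroˡ (nsq w)))) τ-0#)) z≤n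
    power-triangle {w} {B} {F} fs@(f₀ ∷ fs′) v e ps
      with maximal (λ f → τ (nsq f * nsq (F ^ v * w))) f₀ fs′
    ... | f , f∈ , maxi = cancel
      where
      open ℕ.≤-Reasoning
      Q = τ (nsq F ^ suc v * nsq w)
      m² = length fs ℕ.* length fs
      X = τ (nsq f * nsq (F ^ v * w))
      Q≤ : Q ≤ m² ℕ.* X
      Q≤ = ℕ.≤-trans (ℕ.≤-reflexive (τ-cong
        (trans (*-assoc (nsq F) (nsq F ^ v) (nsq w)) (*-congˡ (sym (nsq-^* F v w)))))) (triangle fs e maxi)
      X≤ : X ℕ.^ suc v ≤ Q ℕ.^ v ℕ.* B
      X≤ = begin
        X ℕ.^ suc v ≡⟨ ≡.cong (ℕ._^ suc v) (τ-cong (trans (*-congˡ (nsq-^* F v w)) (trans (sym (*-assoc (nsq f) _ (nsq w)))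
                         (*-congʳ (*-congʳ (sym (*-identityʳ (nsq f)))))))) ⟩
        mixed f F w 1 v ℕ.^ suc v ≡⟨ ≡.cong (λ z → mixed f F w 1 z ℕ.^ suc v) (ℕ.+-identityʳ v) ⟨
        mixed f F w 1 (v ℕ.+ 0) ℕ.^ suc v ≤⟨ hölder f F w 0 0 1 v ⟩
        mixed f F w 0 (suc v ℕ.+ 0) ℕ.^ v ℕ.* mixed f F w (suc v ℕ.+ 0) 0 ℕ.^ 1
          ≡⟨ ≡.cong₂ ℕ._*_ (≡.cong (ℕ._^ v) (≡.trans (mixed₀ f F w (suc v ℕ.+ 0)) (≡.cong (λ z → τ (nsq F ^ z * nsq w)) (ℕ.+-identityʳ (suc v)))))
              (≡.trans (ℕ.^-identityʳ _) (≡.trans (mixed₀′ f F w (suc v ℕ.+ 0)) (≡.cong (λ z → τ (nsq f ^ z * nsq w)) (ℕ.+-identityʳ (suc v))))) ⟩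
        Q ℕ.^ v ℕ.* τ (nsq f ^ suc v * nsq w) ≤⟨ ℕ.*-monoʳ-≤ (Q ℕ.^ v) (All.lookup ps f∈) ⟩
        Q ℕ.^ v ℕ.* B ∎
      Q^≤ : Q ℕ.^ v ℕ.* Q ≤ Q ℕ.^ v ℕ.* (m² ℕ.^ suc v ℕ.* B)
      Q^≤ = begin
        Q ℕ.^ v ℕ.* Q ≡⟨ ℕ.*-comm (Q ℕ.^ v) Q ⟩
        Q ℕ.^ suc v ≤⟨ ℕ.^-monoˡ-≤ (suc v) Q≤ ⟩
        (m² ℕ.* X) ℕ.^ suc v ≡⟨ distrib-^-* m² X (suc v) ⟩
        m² ℕ.^ suc v ℕ.* X ℕ.^ suc v ≤⟨ ℕ.*-monoʳ-≤ (m² ℕ.^ suc v) X≤ ⟩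
        m² ℕ.^ suc v ℕ.* (Q ℕ.^ v ℕ.* B) ≡⟨ rearrange (m² ℕ.^ suc v) (Q ℕ.^ v) B ⟩
        Q ℕ.^ v ℕ.* (m² ℕ.^ suc v ℕ.* B) ∎
        where
        rearrange : ∀ a b c → a ℕ.* (b ℕ.* c) ≡ b ℕ.* (a ℕ.* c)
        rearrange = ℕ-solve-∀
      cancel : Q ≤ m² ℕ.^ suc v ℕ.* B
      cancel with Q in eq
      ... | zero = z≤n
      ... | suc q = *-cancel-≤-pos (suc q ℕ.^ v) (ℕ.m^n>0 (suc q) v)
        (subst (λ z → z ℕ.^ v ℕ.* z ≤ z ℕ.^ v ℕ.* (m² ℕ.^ suc v ℕ.* B)) eq Q^≤)

    private
      -- F ^ n − f ^ n = (F − f) Σ_{i<n} F ^ i f ^ (n − 1 − i)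
      power-difference : ∀ {F f g} n → F ≈ f + g → ∃ λ es →
        (F ^ suc n ≈ f ^ suc n + g * sumR es) × length es ≡ suc n × All (λ e → nsq e ⊑ nsq F ^ n) es
      power-difference {F} {f} {g} zero e = 1# ∷ [] ,
        trans (*-identityʳ F) (trans e (+-cong (sym (*-identityʳ f))
          (trans (sym (*-identityʳ g)) (*-congˡ (sym (+-identityʳ 1#)))))) ,
        ≡.refl , ⊑-reflexive nsq-1# ∷ []
      power-difference {F} {f} {g} (suc n) e with power-difference {F} {f} {g} n e
      ... | es , eq , len , small = F ^ suc n ∷ map (f *_) es ,
        trans (*-congʳ e) (trans (solve 3 (λ f g x → (f :+ g) :* x := f :* x :+ g :* x) refl f g (F ^ suc n))
          (trans (+-congʳ (*-congˡ eq))
          (trans (solve 5 (λ f g a b x → f :* (a :+ g :* b) :+ g :* x := f :* a :+ g :* (x :+ f :* b))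
            refl f g (f ^ suc n) (sumR es) (F ^ suc n))
          (+-congˡ (*-congˡ (+-congˡ (sym (sumR-map es)))))))) ,
        ≡.cong suc (≡.trans (length-map es) len) ,
        ⊑-reflexive (nsq-^ F (suc n)) ∷ all-map small
        where
        sumR-map : ∀ xs → sumR (map (f *_) xs) ≈ f * sumR xs
        sumR-map [] = sym (zeroʳ f)
        sumR-map (x ∷ xs) = trans (+-congˡ (sumR-map xs)) (sym (distribˡ f x (sumR xs)))
        length-map : ∀ (xs : List Carrier) → length (map (f *_) xs) ≡ length xs
        length-map [] = ≡.refl
        length-map (x ∷ xs) = ≡.cong suc (length-map xs)
        all-map : ∀ {xs} → All (λ x → nsq x ⊑ nsq F ^ n) xs → All (λ x → nsq x ⊑ nsq F ^ suc n) (map (f *_) xs)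
        all-map [] = []
        all-map {x ∷ _} (p ∷ ps) = ⊑-trans (⊑-reflexive (nsq-* f x)) (*-mono-⊑ (nsq-mono-⊑ (g , e)) p) ∷ all-map ps

    -- Expand F ^ (2 + n) for F = Σᵢ fᵢ: either the diagonal terms fᵢ ^ (2 + n)
    -- dominate or the terms containing some fᵢ and a piece of gᵢ = F − fᵢ do.
    diagonal-or-off-diagonal : ∀ {I : Set} (is : List I) (f g : I → Carrier) (gs : I → List Carrier) F w n m {A B} →
      F ≈ sumR (map f is) → (∀ i → F ≈ f i + g i) → (∀ i → g i ≈ sumR (gs i)) → (∀ i → length (gs i) ≡ m) →
      All (λ i → τ (nsq (f i) ^ (2 ℕ.+ n) * nsq w) ≤ A) is →
      All (λ i → All (λ x → τ (nsq (f i) * nsq x * nsq F ^ n * nsq w) ≤ B) (gs i)) is →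
      let p² = length is ℕ.* length is in
      τ (nsq F ^ (2 ℕ.+ n) * nsq w) ≤ 4 ℕ.* (p² ℕ.* A) ⊎
      τ (nsq F ^ (2 ℕ.+ n) * nsq w) ≤ 4 ℕ.* (p² ℕ.* (suc n ℕ.* suc n ℕ.* (m ℕ.* m ℕ.* B)))
    diagonal-or-off-diagonal {I} is f g gs F w n m {A} {B} F≈ split pieces len diag off
      with ℕ.≤-total (p² ℕ.* A) (p² ℕ.* (suc n ℕ.* suc n ℕ.* (m ℕ.* m ℕ.* B)))
      where p² = length is ℕ.* length is
    ... | le = Sum.swap (Sum.map (λ l → bound l ℕ.≤-refl) (λ l → bound ℕ.≤-refl l) le)
      where
      p² = length is ℕ.* length is
      es : ∀ i → List Carrier
      es i = proj₁ (power-difference n (split i))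
      dterm oterm : I → Carrier
      dterm i = f i ^ (2 ℕ.+ n)
      oterm i = f i * (g i * sumR (es i))
      length-map : ∀ {X Y : Set} (φ : X → Y) xs → length (map φ xs) ≡ length xs
      length-map φ [] = ≡.refl
      length-map φ (x ∷ xs) = ≡.cong suc (length-map φ xs)
      all-map : ∀ (φ : I → Carrier) {P : Carrier → Set} {xs} → All (λ i → P (φ i)) xs → All P (map φ xs)
      all-map φ [] = []
      all-map φ (p ∷ ps) = p ∷ all-map φ ps
      -- One factor of `F ^ (2 + n)` is written as the sum of the fᵢ, and the `F ^ suc n` standing
      -- next to fᵢ is expanded around fᵢ.
      expand : ∀ xs → sumR (map f xs) * F ^ suc n ≈ sumR (map dterm xs) + sumR (map oterm xs)
      expand [] = trans (zeroˡ _) (sym (+-identityˡ 0#))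
      expand (x ∷ xs) = trans (distribʳ _ (f x) (sumR (map f xs)))
        (trans (+-cong (trans (*-congˡ (proj₁ (proj₂ (power-difference n (split x))))) (distribˡ (f x) _ _)) (expand xs))
          (solve 4 (λ a b c d → (a :+ b) :+ (c :+ d) := (a :+ c) :+ (b :+ d)) refl _ _ _ _))
      F^≈ : F ^ (2 ℕ.+ n) ≈ sumR (map dterm is) + sumR (map oterm is)
      F^≈ = trans (*-congʳ F≈) (expand is)
      diag-bound : Bounded w (p² ℕ.* A) (sumR (map dterm is))
      diag-bound = subst (λ l → Bounded w (l ℕ.* l ℕ.* A) (sumR (map dterm is))) (length-map dterm is)
        (triangle (map dterm is) refl
          (all-map dterm (All.map (λ {i} → ℕ.≤-trans (ℕ.≤-reflexive (τ-cong (*-congʳ (nsq-^ (f i) (2 ℕ.+ n)))))) diag)))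
      OffBound : I → Set
      OffBound i = All (λ x → τ (nsq (f i) * nsq x * nsq F ^ n * nsq w) ≤ B) (gs i)
      piece-bound : ∀ i → OffBound i → τ (nsq (g i) * nsq (f i * F ^ n * w)) ≤ m ℕ.* m ℕ.* B
      piece-bound i o = subst (λ l → τ (nsq (g i) * nsq (f i * F ^ n * w)) ≤ l ℕ.* l ℕ.* B) (len i)
        (triangle (gs i) (pieces i) (All.map (λ {x} → ℕ.≤-trans (ℕ.≤-reflexive (τ-cong (trans (*-congˡ (trans (nsq-* (f i * F ^ n) w)
          (*-congʳ (trans (nsq-* (f i) (F ^ n)) (*-congˡ (nsq-^ F n))))))
          (solve 4 (λ a b c d → a :* (b :* c :* d) := b :* a :* c :* d) refl (nsq x) (nsq (f i)) (nsq F ^ n) (nsq w)))))) o))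
      -- In absolute square each cofactor is coefficientwise below `F ^ n`, so it may be replaced by
      -- `F ^ n`; what remains is `piece-bound`.
      e-bound : ∀ i → OffBound i → All (Bounded (f i * g i * w) (m ℕ.* m ℕ.* B)) (es i)
      e-bound i o = All.map (λ {x} small → ℕ.≤-trans (τ-mono (⊑-trans
        (*-mono-⊑ small (⊑-reflexive {nsq (f i * g i * w)} refl))
        (⊑-reflexive (trans (*-congˡ (trans (nsq-* (f i * g i) w) (*-congʳ (nsq-* (f i) (g i)))))
          (trans (solve 4 (λ a b c d → a :* (b :* c :* d) := c :* (b :* a :* d)) refl (nsq F ^ n) (nsq (f i)) (nsq (g i)) (nsq w))
          (*-congˡ (sym (trans (nsq-* (f i * F ^ n) w) (*-congʳ (trans (nsq-* (f i) (F ^ n)) (*-congˡ (nsq-^ F n))))))))))))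
        (piece-bound i o)) (proj₂ (proj₂ (proj₂ (power-difference n (split i)))))
      oterm-bound : ∀ {i} → OffBound i → Bounded w (suc n ℕ.* suc n ℕ.* (m ℕ.* m ℕ.* B)) (oterm i)
      oterm-bound {i} o = ℕ.≤-trans (ℕ.≤-reflexive (τ-cong
        (trans (*-congʳ (trans (nsq-* (f i) _) (*-congˡ (nsq-* (g i) _))))
        (trans (solve 4 (λ a b c d → a :* (b :* c) :* d := c :* (a :* b :* d)) refl (nsq (f i)) (nsq (g i)) (nsq (sumR (es i))) (nsq w))
        (*-congˡ (sym (trans (nsq-* (f i * g i) w) (*-congʳ (nsq-* (f i) (g i))))))))))
        (subst (λ l → τ (nsq (sumR (es i)) * nsq (f i * g i * w)) ≤ l ℕ.* l ℕ.* (m ℕ.* m ℕ.* B))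
          (proj₁ (proj₂ (proj₂ (power-difference n (split i))))) (triangle (es i) refl (e-bound i o)))
      off-bound : Bounded w (p² ℕ.* (suc n ℕ.* suc n ℕ.* (m ℕ.* m ℕ.* B))) (sumR (map oterm is))
      off-bound = subst (λ l → Bounded w (l ℕ.* l ℕ.* (suc n ℕ.* suc n ℕ.* (m ℕ.* m ℕ.* B))) (sumR (map oterm is))) (length-map oterm is)
        (triangle (map oterm is) refl (all-map oterm (All.map oterm-bound off)))
      bound : ∀ {X} → p² ℕ.* A ≤ X → p² ℕ.* (suc n ℕ.* suc n ℕ.* (m ℕ.* m ℕ.* B)) ≤ X →
        τ (nsq F ^ (2 ℕ.+ n) * nsq w) ≤ 4 ℕ.* X
      bound le₁ le₂ = ℕ.≤-trans (ℕ.≤-reflexive (τ-cong (*-congʳ (sym (nsq-^ F (2 ℕ.+ n))))))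
        (triangle (sumR (map dterm is) ∷ sumR (map oterm is) ∷ []) (trans F^≈ (+-congˡ (sym (+-identityʳ _))))
          (ℕ.≤-trans diag-bound le₁ ∷ ℕ.≤-trans off-bound le₂ ∷ []))

    -- Hölder between g and F with weight f w. In the pure F term, |f|² is enlarged to |F|², which
    -- produces a power of the full moment that can later be cancelled.
    off-diagonal-hölder : ∀ {f g F} w n → f ⊑ F →
      τ (nsq f * nsq g * nsq F ^ n * nsq w) ℕ.^ suc n ≤
      τ (nsq F ^ (2 ℕ.+ n) * nsq w) ℕ.^ n ℕ.* mixed f g w 1 (suc n)
    off-diagonal-hölder {f} {g} {F} w n le = ≡.subst₂ _≤_
      (≡.cong (ℕ._^ suc n) (≡.trans (≡.cong (mixed g F (f * w) 1) (ℕ.+-identityʳ n)) (τ-cong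
        (trans (*-cong (*-congʳ (*-identityʳ (nsq g))) (nsq-* f w))
          (solve 4 (λ g x f w → g :* x :* (f :* w) := f :* g :* x :* w) refl (nsq g) (nsq F ^ n) (nsq f) (nsq w))))))
      ≡.refl
      (ℕ.≤-trans (hölder g F (f * w) 0 0 1 n) (ℕ.*-mono-≤ (ℕ.^-monoˡ-≤ n
        (ℕ.≤-trans (ℕ.≤-reflexive (≡.trans (≡.cong (mixed g F (f * w) 0) (ℕ.+-identityʳ (suc n))) (τ-cong
          (trans (*-cong (*-identityˡ _) (nsq-* f w))
            (solve 3 (λ x f w → x :* (f :* w) := f :* x :* w) refl (nsq F ^ suc n) (nsq f) (nsq w))))))
          (τ-mono (*-mono-⊑ (*-mono-⊑ (nsq-mono-⊑ le) (⊑-refl {nsq F ^ suc n})) (⊑-refl {nsq w})))))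
        (ℕ.≤-reflexive (≡.trans (ℕ.^-identityʳ _) (≡.trans (≡.cong (λ z → mixed g F (f * w) z 0) (ℕ.+-identityʳ (suc n))) (τ-cong
          (trans (*-cong (*-identityʳ _) (nsq-* f w))
            (trans (solve 3 (λ x f w → x :* (f :* w) := f :* x :* w) refl (nsq g ^ suc n) (nsq f) (nsq w))
              (*-congʳ (*-congʳ (sym (*-identityʳ (nsq f)))))))))))))

    mixed-sym : ∀ f g w u v → mixed f g w u v ≡ mixed g f w v u
    mixed-sym f g w u v = τ-cong (*-congʳ (*-comm (nsq f ^ u) (nsq g ^ v)))

    -- Moves g into the weight: this is how one class is decoupled while the other stays fixed.
    mixed-absorb : ∀ f g w u v → mixed f g w u v ≡ τ (nsq f ^ u * nsq (g ^ v * w))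
    mixed-absorb f g w u v = τ-cong (trans (*-assoc _ _ _) (*-congˡ (sym (nsq-^* g v w))))

    hölder-ends : ∀ f g w u v → mixed f g w u v ℕ.^ (v ℕ.+ u) ≤
      τ (nsq g ^ (u ℕ.+ v) * nsq w) ℕ.^ v ℕ.* τ (nsq f ^ (u ℕ.+ v) * nsq w) ℕ.^ u
    hölder-ends f g w u v = ≡.subst₂ _≤_
      (≡.cong₂ ℕ._^_ (≡.cong₂ (mixed f g w) (ℕ.+-identityʳ u) (ℕ.+-identityʳ v)) (ℕ.+-comm u v))
      (≡.cong₂ (λ a b → a ℕ.^ v ℕ.* b ℕ.^ u)
        (≡.trans (mixed₀ f g w (u ℕ.+ v ℕ.+ 0)) (≡.cong (λ z → τ (nsq g ^ z * nsq w)) (ℕ.+-identityʳ (u ℕ.+ v))))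
        (≡.trans (mixed₀′ f g w (u ℕ.+ v ℕ.+ 0)) (≡.cong (λ z → τ (nsq f ^ z * nsq w)) (ℕ.+-identityʳ (u ℕ.+ v)))))
      (hölder f g w 0 0 u v)

    mixed-zeroˡ : ∀ g w u v → mixed 0# g w (suc u) v ≡ 0
    mixed-zeroˡ g w u v = ≡.trans (τ-cong (trans (*-congʳ (trans (*-congʳ (trans (*-congʳ (zeroˡ _)) (zeroˡ _))) (zeroˡ _))) (zeroˡ _))) τ-0#

    mixed-zeroʳ : ∀ f w u v → mixed f 0# w u (suc v) ≡ 0
    mixed-zeroʳ f w u v = ≡.trans (mixed-sym f 0# w u (suc v)) (mixed-zeroˡ f w v u)

    1#^ : ∀ n → 1# ^ n ≈ 1#
    1#^ zero = refl
    1#^ (suc n) = trans (*-identityˡ (1# ^ n)) (1#^ n)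

-- The semiring ℕ[G] of finite formal sums and its Cauchy-Schwarz inequality.

module GroupSemirings where

  open import Algebra.Bundles using (AbelianGroup; CommutativeSemiring)
  open import Algebra.Structures using (IsAbelianGroup)
  import Algebra.Properties.AbelianGroup
  import Algebra.Structures.Biased
  open import Data.Bool using (if_then_else_)
  open import Data.List using (List; []; _∷_; _++_; map)
  open import Data.List.Membership.Propositional using (_∈_)
  open import Data.List.Membership.Propositional.Properties using (∈-++⁻; ∈-map⁻)
  open import Data.List.Relation.Unary.Any using (here; there)
  open import Data.Nat using (ℕ; zero; suc; _+_; _*_; _≤_; z≤n; s≤s)
  open import Data.Nat.Properties
  open import Data.Nat.Tactic.RingSolver using (solve-∀)
  open import Data.Product using (∃₂; _×_; _,_)
  open import Data.Sum using (inj₁; inj₂)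
  open import Level using (0ℓ)
  open import Relation.Binary.Definitions using (DecidableEquality)
  open import Relation.Binary.PropositionalEquality hiding (isEquivalence)
  open import Relation.Binary.Structures using (IsEquivalence)
  open import Relation.Nullary using (¬_; yes; no; does; contradiction)
  open PowerInequalities
  open TraceSemirings

  ∑ : {A : Set} → List A → (A → ℕ) → ℕ
  ∑ [] w = 0
  ∑ (x ∷ xs) w = w x + ∑ xs w

  ∑-cong : ∀ {A : Set} (a : List A) {v w} → (∀ x → v x ≡ w x) → ∑ a v ≡ ∑ a w
  ∑-cong [] e = refl
  ∑-cong (x ∷ a) e = cong₂ _+_ (e x) (∑-cong a e)

  ∑-zero : ∀ {A : Set} (a : List A) → ∑ a (λ _ → 0) ≡ 0
  ∑-zero [] = refl
  ∑-zero (_ ∷ a) = ∑-zero a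

  ∑-+ : ∀ {A : Set} (a : List A) v w → ∑ a (λ x → v x + w x) ≡ ∑ a v + ∑ a w
  ∑-+ [] v w = refl
  ∑-+ (x ∷ a) v w rewrite ∑-+ a v w = lem (v x) (w x) (∑ a v) (∑ a w)
    where
    lem : ∀ p q r s → p + q + (r + s) ≡ p + r + (q + s)
    lem = solve-∀

  ∑-++ : ∀ {A : Set} (a b : List A) w → ∑ (a ++ b) w ≡ ∑ a w + ∑ b w
  ∑-++ [] b w = refl
  ∑-++ (x ∷ a) b w rewrite ∑-++ a b w = sym (+-assoc (w x) (∑ a w) (∑ b w))

  ∑-swap : ∀ {A B : Set} (a : List A) (b : List B) (w : A → B → ℕ) →
    ∑ a (λ x → ∑ b (w x)) ≡ ∑ b (λ y → ∑ a (λ x → w x y))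
  ∑-swap [] b w = sym (∑-zero b)
  ∑-swap (x ∷ a) b w rewrite ∑-swap a b w = sym (∑-+ b (w x) (λ y → ∑ a (λ x → w x y)))

  ∑-map : ∀ {A B : Set} (φ : A → B) a w → ∑ (map φ a) w ≡ ∑ a (λ x → w (φ x))
  ∑-map φ [] w = refl
  ∑-map φ (x ∷ a) w = cong (w (φ x) +_) (∑-map φ a w)

  module GroupSemiring {G : Set} (_∙_ : G → G → G) (ε : G) (_⁻¹ : G → G)
    (isAbelianGroup : IsAbelianGroup _≡_ _∙_ ε _⁻¹) (_≟_ : DecidableEquality G) where

    open IsAbelianGroup isAbelianGroup using (assoc; comm; identityˡ; inverseʳ)
    private
      abelianGroup : AbelianGroup 0ℓ 0ℓ
      abelianGroup = record { isAbelianGroup = isAbelianGroup }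
      module GP = Algebra.Properties.AbelianGroup abelianGroup

    infix 4 _≈_
    -- A list is a formal sum. Testing against all weights is equality up to order, and it reduces
    -- each semiring law to an identity of iterated sums.
    record _≈_ (a b : List G) : Set where
      constructor same
      field at : ∀ w → ∑ a w ≡ ∑ b w
    open _≈_ public

    infixl 7 _⋆_
    _⋆_ : List G → List G → List G
    [] ⋆ b = []
    (x ∷ a) ⋆ b = map (x ∙_) b ++ a ⋆ b

    ∑-⋆ : ∀ a b w → ∑ (a ⋆ b) w ≡ ∑ a (λ x → ∑ b (λ y → w (x ∙ y)))
    ∑-⋆ [] b w = refl
    ∑-⋆ (x ∷ a) b w = trans (∑-++ (map (x ∙_) b) (a ⋆ b) w) (cong₂ _+_ (∑-map (x ∙_) b w) (∑-⋆ a b w))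

    ≈-refl : ∀ {a} → a ≈ a
    ≈-refl = same λ w → refl

    ++-cong : ∀ {a b c d} → a ≈ b → c ≈ d → a ++ c ≈ b ++ d
    ++-cong {a} {b} {c} {d} e f = same λ w →
      trans (∑-++ a c w) (trans (cong₂ _+_ (at e w) (at f w)) (sym (∑-++ b d w)))

    ++-comm : ∀ a b → a ++ b ≈ b ++ a
    ++-comm a b = same λ w → trans (∑-++ a b w) (trans (+-comm (∑ a w) (∑ b w)) (sym (∑-++ b a w)))

    ++-assoc′ : ∀ a b c → (a ++ b) ++ c ≈ a ++ (b ++ c)
    ++-assoc′ [] b c = ≈-refl
    ++-assoc′ (x ∷ a) b c = same λ w → cong (w x +_) (at (++-assoc′ a b c) w)

    ⋆-cong : ∀ {a b c d} → a ≈ b → c ≈ d → a ⋆ c ≈ b ⋆ d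
    ⋆-cong {a} {b} {c} {d} e f = same λ w → trans (∑-⋆ a c w)
      (trans (at e _) (trans (∑-cong b (λ x → at f _)) (sym (∑-⋆ b d w))))

    ⋆-comm : ∀ a b → a ⋆ b ≈ b ⋆ a
    ⋆-comm a b = same λ w → trans (∑-⋆ a b w) (trans (∑-swap a b (λ x y → w (x ∙ y)))
      (trans (∑-cong b (λ y → ∑-cong a (λ x → cong w (comm x y)))) (sym (∑-⋆ b a w))))

    ⋆-assoc : ∀ a b c → (a ⋆ b) ⋆ c ≈ a ⋆ (b ⋆ c)
    ⋆-assoc a b c = same λ w → trans (∑-⋆ (a ⋆ b) c w) (trans (∑-⋆ a b _)
      (trans (∑-cong a (λ x → trans (∑-cong b (λ y → ∑-cong c (λ z → cong w (assoc x y z)))) (sym (∑-⋆ b c _))))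
      (sym (∑-⋆ a (b ⋆ c) w))))

    ⋆-identityˡ : ∀ a → (ε ∷ []) ⋆ a ≈ a
    ⋆-identityˡ a = same λ w → trans (∑-⋆ (ε ∷ []) a w)
      (trans (+-identityʳ _) (∑-cong a (λ x → cong w (identityˡ x))))

    ⋆-distribʳ : ∀ a b c → (b ++ c) ⋆ a ≈ b ⋆ a ++ c ⋆ a
    ⋆-distribʳ a b c = same λ w → trans (∑-⋆ (b ++ c) a w) (trans (∑-++ b c _)
      (trans (cong₂ _+_ (sym (∑-⋆ b a w)) (sym (∑-⋆ c a w))) (sym (∑-++ (b ⋆ a) (c ⋆ a) w))))

    commutativeSemiring : CommutativeSemiring 0ℓ 0ℓ
    commutativeSemiring = record
      { _+_ = _++_ ; _*_ = _⋆_ ; 0# = [] ; 1# = ε ∷ []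
      ; isCommutativeSemiring = isCommutativeSemiringˡ record
        { +-isCommutativeMonoid = record
          { isMonoid = record
            { isSemigroup = record
              { isMagma = record { isEquivalence = ≈-isEquivalence ; ∙-cong = ++-cong }
              ; assoc = ++-assoc′ }
            ; identity = (λ a → ≈-refl) , λ a → ++-comm a [] }
          ; comm = ++-comm }
        ; *-isCommutativeMonoid = isCommutativeMonoidˡ record
          { isSemigroup = record
            { isMagma = record { isEquivalence = ≈-isEquivalence ; ∙-cong = ⋆-cong }
            ; assoc = ⋆-assoc }
          ; identityˡ = ⋆-identityˡ
          ; comm = ⋆-comm }
        ; distribʳ = ⋆-distribʳ
        ; zeroˡ = λ a → ≈-refl {[]}
        }
      }
      where
      open Algebra.Structures.Biased _≈_
      ≈-isEquivalence : IsEquivalence _≈_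
      ≈-isEquivalence = record
        { refl = ≈-refl
        ; sym = λ e → same λ w → sym (at e w)
        ; trans = λ e f → same λ w → trans (at e w) (at f w) }

    κ : G → G → ℕ
    κ x y = if does (x ≟ y) then 1 else 0

    inner : List G → List G → ℕ
    inner a b = ∑ a (λ x → ∑ b (κ x))

    κ-refl : ∀ x → κ x x ≡ 1
    κ-refl x with x ≟ x
    ... | yes _ = refl
    ... | no ≢ = contradiction refl ≢

    private
      κ-sym : ∀ x y → κ x y ≡ κ y x
      κ-sym x y with x ≟ y | y ≟ x
      ... | yes _ | yes _ = refl
      ... | no _ | no _ = refl
      ... | yes e | no ≢ = contradiction (sym e) ≢
      ... | no ≢ | yes e = contradiction (sym e) ≢

      inner-sym : ∀ a b → inner a b ≡ inner b a
      inner-sym a b = trans (∑-swap a b κ) (∑-cong b (λ y → ∑-cong a (λ x → κ-sym x y)))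

      inner-congʳ : ∀ a {b c} → b ≈ c → inner a b ≡ inner a c
      inner-congʳ a e = ∑-cong a (λ x → at e (κ x))

      inner-cong₂ : ∀ {b c} → b ≈ c → inner b b ≡ inner c c
      inner-cong₂ {b} {c} e = trans (inner-congʳ b e) (trans (inner-sym b c)
        (trans (inner-congʳ c e) refl))

      inner-∷ʳ : ∀ a y b → inner a (y ∷ b) ≡ ∑ a (κ y) + inner a b
      inner-∷ʳ a y b = trans (∑-+ a (λ x → κ x y) (λ x → ∑ b (κ x)))
        (cong (_+ inner a b) (∑-cong a (λ x → κ-sym x y)))

      inner-∷∷ : ∀ x a → inner (x ∷ a) (x ∷ a) ≡ 1 + 2 * ∑ a (κ x) + inner a a
      inner-∷∷ x a rewrite inner-∷ʳ a x a | κ-refl x = lem (∑ a (κ x)) (inner a a)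
        where
        lem : ∀ p q → 1 + p + (p + q) ≡ 1 + 2 * p + q
        lem = solve-∀

      data Occurs (x : G) (b : List G) : Set where
        never : ∑ b (κ x) ≡ 0 → Occurs x b
        once  : ∀ b′ → b ≈ x ∷ b′ → Occurs x b

      occurs : ∀ x b → Occurs x b
      occurs x [] = never refl
      occurs x (y ∷ b) with x ≟ y | occurs x b
      ... | yes refl | _ = once b ≈-refl
      ... | no ≢ | never e = never (trans (cong (_+ ∑ b (κ x)) κ0) e)
        where
        κ0 : κ x y ≡ 0
        κ0 with x ≟ y
        ... | yes e = contradiction e ≢
        ... | no _ = refl
      ... | no _ | once b′ e = once (y ∷ b′) (same λ w →
        trans (cong (w y +_) (at e w)) (lem (w y) (w x) (∑ b′ w)))
        where
        lem : ∀ p q r → p + (q + r) ≡ q + (p + r)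
        lem = solve-∀

      -- Subtraction is replaced by cancellation: an x missing from `b` only enlarges the right
      -- side, while one occurring in both is removed from both, which lowers either side by the
      -- same 2 + 2 A + 2 B.
      am-gm : ∀ a b → 2 * inner a b ≤ inner a a + inner b b
      am-gm [] b = z≤n
      am-gm (x ∷ a) b with occurs x b
      ... | never e rewrite e | inner-∷∷ x a =
        ≤-trans (am-gm a b) (+-monoˡ-≤ (inner b b) (m≤n+m (inner a a) _))
      ... | once b′ e = subst₂ _≤_ (cong (2 *_) (sym eq₁)) (cong₂ _+_ (sym (inner-∷∷ x a)) (sym eq₂))
        (subst₂ _≤_ (lem₁ A B (inner a b′)) (lem₂ A B (inner a a) (inner b′ b′))
          (+-monoʳ-≤ (2 + 2 * A + 2 * B) (am-gm a b′)))
        where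
        A = ∑ a (κ x)
        B = ∑ b′ (κ x)
        eq₁ : inner (x ∷ a) b ≡ 1 + B + (A + inner a b′)
        eq₁ = trans (inner-congʳ (x ∷ a) e) (cong₂ _+_ (cong (_+ B) (κ-refl x)) (inner-∷ʳ a x b′))
        eq₂ : inner b b ≡ 1 + 2 * B + inner b′ b′
        eq₂ = trans (inner-cong₂ e) (inner-∷∷ x b′)
        lem₁ : ∀ A B I → 2 + 2 * A + 2 * B + 2 * I ≡ 2 * (1 + B + (A + I))
        lem₁ = solve-∀
        lem₂ : ∀ A B I J → 2 + 2 * A + 2 * B + (I + J) ≡ 1 + 2 * A + I + (1 + 2 * B + J)
        lem₂ = solve-∀

      copies : ℕ → List G → List G
      copies zero a = []
      copies (suc n) a = a ++ copies n a

      ∑-copies : ∀ n a w → ∑ (copies n a) w ≡ n * ∑ a w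
      ∑-copies zero a w = refl
      ∑-copies (suc n) a w = trans (∑-++ a (copies n a) w) (cong (∑ a w +_) (∑-copies n a w))

      ∑-*ˡ : ∀ {A : Set} (a : List A) n w → ∑ a (λ x → n * w x) ≡ n * ∑ a w
      ∑-*ˡ [] n w = sym (*-zeroʳ n)
      ∑-*ˡ (x ∷ a) n w = trans (cong (n * w x +_) (∑-*ˡ a n w)) (sym (*-distribˡ-+ n (w x) (∑ a w)))

      inner-copies : ∀ m n a b → inner (copies m a) (copies n b) ≡ m * (n * inner a b)
      inner-copies m n a b = trans (∑-copies m a _) (cong (m *_)
        (trans (∑-cong a (λ x → ∑-copies n b (κ x))) (∑-*ˡ a n _)))

      -- Scaling turns `am-gm` into Cauchy-Schwarz: B = ⟨b, b⟩ copies of `a` and I = ⟨a, b⟩ copies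
      -- of `b` are the optimal choice in the discriminant argument. `B` can be cancelled because
      -- `b` is nonempty.
      inner-cs : ∀ a b → inner a b * inner a b ≤ inner a a * inner b b
      inner-cs a [] rewrite ∑-zero a = z≤n
      inner-cs a b@(y ∷ b₀) = *-cancel-≤-pos B B>0 (+-cancelʳ-≤ (B * (I * I)) _ _ (begin
        B * (I * I) + B * (I * I)                    ≡⟨ lem₁ B I ⟩
        2 * (B * (I * I))                            ≡⟨ cong (2 *_) (inner-copies B I a b) ⟨
        2 * inner (copies B a) (copies I b)          ≤⟨ am-gm (copies B a) (copies I b) ⟩
        inner (copies B a) (copies B a) + inner (copies I b) (copies I b)
          ≡⟨ cong₂ _+_ (inner-copies B B a a) (inner-copies I I b b) ⟩
        B * (B * A) + I * (I * B)                    ≡⟨ lem₂ A B I ⟩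
        B * (A * B) + B * (I * I)                    ∎))
        where
        open ≤-Reasoning
        A = inner a a
        B = inner b b
        I = inner a b
        B>0 : 1 ≤ B
        B>0 rewrite inner-∷∷ y b₀ = s≤s z≤n
        lem₁ : ∀ B I → B * (I * I) + B * (I * I) ≡ 2 * (B * (I * I))
        lem₁ = solve-∀
        lem₂ : ∀ A B I → B * (B * A) + I * (I * B) ≡ B * (A * B) + B * (I * I)
        lem₂ = solve-∀

    τ : List G → ℕ
    τ a = ∑ a (λ x → κ x ε)

    κ-∙⁻¹ : ∀ x y → κ (x ∙ (y ⁻¹)) ε ≡ κ x y
    κ-∙⁻¹ x y with (x ∙ (y ⁻¹)) ≟ ε | x ≟ y
    ... | yes _ | yes _ = refl
    ... | no _ | no _ = refl
    ... | yes e | no ≢ = contradiction (GP.x∙y⁻¹≈ε⇒x≈y x y e) ≢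
    ... | no ≢ | yes refl = contradiction (inverseʳ x) ≢

    -- Parseval's identity; it hands `inner-cs` over to the trace.
    τ-inner : ∀ a b → τ (a ⋆ map _⁻¹ b) ≡ inner a b
    τ-inner a b = trans (∑-⋆ a (map _⁻¹ b) _) (∑-cong a λ x → trans (∑-map _⁻¹ b _) (∑-cong b (κ-∙⁻¹ x)))

    traceSemiring : TraceSemiring
    traceSemiring = record
      { commutativeSemiring = commutativeSemiring
      ; conj = map _⁻¹
      ; conj-cong = λ {a} {b} e → same λ w → trans (∑-map _⁻¹ a w) (trans (at e _) (sym (∑-map _⁻¹ b w)))
      ; conj-+ = λ a b → same λ w → trans (∑-map _⁻¹ (a ++ b) w) (trans (∑-++ a b _)
          (trans (cong₂ _+_ (sym (∑-map _⁻¹ a w)) (sym (∑-map _⁻¹ b w))) (sym (∑-++ (map _⁻¹ a) (map _⁻¹ b) w))))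
      ; conj-* = λ a b → same λ w → trans (∑-map _⁻¹ (a ⋆ b) w) (trans (∑-⋆ a b _)
          (trans (∑-cong a (λ x → trans (∑-cong b (λ y → cong w (sym (GP.⁻¹-∙-comm x y)))) (sym (∑-map _⁻¹ b _))))
          (trans (sym (∑-map _⁻¹ a _)) (sym (∑-⋆ (map _⁻¹ a) (map _⁻¹ b) w)))))
      ; conj-1# = same λ w → cong (λ z → w z + 0) GP.ε⁻¹≈ε
      ; conj-0# = ≈-refl {[]}
      ; conj-conj = λ a → same λ w → trans (∑-map _⁻¹ (map _⁻¹ a) w) (trans (∑-map _⁻¹ a _)
          (∑-cong a (λ x → cong w (GP.⁻¹-involutive x))))
      ; τ = τ
      ; τ-cong = λ e → at e _
      ; τ-+ = λ a b → ∑-++ a b _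
      ; cauchy-schwarz = λ a b → subst₂ _≤_ (cong₂ _*_ (sym (τ-inner a b)) (sym (τ-inner a b)))
          (cong₂ _*_ (sym (τ-inner a a)) (sym (τ-inner b b))) (inner-cs a b)
      }

    private
      ∈-⋆⁻ : ∀ a b {x} → x ∈ a ⋆ b → ∃₂ λ u v → u ∈ a × v ∈ b × x ≡ u ∙ v
      ∈-⋆⁻ (u ∷ a) b x∈ with ∈-++⁻ (map (u ∙_) b) x∈
      ... | inj₁ p = let v , v∈ , eq = ∈-map⁻ (u ∙_) p in u , v , here refl , v∈ , eq
      ... | inj₂ p = let u′ , v , u′∈ , v∈ , eq = ∈-⋆⁻ a b p in u′ , v , there u′∈ , v∈ , eq

      inner-disjoint : ∀ a b → (∀ {x} → x ∈ a → ¬ x ∈ b) → inner a b ≡ 0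
      inner-disjoint [] b disj = refl
      inner-disjoint (x ∷ a) b disj = cong₂ _+_ (row b (disj (here refl))) (inner-disjoint a b (λ x∈ → disj (there x∈)))
        where
        row : ∀ b → ¬ x ∈ b → ∑ b (κ x) ≡ 0
        row [] _ = refl
        row (y ∷ b) x∉ with x ≟ y
        ... | yes eq = contradiction (here eq) x∉
        ... | no _ = row b (λ x∈ → x∉ (there x∈))

    groupTrace : GroupTrace _∙_ ε
    groupTrace = record
      { traceSemiring = traceSemiring
      ; point = λ g → g ∷ []
      ; _∋_ = λ a x → x ∈ a
      ; ∋-0# = λ ()
      ; ∋-1# = λ { (here eq) → eq }
      ; ∋-point = λ { (here eq) → eq }
      ; ∋-+ = λ a b → ∈-++⁻ a
      ; ∋-* = ∈-⋆⁻
      ; nsq-point = λ g → same λ w → cong (λ z → w z + 0) (inverseʳ g)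
      ; τ-1# = cong (_+ 0) (κ-refl ε)
      ; disjoint = λ a b disj → trans (τ-inner a b) (inner-disjoint a b disj)
      }

-- Curves congruent to the moment curve, their rescaling and projection.

module Curves where

  open import Data.Integer renaming (+_ to int) hiding (suc)
  open import Data.Integer.Divisibility.Signed
  open import Data.Integer.Properties
  open import Data.Integer.Tactic.RingSolver using (solve-∀)
  open import Data.Nat as ℕ using (ℕ; zero; suc; z≤n; s≤s)
  import Data.Nat.Properties as ℕ
  open import Data.Product using (Σ-syntax; ∃; _×_; _,_; proj₁; proj₂)
  open import Relation.Binary.PropositionalEquality
  open import Relation.Nullary using (yes; no; contradiction)

  infixl 6 _⊕_
  infixl 7 _⊗_
  data Poly : Set where
    con : ℤ → Poly
    var : Poly
    _⊕_ _⊗_ : Poly → Poly → Poly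

  ⟦_⟧ : Poly → ℤ → ℤ
  ⟦ con c ⟧ z = c
  ⟦ var ⟧ z = z
  ⟦ f ⊕ g ⟧ z = ⟦ f ⟧ z + ⟦ g ⟧ z
  ⟦ f ⊗ g ⟧ z = ⟦ f ⟧ z * ⟦ g ⟧ z

  _∘ᴾ_ : Poly → Poly → Poly
  con c ∘ᴾ h = con c
  var ∘ᴾ h = h
  (f ⊕ g) ∘ᴾ h = (f ∘ᴾ h) ⊕ (g ∘ᴾ h)
  (f ⊗ g) ∘ᴾ h = (f ∘ᴾ h) ⊗ (g ∘ᴾ h)

  ⟦∘⟧ : ∀ f h z → ⟦ f ∘ᴾ h ⟧ z ≡ ⟦ f ⟧ (⟦ h ⟧ z)
  ⟦∘⟧ (con c) h z = refl
  ⟦∘⟧ var h z = refl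
  ⟦∘⟧ (f ⊕ g) h z = cong₂ _+_ (⟦∘⟧ f h z) (⟦∘⟧ g h z)
  ⟦∘⟧ (f ⊗ g) h z = cong₂ _*_ (⟦∘⟧ f h z) (⟦∘⟧ g h z)

  _^ᴾ_ : Poly → ℕ → Poly
  f ^ᴾ zero = con 1ℤ
  f ^ᴾ suc n = f ⊗ f ^ᴾ n

  ⟦^⟧ : ∀ f n z → ⟦ f ^ᴾ n ⟧ z ≡ ⟦ f ⟧ z ^ n
  ⟦^⟧ f zero z = refl
  ⟦^⟧ f (suc n) z = cong (⟦ f ⟧ z *_) (⟦^⟧ f n z)

  split : ∀ f → Σ[ c ∈ ℤ ] Σ[ g ∈ Poly ] (∀ z → ⟦ f ⟧ z ≡ c + z * ⟦ g ⟧ z)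
  split (con c) = c , con 0ℤ , λ z → sym (trans (cong (c +_) (*-zeroʳ z)) (+-identityʳ c))
  split var = 0ℤ , con 1ℤ , λ z → sym (trans (+-identityˡ _) (*-identityʳ z))
  split (f ⊕ g) with split f | split g
  ... | c , f′ , e | d , g′ , e′ = c + d , f′ ⊕ g′ , λ z →
    trans (cong₂ _+_ (e z) (e′ z)) (lem c d z (⟦ f′ ⟧ z) (⟦ g′ ⟧ z))
    where
    lem : ∀ c d z x y → (c + z * x) + (d + z * y) ≡ c + d + z * (x + y)
    lem = solve-∀
  split (f ⊗ g) with split f | split g
  ... | c , f′ , e | d , g′ , e′ = c * d , con c ⊗ g′ ⊕ f′ ⊗ con d ⊕ var ⊗ (f′ ⊗ g′) , λ z →
    trans (cong₂ _*_ (e z) (e′ z)) (lem c d z (⟦ f′ ⟧ z) (⟦ g′ ⟧ z))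
    where
    lem : ∀ c d z x y → (c + z * x) * (d + z * y) ≡ c * d + z * (c * y + x * d + z * (x * y))
    lem = solve-∀

  difference-divides : ∀ f a b → a - b ∣ ⟦ f ⟧ a - ⟦ f ⟧ b
  difference-divides (con c) a b = divides 0ℤ (+-inverseʳ c)
  difference-divides var a b = ∣-refl
  difference-divides (f ⊕ g) a b = subst (a - b ∣_) (lem (⟦ f ⟧ a) (⟦ f ⟧ b) (⟦ g ⟧ a) (⟦ g ⟧ b))
    (∣m∣n⇒∣m+n (difference-divides f a b) (difference-divides g a b))
    where
    lem : ∀ x y z w → (x - y) + (z - w) ≡ x + z - (y + w)
    lem = solve-∀
  difference-divides (f ⊗ g) a b = subst (a - b ∣_) (lem (⟦ f ⟧ a) (⟦ f ⟧ b) (⟦ g ⟧ a) (⟦ g ⟧ b))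
    (∣m∣n⇒∣m+n (∣n⇒∣m*n (⟦ f ⟧ a) (difference-divides g a b)) (∣m⇒∣m*n (⟦ g ⟧ b) (difference-divides f a b)))
    where
    lem : ∀ x y z w → x * (z - w) + (x - y) * w ≡ x * z - y * w
    lem = solve-∀

  *-^ : ∀ x y n → (x * y) ^ n ≡ x ^ n * y ^ n
  *-^ x y zero = refl
  *-^ x y (suc n) rewrite *-^ x y n = lem x y (x ^ n) (y ^ n)
    where
    lem : ∀ x y a b → x * y * (a * b) ≡ x * a * (y * b)
    lem = solve-∀

  -- Models f ↦ Σ f (xᵢ) - Σ f (yᵢ) for tuples of equal length; the equal lengths give `ap-const`.
  record Functional : Set where
    field
      ap        : (ℤ → ℤ) → ℤ
      ap-cong   : ∀ {f g} → (∀ z → f z ≡ g z) → ap f ≡ ap g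
      ap-+      : ∀ f g → ap (λ z → f z + g z) ≡ ap f + ap g
      ap-scale  : ∀ c f → ap (λ z → c * f z) ≡ c * ap f
      ap-const  : ∀ c → ap (λ _ → c) ≡ 0ℤ
  open Functional public

  pullback : (ℤ → ℤ) → Functional → Functional
  pullback φ Δ = record
    { ap = λ f → ap Δ (λ z → f (φ z))
    ; ap-cong = λ e → ap-cong Δ (λ z → e (φ z))
    ; ap-+ = λ f g → ap-+ Δ _ _
    ; ap-scale = λ c f → ap-scale Δ c _
    ; ap-const = ap-const Δ
    }

  _⊞_ : Functional → Functional → Functional
  Δ ⊞ Δ′ = record
    { ap = λ f → ap Δ f + ap Δ′ f
    ; ap-cong = λ e → cong₂ _+_ (ap-cong Δ e) (ap-cong Δ′ e)
    ; ap-+ = λ f g → trans (cong₂ _+_ (ap-+ Δ f g) (ap-+ Δ′ f g)) (lem (ap Δ f) (ap Δ g) (ap Δ′ f) (ap Δ′ g))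
    ; ap-scale = λ c f → trans (cong₂ _+_ (ap-scale Δ c f) (ap-scale Δ′ c f)) (sym (*-distribˡ-+ c (ap Δ f) (ap Δ′ f)))
    ; ap-const = λ c → cong₂ _+_ (ap-const Δ c) (ap-const Δ′ c)
    }
    where
    lem : ∀ a b c d → a + b + (c + d) ≡ a + c + (b + d)
    lem = solve-∀

  module Reduction (P : ℤ) where

    -- Congruence to the moment curve modulo P, unlike the moment curve itself, is stable under the
    -- rescalings and projections below.
    curve : (ℕ → Poly) → ℕ → ℤ → ℤ
    curve q i x = x ^ i + P * ⟦ q i ⟧ x

    record Unit (u : ℤ) : Set where
      constructor unit
      field
        inv quot : ℤ
        inv-eq : u * inv ≡ 1ℤ + P * quot

    unit-* : ∀ {u v} → Unit u → Unit v → Unit (u * v)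
    unit-* {u} {v} (unit a s e) (unit b t f) = unit (a * b) (s + t + P * (s * t))
      (trans (lem u v a b) (trans (cong₂ _*_ e f) (lem′ P s t)))
      where
      lem : ∀ u v a b → u * v * (a * b) ≡ u * a * (v * b)
      lem = solve-∀
      lem′ : ∀ P s t → (1ℤ + P * s) * (1ℤ + P * t) ≡ 1ℤ + P * (s + t + P * (s * t))
      lem′ = solve-∀

    unit-1 : Unit 1ℤ
    unit-1 = unit 1ℤ 0ℤ (cong (1ℤ +_) (sym (*-zeroʳ P)))

    unit-^ : ∀ {u} n → Unit u → Unit (u ^ n)
    unit-^ zero U = unit-1
    unit-^ (suc n) U = unit-* U (unit-^ n U)

    unit-factorˡ : ∀ {u v w} → u * v ≡ w → Unit w → Unit u
    unit-factorˡ {u} {v} {w} e (unit a s f) = unit (v * a) s (trans (sym (*-assoc u v a)) (trans (cong (_* a) e) f))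

    unit-factorʳ : ∀ {u v w} → u * v ≡ w → Unit w → Unit v
    unit-factorʳ {u} {v} e = unit-factorˡ (trans (*-comm v u) e)

    module Good (Hyp : Functional → Set) (m : ℤ) where

      -- These functions form a ℤ-module containing the constants and all multiples of `m`.
      -- Computing in it treats all Δ with `Hyp` at once.
      Good : (ℤ → ℤ) → Set
      Good f = ∀ Δ → Hyp Δ → m ∣ ap Δ f

      good-cong : ∀ {f g} → (∀ z → f z ≡ g z) → Good f → Good g
      good-cong e G Δ h = subst (m ∣_) (ap-cong Δ e) (G Δ h)

      good-+ : ∀ {f g} → Good f → Good g → Good (λ z → f z + g z)
      good-+ {f} {g} F G Δ h = subst (m ∣_) (sym (ap-+ Δ f g)) (∣m∣n⇒∣m+n (F Δ h) (G Δ h))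

      good-scale : ∀ {f} c → Good f → Good (λ z → c * f z)
      good-scale {f} c F Δ h = subst (m ∣_) (sym (ap-scale Δ c f)) (∣n⇒∣m*n c (F Δ h))

      good-const : ∀ c → Good (λ _ → c)
      good-const c Δ h = subst (m ∣_) (sym (ap-const Δ c)) (divides 0ℤ refl)

      good-multiple : ∀ f → Good (λ z → m * f z)
      good-multiple f Δ h = subst (m ∣_) (sym (ap-scale Δ m f)) (∣m⇒∣m*n (ap Δ f) ∣-refl)

      -- With π = P the tail stays divisible by P under a change of origin; with π = 1
      -- it becomes so after a dilation.
      record Rep (π : ℤ) (l : ℕ) (e : ℕ) (g : Poly) : Set where
        constructor rep
        field
          tail error : Poly
          isGood : Good (λ z → ⟦ g ⟧ z - (π * (z ^ suc l * ⟦ tail ⟧ z) + P ^ e * ⟦ error ⟧ z))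

      module _ {π : ℤ} {l e : ℕ} where

        rep-cong : ∀ {g g′} → (∀ z → ⟦ g ⟧ z ≡ ⟦ g′ ⟧ z) → Rep π l e g → Rep π l e g′
        rep-cong eq (rep A B G) = rep A B (good-cong (λ z → cong (_- (π * (z ^ suc l * ⟦ A ⟧ z) + P ^ e * ⟦ B ⟧ z)) (eq z)) G)

        rep-⊕ : ∀ {f g} → Rep π l e f → Rep π l e g → Rep π l e (f ⊕ g)
        rep-⊕ {f} {g} (rep A B G) (rep A′ B′ G′) = rep (A ⊕ A′) (B ⊕ B′) (good-cong
          (λ z → lem (⟦ f ⟧ z) (⟦ g ⟧ z) π (z ^ suc l) (P ^ e) (⟦ A ⟧ z) (⟦ B ⟧ z) (⟦ A′ ⟧ z) (⟦ B′ ⟧ z)) (good-+ G G′))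
          where
          lem : ∀ f g π y p a b a′ b′ → (f - (π * (y * a) + p * b)) + (g - (π * (y * a′) + p * b′)) ≡
            f + g - (π * (y * (a + a′)) + p * (b + b′))
          lem = solve-∀

        rep-scale : ∀ {f} c → Rep π l e f → Rep π l e (con c ⊗ f)
        rep-scale {f} c (rep A B G) = rep (con c ⊗ A) (con c ⊗ B) (good-cong
          (λ z → lem c (⟦ f ⟧ z) π (z ^ suc l) (P ^ e) (⟦ A ⟧ z) (⟦ B ⟧ z)) (good-scale c G))
          where
          lem : ∀ c f π y p a b → c * (f - (π * (y * a) + p * b)) ≡ c * f - (π * (y * (c * a)) + p * (c * b))
          lem = solve-∀

        rep-good : ∀ {f} → Good ⟦ f ⟧ → Rep π l e f
        rep-good {f} G = rep (con 0ℤ) (con 0ℤ) (good-cong (λ z → lem (⟦ f ⟧ z) π (z ^ suc l) (P ^ e)) G)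
          where
          lem : ∀ f π y p → f ≡ f - (π * (y * 0ℤ) + p * 0ℤ)
          lem = solve-∀

        rep-const : ∀ c → Rep π l e (con c)
        rep-const c = rep-good (good-const c)

        rep-error : ∀ g → Rep π l e (con (P ^ e) ⊗ g)
        rep-error g = rep (con 0ℤ) g (good-cong (λ z → lem (⟦ g ⟧ z) π (z ^ suc l) (P ^ e)) (good-const 0ℤ))
          where
          lem : ∀ g π y p → 0ℤ ≡ p * g - (π * (y * 0ℤ) + p * g)
          lem = solve-∀

        rep-tail : ∀ g → Rep π l e (con π ⊗ (var ^ᴾ suc l ⊗ g))
        rep-tail g = rep g (con 0ℤ) (good-cong (λ z →
          trans (lem (⟦ g ⟧ z) π (z ^ suc l) (P ^ e)) (cong (λ y → π * (y * ⟦ g ⟧ z) - (π * (z ^ suc l * ⟦ g ⟧ z) + P ^ e * 0ℤ))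
            (sym (⟦^⟧ var (suc l) z)))) (good-const 0ℤ))
          where
          lem : ∀ g π y p → 0ℤ ≡ π * (y * g) - (π * (y * g) + p * 0ℤ)
          lem = solve-∀

      -- If u a = 1 + P s, then g = a (u g) - P s g, and at precision one the last term is an error.
      rep-unit : ∀ {π l u} g → Unit u → Rep π l 1 (con u ⊗ g) → Rep π l 1 g
      rep-unit {u = u} g (unit a s eq) R = rep-cong
        (λ z → trans (cong (λ p → a * (u * ⟦ g ⟧ z) + p * (- s * ⟦ g ⟧ z)) (*-identityʳ P))
          (trans (lem a u P s (⟦ g ⟧ z)) (trans (cong (λ x → x * ⟦ g ⟧ z - P * s * ⟦ g ⟧ z) eq) (lem′ P s (⟦ g ⟧ z)))))
        (rep-⊕ (rep-scale a R) (rep-error (con (- s) ⊗ g)))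
        where
        lem : ∀ a u p s g → a * (u * g) + p * (- s * g) ≡ u * a * g - p * s * g
        lem = solve-∀
        lem′ : ∀ p s g → (1ℤ + p * s) * g - p * s * g ≡ g
        lem′ = solve-∀

      module Eliminate (π ρ : ℤ) (πρ≡P : π * ρ ≡ P) (l : ℕ)
        (monomial : ∀ t → 1 ℕ.≤ t → t ℕ.≤ l → Rep π l 1 (var ^ᴾ t)) where

        private
          monomial₁ : ∀ t → 1 ℕ.≤ t → t ℕ.≤ l → Rep 1ℤ l 1 (var ^ᴾ t)
          monomial₁ t lo hi with monomial t lo hi
          ... | rep A B G = rep (con π ⊗ A) B (good-cong
            (λ z → lem (⟦ var ^ᴾ t ⟧ z) π (z ^ suc l) (⟦ A ⟧ z) (P ^ 1 * ⟦ B ⟧ z)) G)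
            where
            lem : ∀ f π y a b → f - (π * (y * a) + b) ≡ f - (1ℤ * (y * (π * a)) + b)
            lem = solve-∀

          -- Peels coefficients off `g` until the power of z exceeds `l`; from there on everything
          -- is tail.
          shifted : ∀ n t → 1 ℕ.≤ t → t ℕ.+ n ≡ suc l → ∀ g → Rep 1ℤ l 1 (var ^ᴾ t ⊗ g)
          shifted zero t lo eq g rewrite trans (sym (ℕ.+-identityʳ t)) eq =
            rep-cong (λ z → *-identityˡ _) (rep-tail g)
          shifted (suc n) t lo eq g with split g
          ... | c , g′ , e = rep-cong
            (λ z → trans (lem c z (⟦ var ^ᴾ t ⟧ z) (⟦ g′ ⟧ z)) (cong (⟦ var ^ᴾ t ⟧ z *_) (sym (e z))))
            (rep-⊕ (rep-scale c (monomial₁ t lo t≤l))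
              (shifted n (suc t) (s≤s z≤n) (trans (sym (ℕ.+-suc t n)) eq) g′))
            where
            lem : ∀ c z y g → c * y + z * y * g ≡ y * (c + z * g)
            lem = solve-∀
            t≤l : t ℕ.≤ l
            t≤l = ℕ.≤-pred (subst (suc t ℕ.≤_) (trans (sym (ℕ.+-suc t n)) eq) (ℕ.m≤m+n (suc t) n))

          reduce : ∀ g → Rep 1ℤ l 1 g
          reduce g with split g
          ... | c , g′ , e = rep-cong (λ z → trans (cong (λ y → c + y * ⟦ g′ ⟧ z) (*-identityʳ z)) (sym (e z)))
            (rep-⊕ (rep-const c) (shifted l 1 (s≤s z≤n) refl g′))

          -- Hensel-type iteration: the error polynomial is itself reduced and substituted back,
          -- which gains a factor P. The new tail carries `P ^ suc e`, and π ρ = P allows π to be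
          -- split off.
          lift : ∀ e t → 1 ℕ.≤ t → t ℕ.≤ l → Rep π l (suc e) (var ^ᴾ t)
          lift zero t lo hi = monomial t lo hi
          lift (suc e) t lo hi with lift e t lo hi
          ... | rep A B G with reduce B
          ...   | rep A′ B′ G′ = rep (A ⊕ con (ρ * P ^ e) ⊗ A′) B′ (good-cong
            (λ z → trans
              (lem (⟦ var ^ᴾ t ⟧ z) π (z ^ suc l) P (P ^ e) (⟦ A ⟧ z) (⟦ B ⟧ z) (⟦ A′ ⟧ z) (⟦ B′ ⟧ z))
              (trans (cong (λ p → ⟦ var ^ᴾ t ⟧ z - (π * (z ^ suc l * ⟦ A ⟧ z) + p * P ^ e * (z ^ suc l * ⟦ A′ ⟧ z) + P * (P * P ^ e) * ⟦ B′ ⟧ z)) (sym πρ≡P))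
                (lem′ (⟦ var ^ᴾ t ⟧ z) π ρ (z ^ suc l) (P ^ e) (⟦ A ⟧ z) (⟦ A′ ⟧ z) (P * (P * P ^ e) * ⟦ B′ ⟧ z))))
            (good-+ G (good-scale (P ^ suc e) G′)))
            where
            lem : ∀ f π y p pe a b a′ b′ →
              (f - (π * (y * a) + p * pe * b)) + p * pe * (b - (1ℤ * (y * a′) + p * 1ℤ * b′)) ≡
              f - (π * (y * a) + p * pe * (y * a′) + p * (p * pe) * b′)
            lem = solve-∀
            lem′ : ∀ f π ρ y pe a a′ b → f - (π * (y * a) + π * ρ * pe * (y * a′) + b) ≡
              f - (π * (y * (a + ρ * pe * a′)) + b)
            lem′ = solve-∀

        eliminate : ∀ M → m ≡ P ^ M → ∀ t → 1 ℕ.≤ t → t ℕ.≤ l →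
          Σ[ A ∈ Poly ] Good (λ z → z ^ t - π * (z ^ suc l * ⟦ A ⟧ z))
        -- The error of `lift M` has the factor `P ^ suc M`, a multiple of `m`, and therefore
        -- disappears.
        eliminate M refl t lo hi with lift M t lo hi
        ... | rep A B G = A , good-cong
          (λ z → trans (lem (⟦ var ^ᴾ t ⟧ z) (π * (z ^ suc l * ⟦ A ⟧ z)) P (P ^ M) (⟦ B ⟧ z))
            (cong (_- π * (z ^ suc l * ⟦ A ⟧ z)) (⟦^⟧ var t z)))
          (good-+ G (good-multiple (λ z → P * ⟦ B ⟧ z)))
          where
          lem : ∀ f x p pm b → (f - (x + p * pm * b)) + pm * (p * b) ≡ f - x
          lem = solve-∀

      -- Each factor z is replaced by y - ξ, so multiplying by z costs only a higher power of y.
      products : ∀ {π l} ξ s n → let y = con ξ ⊕ var in (∀ t → t ℕ.≤ n → Rep π l 1 (y ^ᴾ (s ℕ.+ t))) →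
        ∀ j t → t ℕ.+ j ℕ.≤ n → Rep π l 1 (y ^ᴾ (s ℕ.+ t) ⊗ var ^ᴾ j)
      products ξ s n R zero t le =
        rep-cong (λ z → sym (*-identityʳ _)) (R t (subst (ℕ._≤ n) (ℕ.+-identityʳ t) le))
      products ξ s n R (suc j) t le = rep-cong
        (λ z → trans (cong (λ i → ⟦ y ^ᴾ i ⟧ z * ⟦ var ^ᴾ j ⟧ z + - ξ * (⟦ y ^ᴾ (s ℕ.+ t) ⟧ z * ⟦ var ^ᴾ j ⟧ z)) (ℕ.+-suc s t))
          (lem ξ z (⟦ y ^ᴾ (s ℕ.+ t) ⟧ z) (⟦ var ^ᴾ j ⟧ z)))
        (rep-⊕ (products ξ s n R j (suc t) (subst (ℕ._≤ n) (ℕ.+-suc t j) le))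
          (rep-scale (- ξ) (products ξ s n R j t (ℕ.≤-trans (ℕ.+-monoʳ-≤ t (ℕ.n≤1+n j)) le))))
        where
        y = con ξ ⊕ var
        lem : ∀ ξ z a b → (ξ + z) * a * b + - ξ * (a * b) ≡ a * (z * b)
        lem = solve-∀

      -- The perturbation P q counts as error, so the powers of ξ + z are representable with zero
      -- tail; the powers of z are combinations of them.
      curve-monomial : ∀ {π l} q ξ k → (∀ i → 1 ℕ.≤ i → i ℕ.≤ k → Good (λ z → curve q i (ξ + z))) →
        ∀ t → t ℕ.≤ k → Rep π l 1 (var ^ᴾ t)
      curve-monomial q ξ k G t le = rep-cong (λ z → *-identityˡ _) (products ξ 0 k powers t 0 le)
        where
        y = con ξ ⊕ var
        powers : ∀ t → t ℕ.≤ k → Rep _ _ 1 (y ^ᴾ t)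
        powers zero _ = rep-const 1ℤ
        powers t@(suc _) le = rep-cong
          (λ z → trans (cong (λ p → ⟦ y ^ᴾ t ⟧ z + P * ⟦ q t ∘ᴾ y ⟧ z + p * (-1ℤ * ⟦ q t ∘ᴾ y ⟧ z)) (*-identityʳ P))
            (lem (⟦ y ^ᴾ t ⟧ z) P (⟦ q t ∘ᴾ y ⟧ z)))
          (rep-⊕ (rep-good {f = y ^ᴾ t ⊕ con P ⊗ (q t ∘ᴾ y)} (good-cong
            (λ z → cong₂ _+_ (sym (⟦^⟧ y t z)) (cong (P *_) (sym (⟦∘⟧ (q t) y z)))) (G t (s≤s z≤n) le)))
            (rep-error (con -1ℤ ⊗ (q t ∘ᴾ y))))
          where
          lem : ∀ a p b → a + p * b + p * (-1ℤ * b) ≡ a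
          lem = solve-∀

      -- F m j is Λ ∫₀ᶻ y ^ m z ^ (j − 1) dz for y = ξ + z: integrating by parts, it is
      -- a combination of y ^ (m + 1), …, y ^ (m + j), while by its definition
      -- it is z ^ j times a polynomial with constant term a unit.
      module Osculating (ξ : ℤ) (ξ-unit : Unit ξ) (K : ℕ) (Λ : ℤ) (Λ-unit : Unit Λ) (Λ/ : ℕ → ℤ)
        (Λ/-eq : ∀ j → 1 ℕ.≤ j → j ℕ.≤ K → int j * Λ/ j ≡ Λ) where

        private
          y = con ξ ⊕ var

          index-unit : ∀ j → 1 ℕ.≤ j → j ℕ.≤ K → Unit (int j)
          index-unit j lo hi = unit-factorˡ {int j} {Λ/ j} (Λ/-eq j lo hi) Λ-unit

          T : ℕ → ℕ → Poly
          T zero j = con (Λ/ j)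
          T (suc m) j = var ⊗ T m (suc j) ⊕ con ξ ⊗ T m j

          F : ℕ → ℕ → ℤ → ℤ
          F m j z = z ^ j * ⟦ T m j ⟧ z

          F-suc : ∀ m j z → F (suc m) j z ≡ F m (suc j) z + ξ * F m j z
          F-suc m j z = lem (z ^ j) z (⟦ T m (suc j) ⟧ z) ξ (⟦ T m j ⟧ z)
            where
            lem : ∀ a z b x c → a * (z * b + x * c) ≡ z * a * b + x * (a * c)
            lem = solve-∀

          -- The derivative of y^(m + 1) z^j, integrated from 0 and scaled by Λ. The algebraic proof
          -- is an induction on `m` through `F-suc`.
          by-parts : ∀ m j z → 1 ℕ.≤ j → m ℕ.+ suc j ℕ.≤ K →
            int (suc m) * F m (suc j) z + int j * F (suc m) j z ≡ Λ * ((ξ + z) ^ suc m * z ^ j)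
          by-parts zero j z lo hi = begin
            1ℤ * (z * z ^ j * Λ/ (suc j)) + int j * (z ^ j * (z * Λ/ (suc j) + ξ * Λ/ j))
              ≡⟨ lem (int j) z (z ^ j) (Λ/ (suc j)) (Λ/ j) ξ ⟩
            (1ℤ + int j) * Λ/ (suc j) * (z * z ^ j) + int j * Λ/ j * (ξ * z ^ j)
              ≡⟨ cong₂ (λ a b → a * (z * z ^ j) + b * (ξ * z ^ j)) (Λ/-eq (suc j) (s≤s z≤n) hi) (Λ/-eq j lo (ℕ.≤-trans (ℕ.n≤1+n j) hi)) ⟩
            Λ * (z * z ^ j) + Λ * (ξ * z ^ j)
              ≡⟨ lem′ Λ z ξ (z ^ j) ⟩
            Λ * ((ξ + z) ^ 1 * z ^ j) ∎
            where
            open ≡-Reasoning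
            lem : ∀ i z a b c x → 1ℤ * (z * a * b) + i * (a * (z * b + x * c)) ≡ (1ℤ + i) * b * (z * a) + i * c * (x * a)
            lem = solve-∀
            lem′ : ∀ Λ z x a → Λ * (z * a) + Λ * (x * a) ≡ Λ * ((x + z) * 1ℤ * a)
            lem′ = solve-∀
          by-parts (suc m) j z lo hi = begin
            int (2 ℕ.+ m) * F (suc m) (suc j) z + int j * F (2 ℕ.+ m) j z
              ≡⟨ cong₂ (λ a b → int (2 ℕ.+ m) * a + int j * b) (F-suc m (suc j) z) (trans (F-suc (suc m) j z) (cong₂ (λ a b → a + ξ * b) (F-suc m (suc j) z) (F-suc m j z))) ⟩
            (1ℤ + int (suc m)) * (a + ξ * b) + int j * (a + ξ * b + ξ * (b + ξ * c))
              ≡⟨ lem (int (suc m)) (int j) a b c ξ ⟩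
            (int (suc m) * a + (1ℤ + int j) * (a + ξ * b)) + ξ * (int (suc m) * b + int j * (b + ξ * c))
              ≡⟨ cong₂ (λ u v → (int (suc m) * a + int (suc j) * u) + ξ * (int (suc m) * b + int j * v)) (F-suc m (suc j) z) (F-suc m j z) ⟨
            (int (suc m) * a + int (suc j) * F (suc m) (suc j) z) + ξ * (int (suc m) * b + int j * F (suc m) j z)
              ≡⟨ cong₂ (λ u v → u + ξ * v) (by-parts m (suc j) z (s≤s z≤n) (subst (ℕ._≤ K) (sym (ℕ.+-suc m (suc j))) hi))
                   (by-parts m j z lo (ℕ.≤-trans (ℕ.n≤1+n _) hi)) ⟩
            Λ * ((ξ + z) ^ suc m * (z * z ^ j)) + ξ * (Λ * ((ξ + z) ^ suc m * z ^ j))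
              ≡⟨ lem′ Λ ξ z ((ξ + z) ^ suc m) (z ^ j) ⟩
            Λ * ((ξ + z) * (ξ + z) ^ suc m * z ^ j) ∎
            where
            open ≡-Reasoning
            a = F m (2 ℕ.+ j) z
            b = F m (suc j) z
            c = F m j z
            lem : ∀ m j a b c x → (1ℤ + m) * (a + x * b) + j * (a + x * b + x * (b + x * c)) ≡
              (m * a + (1ℤ + j) * (a + x * b)) + x * (m * b + j * (b + x * c))
            lem = solve-∀
            lem′ : ∀ Λ x z u v → Λ * (u * (z * v)) + x * (Λ * (u * v)) ≡ Λ * ((x + z) * u * v)
            lem′ = solve-∀

          -- The case j = 0 of integration by parts, in which the boundary term at z = 0 survives.
          by-parts₁ : ∀ m z → suc m ℕ.≤ K → int (suc m) * F m 1 z ≡ Λ * ((ξ + z) ^ suc m - ξ ^ suc m)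
          by-parts₁ zero z hi = begin
            1ℤ * (z * 1ℤ * Λ/ 1)             ≡⟨ lem z (Λ/ 1) ξ ⟩
            1ℤ * Λ/ 1 * ((ξ + z) * 1ℤ - ξ * 1ℤ) ≡⟨ cong (_* ((ξ + z) * 1ℤ - ξ * 1ℤ)) (Λ/-eq 1 ℕ.≤-refl hi) ⟩
            Λ * ((ξ + z) * 1ℤ - ξ * 1ℤ) ∎
            where
            open ≡-Reasoning
            lem : ∀ z l x → 1ℤ * (z * 1ℤ * l) ≡ 1ℤ * l * ((x + z) * 1ℤ - x * 1ℤ)
            lem = solve-∀
          by-parts₁ (suc m) z hi = begin
            (1ℤ + int (suc m)) * F (suc m) 1 z
              ≡⟨ cong ((1ℤ + int (suc m)) *_) (F-suc m 1 z) ⟩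
            (1ℤ + int (suc m)) * (a + ξ * b)
              ≡⟨ lem (int (suc m)) a b ξ ⟩
            (int (suc m) * a + 1ℤ * (a + ξ * b)) + ξ * (int (suc m) * b)
              ≡⟨ cong (λ u → (int (suc m) * a + 1ℤ * u) + ξ * (int (suc m) * b)) (F-suc m 1 z) ⟨
            (int (suc m) * a + 1ℤ * F (suc m) 1 z) + ξ * (int (suc m) * b)
              ≡⟨ cong₂ (λ u v → u + ξ * v) (by-parts m 1 z ℕ.≤-refl (subst (ℕ._≤ K) (trans (cong suc (ℕ.+-comm 1 m)) (sym (ℕ.+-suc m 1))) hi))
                   (by-parts₁ m z (ℕ.≤-trans (ℕ.n≤1+n _) hi)) ⟩
            Λ * ((ξ + z) ^ suc m * (z * 1ℤ)) + ξ * (Λ * ((ξ + z) ^ suc m - ξ ^ suc m))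
              ≡⟨ lem′ Λ ξ z ((ξ + z) ^ suc m) (ξ ^ suc m) ⟩
            Λ * ((ξ + z) * (ξ + z) ^ suc m - ξ * ξ ^ suc m) ∎
            where
            open ≡-Reasoning
            a = F m 2 z
            b = F m 1 z
            lem : ∀ m a b x → (1ℤ + m) * (a + x * b) ≡ (m * a + 1ℤ * (a + x * b)) + x * (m * b)
            lem = solve-∀
            lem′ : ∀ Λ x z u v → Λ * (u * (z * 1ℤ)) + x * (Λ * (u - v)) ≡ Λ * ((x + z) * u - x * v)
            lem′ = solve-∀

          T-at-0 : ∀ m j → ⟦ T m j ⟧ 0ℤ ≡ ξ ^ m * Λ/ j
          T-at-0 zero j = sym (*-identityˡ (Λ/ j))
          T-at-0 (suc m) j = trans (+-identityˡ _) (trans (cong (ξ *_) (T-at-0 m j)) (sym (*-assoc ξ (ξ ^ m) (Λ/ j))))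

        module _ {l : ℕ} (m r : ℕ) (m+r≤K : m ℕ.+ suc r ℕ.≤ K) (l≡ : l ≡ suc r)
          (top : ∀ i → 1 ℕ.≤ i → i ℕ.≤ suc r → Rep 1ℤ l 1 (y ^ᴾ (m ℕ.+ i))) where

          private
            below : ∀ {j} → j ℕ.≤ r → suc (m ℕ.+ j) ℕ.≤ K
            below {j} j≤r = ℕ.≤-trans (s≤s (ℕ.+-monoʳ-≤ m j≤r)) (subst (ℕ._≤ K) (ℕ.+-suc m r) m+r≤K)

            mixed : ∀ j → j ℕ.≤ r → Rep 1ℤ l 1 (y ^ᴾ suc m ⊗ var ^ᴾ j)
            mixed j j≤r = subst (λ i → Rep 1ℤ l 1 (y ^ᴾ i ⊗ var ^ᴾ j)) (cong suc (ℕ.+-identityʳ m))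
              (products ξ (suc m) r (λ t t≤r → subst (λ i → Rep 1ℤ l 1 (y ^ᴾ i)) (ℕ.+-suc m t) (top (suc t) (s≤s z≤n) (s≤s t≤r))) j 0 j≤r)

            Fᴾ : ℕ → Poly
            Fᴾ j = var ^ᴾ j ⊗ T m j

            ⟦Fᴾ⟧ : ∀ j z → ⟦ Fᴾ j ⟧ z ≡ F m j z
            ⟦Fᴾ⟧ j z = cong (_* ⟦ T m j ⟧ z) (⟦^⟧ var j z)

            -- Integration by parts, with `F (suc m)` expanded by `F-suc`, determines `F m (2 + j)`
            -- from `F m (suc j)` up to the coefficient m + j + 2, a unit because it is at most `K`.
            F-rep : ∀ j → j ℕ.≤ r → Rep 1ℤ l 1 (Fᴾ (suc j))
            F-rep zero _ = rep-unit (Fᴾ 1) (index-unit (suc m) (s≤s z≤n) sm≤K) (rep-cong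
              (λ z → sym (trans (cong (int (suc m) *_) (⟦Fᴾ⟧ 1 z)) (trans (by-parts₁ m z sm≤K)
                (trans (lem Λ ((ξ + z) ^ suc m) (ξ ^ suc m))
                  (cong (λ a → Λ * (a * 1ℤ) + - (Λ * ξ ^ suc m)) (sym (⟦^⟧ y (suc m) z)))))))
              (rep-⊕ (rep-scale Λ (mixed 0 z≤n)) (rep-const (- (Λ * ξ ^ suc m)))))
              where
              sm≤K : suc m ℕ.≤ K
              sm≤K = subst (λ i → suc i ℕ.≤ K) (ℕ.+-identityʳ m) (below z≤n)
              lem : ∀ Λ a b → Λ * (a - b) ≡ Λ * (a * 1ℤ) + - (Λ * b)
              lem = solve-∀
            F-rep (suc j) j<r = rep-unit (Fᴾ (2 ℕ.+ j)) (index-unit (suc (m ℕ.+ suc j)) (s≤s z≤n) (below j<r)) (rep-cong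
              (λ z → sym (begin
                int (suc m ℕ.+ suc j) * ⟦ Fᴾ (2 ℕ.+ j) ⟧ z
                  ≡⟨ cong₂ _*_ (pos-+ (suc m) (suc j)) (⟦Fᴾ⟧ (2 ℕ.+ j) z) ⟩
                (int (suc m) + int (suc j)) * F m (2 ℕ.+ j) z
                  ≡⟨ lem (int (suc m)) (int (suc j)) (F m (2 ℕ.+ j) z) ξ (F m (suc j) z) ⟩
                int (suc m) * F m (2 ℕ.+ j) z + int (suc j) * (F m (2 ℕ.+ j) z + ξ * F m (suc j) z) + - (int (suc j) * ξ) * F m (suc j) z
                  ≡⟨ cong (λ u → int (suc m) * F m (2 ℕ.+ j) z + int (suc j) * u + - (int (suc j) * ξ) * F m (suc j) z) (F-suc m (suc j) z) ⟨
                int (suc m) * F m (2 ℕ.+ j) z + int (suc j) * F (suc m) (suc j) z + - (int (suc j) * ξ) * F m (suc j) z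
                  ≡⟨ cong₂ _+_ (by-parts m (suc j) z (s≤s z≤n) (subst (ℕ._≤ K) (sym (ℕ.+-suc m (suc j))) (below j<r))) (cong (- (int (suc j) * ξ) *_) (sym (⟦Fᴾ⟧ (suc j) z))) ⟩
                Λ * ((ξ + z) ^ suc m * z ^ suc j) + - (int (suc j) * ξ) * ⟦ Fᴾ (suc j) ⟧ z
                  ≡⟨ cong (λ u → Λ * u + - (int (suc j) * ξ) * ⟦ Fᴾ (suc j) ⟧ z) (cong₂ _*_ (⟦^⟧ y (suc m) z) (⟦^⟧ var (suc j) z)) ⟨
                Λ * (⟦ y ^ᴾ suc m ⟧ z * ⟦ var ^ᴾ suc j ⟧ z) + - (int (suc j) * ξ) * ⟦ Fᴾ (suc j) ⟧ z ∎))
              (rep-⊕ (rep-scale Λ (mixed (suc j) j<r)) (rep-scale (- (int (suc j) * ξ)) (F-rep j (ℕ.≤-trans (ℕ.n≤1+n j) j<r)))))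
              where
              open ≡-Reasoning
              lem : ∀ m j a x b → (m + j) * a ≡ m * a + j * (a + x * b) + - (j * x) * b
              lem = solve-∀

            leading-unit : ∀ j → j ℕ.≤ r → Unit (⟦ T m (suc j) ⟧ 0ℤ)
            leading-unit j j≤r = subst Unit (sym (T-at-0 m (suc j))) (unit-* (unit-^ m ξ-unit)
              (unit-factorʳ {int (suc j)} {Λ/ (suc j)} (Λ/-eq (suc j) (s≤s z≤n) (ℕ.≤-trans (s≤s (ℕ.m≤n+m j m)) (below j≤r))) Λ-unit))

            -- A triangular system solved from the top degree down: `F m (suc t)` is a unit times
            -- z^(t + 1) plus terms of higher degree, which are already representable; beyond degree
            -- `l` all is tail.
            shifted : ∀ n t → t ℕ.+ n ≡ l → ∀ g → Rep 1ℤ l 1 (var ^ᴾ suc t ⊗ g)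
            shifted zero t eq g rewrite trans (sym (ℕ.+-identityʳ t)) eq = rep-cong (λ z → *-identityˡ _) (rep-tail g)
            shifted (suc n) t eq g with split g | split (T m (suc t))
            ... | c , g′ , e | c₀ , T′ , e₀ = rep-cong
              (λ z → trans (lem c z (⟦ var ^ᴾ suc t ⟧ z) (⟦ g′ ⟧ z)) (cong (⟦ var ^ᴾ suc t ⟧ z *_) (sym (e z))))
              (rep-⊕ (rep-scale c monomial) (higher g′))
              where
              lem : ∀ c z y g → c * y + z * y * g ≡ y * (c + z * g)
              lem = solve-∀
              lem′ : ∀ c z y g → y * (c + z * g) + -1ℤ * (z * y * g) ≡ c * y
              lem′ = solve-∀
              t≤r : t ℕ.≤ r
              t≤r = ℕ.≤-pred (subst (suc t ℕ.≤_) (trans (sym (ℕ.+-suc t n)) (trans eq l≡)) (ℕ.m≤m+n (suc t) n))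
              higher : ∀ g → Rep 1ℤ l 1 (var ^ᴾ (2 ℕ.+ t) ⊗ g)
              higher = shifted n (suc t) (trans (sym (ℕ.+-suc t n)) eq)
              c₀-unit : Unit c₀
              c₀-unit = subst Unit (trans (e₀ 0ℤ) (+-identityʳ c₀)) (leading-unit t t≤r)
              monomial : Rep 1ℤ l 1 (var ^ᴾ suc t)
              monomial = rep-unit (var ^ᴾ suc t) c₀-unit (rep-cong
                (λ z → trans (cong (λ u → ⟦ var ^ᴾ suc t ⟧ z * u + -1ℤ * (⟦ var ^ᴾ (2 ℕ.+ t) ⟧ z * ⟦ T′ ⟧ z)) (e₀ z))
                  (lem′ c₀ z (⟦ var ^ᴾ suc t ⟧ z) (⟦ T′ ⟧ z)))
                (rep-⊕ (F-rep t t≤r) (rep-scale -1ℤ (higher T′))))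

          osculating-monomial : ∀ t → 1 ℕ.≤ t → t ℕ.≤ l → Rep 1ℤ l 1 (var ^ᴾ t)
          osculating-monomial (suc t) _ t<l = rep-cong (λ z → *-identityʳ _)
            (shifted (l ℕ.∸ t) t (ℕ.m+[n∸m]≡n (ℕ.≤-trans (ℕ.n≤1+n t) t<l)) (con 1ℤ))

    private
      choose : ∀ {k} {Q : ℕ → Poly → Set} → (∀ i → 1 ℕ.≤ i → i ℕ.≤ k → ∃ (Q i)) →
        Σ[ ψ ∈ (ℕ → Poly) ] (∀ i → 1 ℕ.≤ i → i ℕ.≤ k → Q i (ψ i))
      choose {k} {Q} f = ψ , ψ-spec
        where
        ψ : ℕ → Poly
        ψ i with 1 ℕ.≤? i | i ℕ.≤? k
        ... | yes lo | yes hi = proj₁ (f i lo hi)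
        ... | _ | _ = con 0ℤ
        ψ-spec : ∀ i → 1 ℕ.≤ i → i ℕ.≤ k → Q i (ψ i)
        ψ-spec i lo hi with 1 ℕ.≤? i | i ℕ.≤? k
        ... | yes lo′ | yes hi′ = proj₂ (f i lo′ hi′)
        ... | no ¬lo | _ = contradiction lo ¬lo
        ... | yes _ | no ¬hi = contradiction hi ¬hi

      -- Every z brings a factor P^a. The tail has degree at least l + 1 > j, hence at least one
      -- factor P^a more than z^j, and a ≥ 1 makes the correction divisible by P.
      dilate : ∀ l a j → 1 ℕ.≤ a → j ℕ.≤ l → ∀ A → Σ[ ψ ∈ Poly ]
        (∀ z → (P ^ a * z) ^ j - 1ℤ * ((P ^ a * z) ^ suc l * ⟦ A ⟧ (P ^ a * z)) ≡ P ^ (a ℕ.* j) * (z ^ j + P * ⟦ ψ ⟧ z))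
      dilate l (suc a) j _ j≤l A =
        con -1ℤ ⊗ (var ^ᴾ j ⊗ (con (P ^ a) ⊗ var) ⊗ (s ^ᴾ (l ℕ.∸ j) ⊗ (A ∘ᴾ s))) , λ z →
        begin
          (P ^ suc a * z) ^ j - 1ℤ * ((P ^ suc a * z) ^ suc l * ⟦ A ⟧ (P ^ suc a * z))
            ≡⟨ cong (λ i → (P ^ suc a * z) ^ j - 1ℤ * ((P ^ suc a * z) ^ i * ⟦ A ⟧ (P ^ suc a * z)))
                 (trans (cong suc (sym (ℕ.m+[n∸m]≡n j≤l))) (sym (ℕ.+-suc j (l ℕ.∸ j)))) ⟩
          (P ^ suc a * z) ^ j - 1ℤ * ((P ^ suc a * z) ^ (j ℕ.+ suc (l ℕ.∸ j)) * ⟦ A ⟧ (P ^ suc a * z))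
            ≡⟨ cong (λ u → (P ^ suc a * z) ^ j - 1ℤ * (u * ⟦ A ⟧ (P ^ suc a * z))) (^-distribˡ-+-* (P ^ suc a * z) j (suc (l ℕ.∸ j))) ⟩
          (P ^ suc a * z) ^ j - 1ℤ * ((P ^ suc a * z) ^ j * (P * P ^ a * z * (P ^ suc a * z) ^ (l ℕ.∸ j)) * ⟦ A ⟧ (P ^ suc a * z))
            ≡⟨ cong (λ u → u - 1ℤ * (u * (P * P ^ a * z * (P ^ suc a * z) ^ (l ℕ.∸ j)) * ⟦ A ⟧ (P ^ suc a * z)))
                 (trans (*-^ (P ^ suc a) z j) (cong (_* z ^ j) (^-*-assoc P (suc a) j))) ⟩
          P ^ (suc a ℕ.* j) * z ^ j - 1ℤ * (P ^ (suc a ℕ.* j) * z ^ j * (P * P ^ a * z * (P ^ suc a * z) ^ (l ℕ.∸ j)) * ⟦ A ⟧ (P ^ suc a * z))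
            ≡⟨ lem (P ^ (suc a ℕ.* j)) (z ^ j) P (P ^ a) z ((P ^ suc a * z) ^ (l ℕ.∸ j)) (⟦ A ⟧ (P ^ suc a * z)) ⟩
          P ^ (suc a ℕ.* j) * (z ^ j + P * (-1ℤ * (z ^ j * (P ^ a * z) * ((P ^ suc a * z) ^ (l ℕ.∸ j) * ⟦ A ⟧ (P ^ suc a * z)))))
            ≡⟨ cong (λ u → P ^ (suc a ℕ.* j) * (z ^ j + P * (-1ℤ * u))) (cong₂ (λ u v → u * (P ^ a * z) * v) (⟦^⟧ var j z)
                 (cong₂ _*_ (⟦^⟧ s (l ℕ.∸ j) z) (⟦∘⟧ A s z))) ⟨
          P ^ (suc a ℕ.* j) * (z ^ j + P * (-1ℤ * (⟦ var ^ᴾ j ⟧ z * (P ^ a * z) * (⟦ s ^ᴾ (l ℕ.∸ j) ⟧ z * ⟦ A ∘ᴾ s ⟧ z)))) ∎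
        where
        open ≡-Reasoning
        s = con (P ^ suc a) ⊗ var
        lem : ∀ c y p pa z w b → c * y - 1ℤ * (c * y * (p * pa * z * w) * b) ≡ c * (y + p * (-1ℤ * (y * (pa * z) * (w * b))))
        lem = solve-∀

      ^-∣-^ : ∀ {m n} → m ℕ.≤ n → P ^ m ∣ P ^ n
      ^-∣-^ {m} {n} le = subst (λ i → P ^ m ∣ P ^ i) (ℕ.m+[n∸m]≡n le)
        (subst (P ^ m ∣_) (sym (^-distribˡ-+-* P m (n ℕ.∸ m))) (∣m⇒∣m*n _ ∣-refl))

    -- Bootstrapping: if P^j divides a - b, then P^(j + 1) divides the difference of the
    -- perturbations, and thus a - b itself as long as j < N.
    curve-injective : ∀ q N a b → P ^ N ∣ curve q 1 a - curve q 1 b → P ^ N ∣ a - b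
    curve-injective q N a b d = go N ℕ.≤-refl
      where
      lem : ∀ p a b x y → (a * 1ℤ + p * x - (b * 1ℤ + p * y)) - p * (x - y) ≡ a - b
      lem = solve-∀
      go : ∀ j → j ℕ.≤ N → P ^ j ∣ a - b
      go zero _ = divides (a - b) (sym (*-identityʳ (a - b)))
      go (suc j) j<N = subst (P ^ suc j ∣_) (lem P a b (⟦ q 1 ⟧ a) (⟦ q 1 ⟧ b))
        (∣m∣n⇒∣m-n (∣-trans (^-∣-^ j<N) d)
          (*-monoʳ-∣ P (∣-trans (go j (ℕ.≤-trans (ℕ.n≤1+n j) j<N)) (difference-divides (q 1) a b))))

    module _ .{{_ : NonZero P}} where
      private
        cancel : ∀ {L M} i {x} → L ℕ.+ i ℕ.≤ M → P ^ M ∣ P ^ i * x → P ^ L ∣ x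
        cancel {L} i {x} le d = go i (subst (_∣ P ^ i * x) (cong (P ^_) (ℕ.+-comm L i)) (∣-trans (^-∣-^ le) d))
          where
          go : ∀ i → P ^ (i ℕ.+ L) ∣ P ^ i * x → P ^ L ∣ x
          go zero d = subst (P ^ L ∣_) (*-identityˡ x) d
          go (suc i) d = go i (*-cancelˡ-∣ P (subst (P ^ (suc i ℕ.+ L) ∣_) (*-assoc P (P ^ i) x) d))

        -- ψ must not depend on Δ, hence the passage through Good.
        rescaled : ∀ Hyp l a M → 1 ℕ.≤ a →
          (∀ t → 1 ℕ.≤ t → t ℕ.≤ l → Good.Rep Hyp (P ^ M) 1ℤ l 1 (var ^ᴾ t)) →
          Σ[ ψ ∈ (ℕ → Poly) ] (∀ i → 1 ℕ.≤ i → i ℕ.≤ l → ∀ Δ → Hyp (pullback (P ^ a *_) Δ) →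
            ∀ L → L ℕ.+ a ℕ.* i ℕ.≤ M → P ^ L ∣ ap Δ (curve ψ i))
        rescaled Hyp l a M 1≤a monomial = proj₁ chosen , λ i lo hi Δ h L le → cancel (a ℕ.* i) le (proj₂ chosen i lo hi Δ h)
          where
          Spec : ℕ → Poly → Set
          Spec i ψ = ∀ Δ → Hyp (pullback (P ^ a *_) Δ) → P ^ M ∣ P ^ (a ℕ.* i) * ap Δ (λ z → z ^ i + P * ⟦ ψ ⟧ z)
          one : ∀ i → 1 ℕ.≤ i → i ℕ.≤ l → ∃ (Spec i)
          one i lo hi = proj₁ D , λ Δ h → subst (P ^ M ∣_)
            (trans (ap-cong Δ (proj₂ D)) (ap-scale Δ (P ^ (a ℕ.* i)) (λ z → z ^ i + P * ⟦ proj₁ D ⟧ z)))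
            (proj₂ E (pullback (P ^ a *_) Δ) h)
            where
            E = Good.Eliminate.eliminate Hyp (P ^ M) 1ℤ P (*-identityˡ P) l monomial M refl i lo hi
            D = dilate l a i 1≤a hi (proj₁ E)
          chosen = choose {l} {Spec} one

      -- Anisotropic rescaling: on the class of ξ modulo P^a the i-th coordinate shrinks by P^(a i),
      -- so P^M leaves P^(M - a i) after division.
      curve-rescale : ∀ q k ξ a M → 1 ℕ.≤ a → Σ[ ψ ∈ (ℕ → Poly) ] (∀ Δ →
        (∀ i → 1 ℕ.≤ i → i ℕ.≤ k → P ^ M ∣ ap Δ (λ z → curve q i (ξ + P ^ a * z))) →
        ∀ i → 1 ℕ.≤ i → i ℕ.≤ k → ∀ L → L ℕ.+ a ℕ.* i ℕ.≤ M → P ^ L ∣ ap Δ (curve ψ i))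
      curve-rescale q k ξ a M 1≤a = proj₁ result , λ Δ h i lo hi → proj₂ result i lo hi Δ h
        where
        Hyp : Functional → Set
        Hyp Δ = ∀ i → 1 ℕ.≤ i → i ℕ.≤ k → P ^ M ∣ ap Δ (λ z → curve q i (ξ + z))
        result = rescaled Hyp k a M 1≤a (λ t _ → Good.curve-monomial Hyp (P ^ M) q ξ k (λ i lo hi Δ h → h i lo hi) t)

      -- The last r coordinates of the curve, taken in the osculating frame at η, are
      -- divisible by P ^ (suc m * b) on η + P ^ b ℤ; away from η they form a curve again.
      curve-project : ∀ K Λ Λ/ → Unit Λ → (∀ j → 1 ℕ.≤ j → j ℕ.≤ K → int j * Λ/ j ≡ Λ) →
        ∀ q m r ξ η a b M → 1 ℕ.≤ a → 1 ℕ.≤ r → m ℕ.+ r ℕ.≤ K → suc m ℕ.* b ℕ.≤ M → Unit (ξ - η) →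
        Σ[ ψ ∈ (ℕ → Poly) ] (∀ Δ Δ′ →
          (∀ i → 1 ℕ.≤ i → i ℕ.≤ m ℕ.+ r →
            P ^ M ∣ ap Δ (λ z → curve q i (ξ + P ^ a * z)) + ap Δ′ (λ w → curve q i (η + P ^ b * w))) →
          ∀ i → 1 ℕ.≤ i → i ℕ.≤ r → ∀ L → L ℕ.+ a ℕ.* i ℕ.≤ suc m ℕ.* b → P ^ L ∣ ap Δ (curve ψ i))
      curve-project K Λ Λ/ Λ-unit Λ/-eq q m r@(suc r′) ξ η a b M 1≤a _ m+r≤K ≤M ξ-η-unit = proj₁ result ,
        λ Δ Δ′ h i lo hi → proj₂ result i lo hi Δ (hyp₂ Δ Δ′ h)
        where
        k = m ℕ.+ r
        y = con (ξ - η) ⊕ var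
        Hyp₁ : Functional → Set
        Hyp₁ Δ = ∀ i → 1 ℕ.≤ i → i ℕ.≤ k → P ^ M ∣ ap Δ (λ z → curve q i (η + z))
        module G₁ = Good Hyp₁ (P ^ M)
        -- The choice π = P matters here: after the translation from η to ξ the tail is a multiple
        -- of P and joins the error in `top`.
        frame : ∀ i → 1 ℕ.≤ i → i ℕ.≤ k → Σ[ A ∈ Poly ] G₁.Good (λ z → z ^ i - P * (z ^ suc k * ⟦ A ⟧ z))
        frame = G₁.Eliminate.eliminate P 1ℤ (*-identityʳ P) k
          (λ t _ → G₁.curve-monomial q η k (λ i lo hi Δ h → h i lo hi) t) M refl
        A : ℕ → Poly
        A = proj₁ (choose frame)
        A-good : ∀ i → 1 ℕ.≤ i → i ℕ.≤ k → G₁.Good (λ z → z ^ i - P * (z ^ suc k * ⟦ A i ⟧ z))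
        A-good = proj₂ (choose frame)
        f : ℕ → ℤ → ℤ
        f i x = x ^ i - P * (x ^ suc k * ⟦ A i ⟧ x)
        Hyp₂ : Functional → Set
        Hyp₂ Δ = ∀ i → 1 ℕ.≤ i → i ℕ.≤ r → P ^ (suc m ℕ.* b) ∣ ap Δ (λ z → f (m ℕ.+ i) (ξ - η + z))
        module G₂ = Good Hyp₂ (P ^ (suc m ℕ.* b))
        top : ∀ i → 1 ℕ.≤ i → i ℕ.≤ r → G₂.Rep 1ℤ r 1 (y ^ᴾ (m ℕ.+ i))
        top i lo hi = G₂.rep-cong
          (λ z → trans (cong (λ p → ⟦ y ^ᴾ (m ℕ.+ i) ⟧ z + -1ℤ * (P * ⟦ t ⟧ z) + p * ⟦ t ⟧ z) (*-identityʳ P)) (lem (⟦ y ^ᴾ (m ℕ.+ i) ⟧ z) P (⟦ t ⟧ z)))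
          (G₂.rep-⊕ (G₂.rep-good {f = y ^ᴾ (m ℕ.+ i) ⊕ con -1ℤ ⊗ (con P ⊗ t)} (G₂.good-cong
            (λ z → trans (lem′ ((ξ - η + z) ^ (m ℕ.+ i)) P _) (cong₂ (λ u v → u + -1ℤ * (P * v)) (sym (⟦^⟧ y (m ℕ.+ i) z))
              (sym (cong₂ _*_ (⟦^⟧ y (suc k) z) (⟦∘⟧ (A (m ℕ.+ i)) y z)))))
            (λ Δ h → h i lo hi)))
            (G₂.rep-error t))
          where
          t = y ^ᴾ suc k ⊗ (A (m ℕ.+ i) ∘ᴾ y)
          lem : ∀ a p b → a + -1ℤ * (p * b) + p * b ≡ a
          lem = solve-∀
          lem′ : ∀ a p b → a - p * b ≡ a + -1ℤ * (p * b)
          lem′ = solve-∀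
        result = rescaled Hyp₂ r a (suc m ℕ.* b) 1≤a
          (G₂.Osculating.osculating-monomial (ξ - η) ξ-η-unit K Λ Λ-unit Λ/ Λ/-eq m r′ m+r≤K refl top)
        power-divides : ∀ i w → suc m ℕ.≤ i → P ^ (suc m ℕ.* b) ∣ (P ^ b * w) ^ i
        power-divides i w le = subst (P ^ (suc m ℕ.* b) ∣_) (sym (*-^ (P ^ b) w i)) (∣m⇒∣m*n (w ^ i)
          (subst (P ^ (suc m ℕ.* b) ∣_) (sym (^-*-assoc P b i))
            (^-∣-^ (subst (ℕ._≤ b ℕ.* i) (ℕ.*-comm b (suc m)) (ℕ.*-monoʳ-≤ b le)))))
        ap-divides : ∀ Δ n g → (∀ w → n ∣ g w) → n ∣ ap Δ g
        ap-divides Δ n g d = subst (n ∣_)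
          (sym (trans (ap-cong Δ (λ w → trans (_∣_.equality (d w)) (*-comm _ n))) (ap-scale Δ n (λ w → _∣_.quotient (d w)))))
          (∣m⇒∣m*n _ ∣-refl)
        hyp₂ : ∀ Δ Δ′ → (∀ i → 1 ℕ.≤ i → i ℕ.≤ k →
            P ^ M ∣ ap Δ (λ z → curve q i (ξ + P ^ a * z)) + ap Δ′ (λ w → curve q i (η + P ^ b * w))) →
          Hyp₂ (pullback (P ^ a *_) Δ)
        -- Coordinate m + i of the frame vanishes at η to order at least m + 1, so the class of η
        -- contributes a multiple of P^((m + 1) b). Subtracting it leaves a condition on Δ alone.
        hyp₂ Δ Δ′ h i lo hi = ∣m+n∣n⇒∣m
          (∣-trans (^-∣-^ ≤M) (A-good (m ℕ.+ i) (ℕ.≤-trans lo (ℕ.m≤n+m i m)) (ℕ.+-monoʳ-≤ m hi)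
            (pullback (λ z → ξ - η + P ^ a * z) Δ ⊞ pullback (P ^ b *_) Δ′)
            (λ i lo hi → subst (P ^ M ∣_) (cong (_+ ap Δ′ (λ w → curve q i (η + P ^ b * w)))
              (ap-cong Δ (λ z → cong (curve q i) (lem ξ η (P ^ a * z))))) (h i lo hi))))
          (ap-divides Δ′ (P ^ (suc m ℕ.* b)) (λ w → f (m ℕ.+ i) (P ^ b * w)) (λ w → ∣m∣n⇒∣m-n
            (power-divides (m ℕ.+ i) w (subst (ℕ._≤ m ℕ.+ i) (ℕ.+-comm m 1) (ℕ.+-monoʳ-≤ m lo)))
            (∣n⇒∣m*n P (∣m⇒∣m*n _ (power-divides (suc k) w (s≤s (ℕ.m≤m+n m r)))))))
          where
          lem : ∀ ξ η x → ξ + x ≡ η + (ξ - η + x)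
          lem = solve-∀

-- Moments of exponential sums, residue classes and the broad-narrow dichotomy.

module MeanValues where

  open import Algebra.Structures using (IsMonoid)
  import Algebra.Solver.Ring.NaturalCoefficients.Default
  open import Data.Bool using (if_then_else_)
  open import Data.List using (List; []; _∷_; _++_; map; length; filter; downFrom)
  open import Data.List.Properties using (length-downFrom; length-map)
  open import Data.List.Membership.Propositional using (_∈_)
  open import Data.List.Relation.Binary.Sublist.Propositional using (_⊆_; []; _∷_; _∷ʳ_; ⊆-trans; lookup)
  open import Data.List.Relation.Binary.Sublist.Propositional.Properties using (filter-⊆; All-resp-⊆)
  open import Data.List.Relation.Unary.All as All using (All; []; _∷_)
  import Data.List.Relation.Unary.All.Properties as All
  open import Data.List.Relation.Unary.Any using (here; there)
  open import Data.Nat as ℕ using (ℕ; zero; suc; _≤_; _<_; z≤n)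
  import Data.Nat.Properties as ℕ
  open import Data.Nat.Tactic.RingSolver using () renaming (solve-∀ to ℕ-solve-∀)
  open import Data.Product using (∃; ∃₂; _×_; _,_; proj₁; proj₂)
  open import Data.Sum as Sum using (_⊎_; inj₁; inj₂)
  open import Function using (_∘_)
  open import Relation.Binary.PropositionalEquality as ≡ using (_≡_; _≢_; subst; cong; cong₂)
  open import Relation.Nullary using (¬_; Dec; yes; no; does; contradiction)
  open import Relation.Nullary.Decidable using (¬?)
  open import Relation.Unary using (Decidable)
  open PowerInequalities
  open TraceSemirings

  module Means {G : Set} {_∙_ : G → G → G} {ε : G} (isMonoid : IsMonoid _≡_ _∙_ ε)
    (T : GroupTrace _∙_ ε) {ι : Set} (e : ι → G) where

    open GroupTrace T public
    open TraceLemmas traceSemiring public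
    open IsMonoid isMonoid using () renaming (assoc to ∙-assoc; identityˡ to ∙-identityˡ)
    open Algebra.Solver.Ring.NaturalCoefficients.Default commutativeSemiring using (solve; _:+_; _:*_; _:=_; con)

    lst : List ι → Carrier
    lst [] = 0#
    lst (x ∷ S) = point (e x) + lst S

    total : List ι → G
    total [] = ε
    total (x ∷ xs) = e x ∙ total xs

    -- The weighted moment of order 2 u of the exponential sum over `S`.
    mean : List ι → ℕ → Carrier → ℕ
    mean S u w = τ (nsq (lst S) ^ u * nsq w)

    private
      left-comm : ∀ a b c → a + (b + c) ≈ b + (a + c)
      left-comm = solve 3 (λ a b c → a :+ (b :+ c) := b :+ (a :+ c)) refl

    sublist-⊑ : ∀ {S₀ S} → S₀ ⊆ S → lst S₀ ⊑ lst S
    sublist-⊑ [] = ⊑-refl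
    sublist-⊑ (x ∷ʳ sub) = let c , eq = sublist-⊑ sub in
      point (e x) + c , trans (+-congˡ eq) (left-comm (point (e x)) _ c)
    sublist-⊑ (_∷_ {x} ≡.refl sub) = let c , eq = sublist-⊑ sub in
      c , trans (+-congˡ eq) (sym (+-assoc (point (e x)) _ c))

    lst-filter : ∀ {P : ι → Set} (P? : Decidable P) S → lst S ≈ lst (filter P? S) + lst (filter (¬? ∘ P?) S)
    lst-filter P? [] = sym (+-identityʳ 0#)
    lst-filter P? (x ∷ S) with P? x | lst-filter P? S
    ... | yes _ | eq = trans (+-congˡ eq) (sym (+-assoc (point (e x)) _ _))
    ... | no _ | eq = trans (+-congˡ eq) (left-comm (point (e x)) _ _)

    private
      pick : ∀ {A : Set} → Dec A → Carrier → Carrier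
      pick d c = if does d then c else 0#

      lst-filter-∷ : ∀ {P : ι → Set} (P? : Decidable P) x S → lst (filter P? (x ∷ S)) ≈ pick (P? x) (point (e x)) + lst (filter P? S)
      lst-filter-∷ P? x S with P? x
      ... | yes _ = refl
      ... | no _ = sym (+-identityˡ _)

      filter-none : ∀ {P : ι → Set} (P? : Decidable P) {xs} → All (λ i → ¬ P i) xs → filter P? xs ≡ []
      filter-none P? [] = ≡.refl
      filter-none P? {x ∷ _} (¬p ∷ ps) with P? x
      ... | yes p = contradiction p ¬p
      ... | no _ = filter-none P? ps

      pick-no : ∀ {A : Set} {c} (d : Dec A) → ¬ A → pick d c ≡ 0#
      pick-no (yes a) ¬a = contradiction a ¬a
      pick-no (no _) _ = ≡.refl

      pick-yes : ∀ {A : Set} {c} (d : Dec A) → A → pick d c ≡ c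
      pick-yes (yes _) _ = ≡.refl
      pick-yes (no ¬a) a = contradiction a ¬a

    class : (ι → ℕ) → ℕ → List ι → List ι
    class ρ ζ = filter (λ i → ρ i ℕ.≟ ζ)

    class-⊆ : ∀ ρ ζ S → class ρ ζ S ⊆ S
    class-⊆ ρ ζ S = filter-⊆ (λ i → ρ i ℕ.≟ ζ) S

    class-all : ∀ ρ ζ S → All (λ i → ρ i ≡ ζ) (class ρ ζ S)
    class-all ρ ζ S = All.all-filter (λ i → ρ i ℕ.≟ ζ) S

    partition : ∀ ρ n S → All (λ i → ρ i < n) S → lst S ≈ sumR (map (λ ζ → lst (class ρ ζ S)) (downFrom n))
    partition ρ n [] [] = sym (zeros (downFrom n))
      where
      zeros : ∀ (ζs : List ℕ) → sumR (map (λ _ → 0#) ζs) ≈ 0#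
      zeros [] = refl
      zeros (_ ∷ ζs) = trans (+-identityˡ _) (zeros ζs)
    partition ρ n (x ∷ S) (b ∷ bs) = trans (+-cong (sym (once n b)) (partition ρ n S bs)) (sym (separate (downFrom n)))
      where
      chosen : ℕ → Carrier
      chosen ζ = pick (ρ x ℕ.≟ ζ) (point (e x))
      separate : ∀ ζs → sumR (map (λ ζ → lst (class ρ ζ (x ∷ S))) ζs) ≈ sumR (map chosen ζs) + sumR (map (λ ζ → lst (class ρ ζ S)) ζs)
      separate [] = sym (+-identityʳ 0#)
      separate (ζ ∷ ζs) = trans (+-cong (lst-filter-∷ (λ i → ρ i ℕ.≟ ζ) x S) (separate ζs))
        (solve 4 (λ a b c d → (a :+ b) :+ (c :+ d) := (a :+ c) :+ (b :+ d)) refl _ _ _ _)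
      never : ∀ n → n ≤ ρ x → sumR (map chosen (downFrom n)) ≈ 0#
      never zero _ = refl
      never (suc n) le = trans (+-cong (reflexive (pick-no (ρ x ℕ.≟ n) (ℕ.<⇒≢ le ∘ ≡.sym))) (never n (ℕ.≤-trans (ℕ.n≤1+n n) le)))
        (+-identityʳ 0#)
      once : ∀ n → ρ x < n → sumR (map chosen (downFrom n)) ≈ point (e x)
      once (suc n) lt with ℕ.m<1+n⇒m<n∨m≡n lt
      ... | inj₁ lt′ = trans (+-cong (reflexive (pick-no (ρ x ℕ.≟ n) (ℕ.<⇒≢ lt′))) (once n lt′)) (+-identityˡ _)
      ... | inj₂ eq = trans (+-cong (reflexive (pick-yes (ρ x ℕ.≟ n) eq)) (never n (ℕ.≤-reflexive (≡.sym eq)))) (+-identityʳ _)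

    private
      all-map : ∀ {A B : Set} {P : B → Set} (f : A → B) {xs} → All (λ x → P (f x)) xs → All P (map f xs)
      all-map f [] = []
      all-map f (p ∷ ps) = p ∷ all-map f ps

    -- `power-triangle` over the n classes: the loss n^(2 (v + 1)) is the one without any
    -- cancellation.
    largest-class : ∀ ρ n S w v → 1 ≤ n → All (λ i → ρ i < n) S →
      ∃ λ ζ → mean S (suc v) w ≤ (n ℕ.* n) ℕ.^ suc v ℕ.* mean (class ρ ζ S) (suc v) w
    largest-class ρ (suc n) S w v _ bounded with maximal (λ ζ → mean (class ρ ζ S) (suc v) w) n (downFrom n)
    ... | ζ , _ , maxi = ζ , subst (λ l → mean S (suc v) w ≤ (l ℕ.* l) ℕ.^ suc v ℕ.* mean (class ρ ζ S) (suc v) w)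
      (≡.trans (length-map (λ ζ → lst (class ρ ζ S)) (downFrom (suc n))) (length-downFrom (suc n)))
      (power-triangle (map (λ ζ → lst (class ρ ζ S)) (downFrom (suc n))) v (partition ρ (suc n) S bounded)
        (all-map (λ ζ → lst (class ρ ζ S)) maxi))

    ∋-lst : ∀ S {x} → lst S ∋ x → ∃ λ i → i ∈ S × x ≡ e i
    ∋-lst [] x∈ = contradiction x∈ ∋-0#
    ∋-lst (s ∷ S) x∈ with ∋-+ (point (e s)) (lst S) x∈
    ... | inj₁ p = s , here ≡.refl , ∋-point p
    ... | inj₂ p = let i , i∈ , eq = ∋-lst S p in i , there i∈ , eq

    private
      cross-zero : ∀ S S′ L → (∀ x x′ y y′ → x ∈ S → x′ ∈ S′ → L ∋ y → L ∋ y′ → e x ∙ y ≢ e x′ ∙ y′) →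
        τ (lst S * conj (lst S′) * nsq L) ≡ 0
      cross-zero S S′ L disj = ≡.trans
        (τ-cong (trans (solve 4 (λ a b c d → a :* b :* (c :* d) := a :* c :* (b :* d)) refl (lst S) (conj (lst S′)) L (conj L))
          (*-congˡ (sym (conj-* (lst S′) L)))))
        (disjoint (lst S * L) (lst S′ * L) λ x∈ x∈′ →
          let u , v , u∈ , v∈ , eq = ∋-* (lst S) L x∈
              u′ , v′ , u′∈ , v′∈ , eq′ = ∋-* (lst S′) L x∈′
              i , i∈ , eqᵢ = ∋-lst S u∈
              j , j∈ , eqⱼ = ∋-lst S′ u′∈
          in disj i j v v′ i∈ j∈ v∈ v′∈ (≡.trans (cong (_∙ v) (≡.sym eqᵢ)) (≡.trans (≡.sym eq) (≡.trans eq′ (cong (_∙ v′) eqⱼ)))))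

    -- If coincidences force equal classes, products of different classes with `L` have disjoint
    -- frequencies and the cross terms vanish. The second moment is then additive, so the loss is
    -- the number of classes and not its square.
    orthogonal-classes : ∀ ρ n S L → All (λ i → ρ i < n) S →
      (∀ x x′ y y′ → x ∈ S → x′ ∈ S → L ∋ y → L ∋ y′ → e x ∙ y ≡ e x′ ∙ y′ → ρ x ≡ ρ x′) →
      ∃₂ λ S₀ ζ → S₀ ⊆ S × All (λ i → ρ i ≡ ζ) S₀ × mean S 1 L ≤ n ℕ.* mean S₀ 1 L
    orthogonal-classes ρ zero [] L [] _ = [] , 0 , [] , [] , ℕ.≤-reflexive
      (≡.trans (τ-cong (trans (*-congʳ (trans (*-congʳ (zeroˡ (conj 0#))) (zeroˡ 1#))) (zeroˡ (nsq L)))) τ-0#)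
    orthogonal-classes ρ (suc n) S L bounded orth
      with orthogonal-classes ρ n S₂ L bounded₂ (λ x x′ y y′ x∈ x′∈ → orth x x′ y y′ (lookup S₂⊆ x∈) (lookup S₂⊆ x′∈))
      where
      S₂ = filter (¬? ∘ (λ i → ρ i ℕ.≟ n)) S
      S₂⊆ = filter-⊆ (¬? ∘ (λ i → ρ i ℕ.≟ n)) S
      bounded₂ : All (λ i → ρ i < n) S₂
      bounded₂ = All.zipWith (λ (lt , ≢) → ℕ.≤∧≢⇒< (ℕ.≤-pred lt) ≢)
        (All-resp-⊆ S₂⊆ bounded , All.all-filter (¬? ∘ (λ i → ρ i ℕ.≟ n)) S)
    ... | S₀ , ζ , S₀⊆ , all₀ , bound = goal (ℕ.≤-total (mean S₁ 1 L) (mean S₀ 1 L))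
      where
      S₁ = class ρ n S
      S₂ = filter (¬? ∘ (λ i → ρ i ℕ.≟ n)) S
      S₂⊆ = filter-⊆ (¬? ∘ (λ i → ρ i ℕ.≟ n)) S
      f = lst S₁
      g = lst S₂
      W = nsq L
      expand : nsq (lst S) ^ 1 * W ≈ ((nsq f ^ 1 * W) + (nsq g ^ 1 * W)) + (f * conj g * W + g * conj f * W)
      expand = trans (*-congʳ (*-congʳ (trans (nsq-cong (lst-filter (λ i → ρ i ℕ.≟ n) S)) (*-congˡ (conj-+ f g)))))
        (solve 5 (λ f g x y w → ((f :+ g) :* (x :+ y) :* con 1) :* w :=
          (f :* x :* con 1 :* w :+ g :* y :* con 1 :* w) :+ (f :* y :* w :+ g :* x :* w)) refl f g (conj f) (conj g) W)
      in₁ : ∀ {x} → x ∈ S₁ → ρ x ≡ n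
      in₁ = All.lookup (class-all ρ n S)
      in₂ : ∀ {x} → x ∈ S₂ → ρ x ≢ n
      in₂ = All.lookup (All.all-filter (¬? ∘ (λ i → ρ i ℕ.≟ n)) S)
      additive : mean S 1 L ≡ mean S₁ 1 L ℕ.+ mean S₂ 1 L
      additive = ≡.trans (τ-cong expand) (≡.trans (τ-+ _ _) (≡.trans (cong₂ ℕ._+_ (τ-+ _ _) (≡.trans (τ-+ _ _) (cong₂ ℕ._+_
        (cross-zero S₁ S₂ L λ x x′ y y′ x∈ x′∈ y∈ y′∈ eq → in₂ x′∈ (≡.trans
          (≡.sym (orth x x′ y y′ (lookup (class-⊆ ρ n S) x∈) (lookup S₂⊆ x′∈) y∈ y′∈ eq)) (in₁ x∈)))
        (cross-zero S₂ S₁ L λ x x′ y y′ x∈ x′∈ y∈ y′∈ eq → in₂ x∈ (≡.trans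
          (orth x x′ y y′ (lookup S₂⊆ x∈) (lookup (class-⊆ ρ n S) x′∈) y∈ y′∈ eq) (in₁ x′∈)))))) (ℕ.+-identityʳ _)))
      goal : mean S₁ 1 L ≤ mean S₀ 1 L ⊎ mean S₀ 1 L ≤ mean S₁ 1 L → _
      goal (inj₁ le) = S₀ , ζ , ⊆-trans S₀⊆ S₂⊆ , all₀ ,
        ℕ.≤-trans (ℕ.≤-reflexive additive) (ℕ.+-mono-≤ le bound)
      goal (inj₂ ge) = S₁ , n , class-⊆ ρ n S , class-all ρ n S ,
        ℕ.≤-trans (ℕ.≤-reflexive additive) (ℕ.+-monoʳ-≤ (mean S₁ 1 L) (ℕ.≤-trans bound (ℕ.*-monoʳ-≤ n ge)))

    Tuple : ℕ → List ι → List ι → Set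
    Tuple n S xs = length xs ≡ n × All (_∈ S) xs

    ∋-power : ∀ S v {y} → lst S ^ v ∋ y → ∃ λ ws → Tuple v S ws × y ≡ total ws
    ∋-power S zero y∈ = [] , (≡.refl , []) , ∋-1# y∈
    ∋-power S (suc v) y∈ =
      let a , t , a∈ , t∈ , eq = ∋-* (lst S) (lst S ^ v) y∈
          i , i∈ , eqᵢ = ∋-lst S a∈
          ws , (len , all) , eq′ = ∋-power S v t∈
      in i ∷ ws , (cong suc len , i∈ ∷ all) , ≡.trans eq (cong₂ _∙_ eqᵢ eq′)

    total-++ : ∀ xs ys y → total (xs ++ ys) ∙ y ≡ total xs ∙ (total ys ∙ y)
    total-++ [] ys y = ≡.sym (∙-identityˡ _)
    total-++ (x ∷ xs) ys y = ≡.trans (∙-assoc (e x) _ y)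
      (≡.trans (cong (e x ∙_) (total-++ xs ys y)) (≡.sym (∙-assoc (e x) (total xs) _)))

    lst-points : ∀ S → lst S ≈ sumR (map (λ i → point (e i)) S)
    lst-points [] = refl
    lst-points (x ∷ S) = +-congˡ (lst-points S)

    mean-suc : ∀ S u w → mean S (suc u) w ≤ length S ℕ.* length S ℕ.* mean S u w
    mean-suc S u w = ℕ.≤-trans
      (ℕ.≤-reflexive (τ-cong (trans (*-assoc (nsq (lst S)) (nsq (lst S) ^ u) (nsq w)) (*-congˡ (sym (nsq-^* (lst S) u w))))))
      (subst (λ l → τ (nsq (lst S) * nsq (lst S ^ u * w)) ≤ l ℕ.* l ℕ.* mean S u w) (length-map (λ i → point (e i)) S)
        (triangle (map (λ i → point (e i)) S) (lst-points S) (all-map (λ i → point (e i)) (All.universal (λ i →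
          ℕ.≤-reflexive (τ-cong (trans (*-congʳ (nsq-point (e i))) (trans (*-identityˡ _) (nsq-^* (lst S) u w))))) S))))

    -- Extra factors are bounded trivially by the length; this carries the critical moment to higher
    -- ones.
    mean-+ : ∀ S v u w → mean S (v ℕ.+ u) w ≤ (length S ℕ.* length S) ℕ.^ v ℕ.* mean S u w
    mean-+ S zero u w = ℕ.≤-reflexive (≡.sym (ℕ.*-identityˡ _))
    mean-+ S (suc v) u w = ℕ.≤-trans (mean-suc S (v ℕ.+ u) w) (ℕ.≤-trans (ℕ.*-monoʳ-≤ (length S ℕ.* length S) (mean-+ S v u w))
      (ℕ.≤-reflexive (≡.sym (ℕ.*-assoc (length S ℕ.* length S) _ _))))

    mean-[] : ∀ u w → mean [] (suc u) w ≡ 0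
    mean-[] u w = ≡.trans (τ-cong (trans (*-congʳ (trans (*-congʳ (zeroˡ _)) (zeroˡ _))) (zeroˡ _))) τ-0#

    mean-1# : ∀ S u → mean S u 1# ≡ τ (nsq (lst S ^ u))
    mean-1# S u = τ-cong (trans (*-congˡ nsq-1#) (trans (*-identityʳ _) (sym (nsq-^ (lst S) u))))

    mean-singleton : ∀ x u → mean (x ∷ []) u 1# ≡ 1
    mean-singleton x u = ≡.trans (τ-cong (trans (*-congˡ nsq-1#) (trans (*-identityʳ _) (trans (^-congˡ u
      (trans (nsq-cong (+-identityʳ (point (e x)))) (nsq-point (e x)))) (1#^ u))))) τ-1#

    private
      largest : ∀ (φ : ℕ → ℕ) n → 1 ≤ n → ∃ λ y → y ∈ downFrom n × All (λ z → φ z ≤ φ y) (downFrom n)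
      largest φ (suc n) _ = maximal φ n (downFrom n)

    -- The largest diagonal and off-diagonal terms enter `diagonal-or-off-diagonal`. In the
    -- off-diagonal case `off-diagonal-hölder` produces Q^n, which cancels, and only two classes
    -- remain, with exponents 1 and n + 1.
    narrow-or-broad : ∀ ρ p S w n c → 1 ≤ p → All (λ i → ρ i < p) S →
      c ≡ 4 ℕ.* (p ℕ.* p ℕ.* (suc n ℕ.* suc n ℕ.* (p ℕ.* p))) →
      (∃ λ ζ → mean S (2 ℕ.+ n) w ≤ 4 ℕ.* (p ℕ.* p ℕ.* mean (class ρ ζ S) (2 ℕ.+ n) w)) ⊎
      (∃₂ λ ξ ζ → ξ ≢ ζ × ∃ λ J → J ⊆ S × All (λ i → ρ i ≡ ζ) J ×
        mean S (2 ℕ.+ n) w ≤ c ℕ.^ suc n ℕ.* mixed (lst (class ρ ξ S)) (lst J) w 1 (suc n))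
    narrow-or-broad ρ p S w n c 1≤p bounded c≡ = goal
      where
      Q = mean S (2 ℕ.+ n) w
      F = lst S
      f g : ℕ → Carrier
      f ζ = lst (class ρ ζ S)
      rest : ℕ → List ι
      rest ξ = filter (¬? ∘ (λ i → ρ i ℕ.≟ ξ)) S
      rest⊆ : ∀ ξ → rest ξ ⊆ S
      rest⊆ ξ = filter-⊆ (¬? ∘ (λ i → ρ i ℕ.≟ ξ)) S
      g ξ = lst (rest ξ)
      J : ℕ → ℕ → List ι
      J ξ ζ = class ρ ζ (rest ξ)
      gs : ℕ → List Carrier
      gs ξ = map (λ ζ → lst (J ξ ζ)) (downFrom p)
      off : ℕ → ℕ → ℕ
      off ξ ζ = τ (nsq (f ξ) * nsq (lst (J ξ ζ)) * nsq F ^ n * nsq w)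
      diagonal-max = largest (λ ζ → mean (class ρ ζ S) (2 ℕ.+ n) w) p 1≤p
      ξ₀ = proj₁ diagonal-max
      row-max : ∀ ξ → ∃ λ ζ → ζ ∈ downFrom p × All (λ z → off ξ z ≤ off ξ ζ) (downFrom p)
      row-max ξ = largest (off ξ) p 1≤p
      off-max = largest (λ ξ → off ξ (proj₁ (row-max ξ))) p 1≤p
      ξ₁ = proj₁ off-max
      ζ₁ = proj₁ (row-max ξ₁)
      X = off ξ₁ ζ₁
      K₁ = mixed (f ξ₁) (lst (J ξ₁ ζ₁)) w 1 (suc n)
      length-range : ∀ {A : Set} (h : ℕ → A) n → length (map h (downFrom n)) ≡ n
      length-range h n = ≡.trans (length-map h (downFrom n)) (length-downFrom n)
      dichotomy : Q ≤ 4 ℕ.* (p ℕ.* p ℕ.* mean (class ρ ξ₀ S) (2 ℕ.+ n) w) ⊎ Q ≤ c ℕ.* X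
      dichotomy = Sum.map
        (λ le → ℕ.≤-trans le (ℕ.≤-reflexive (cong (λ l → 4 ℕ.* (l ℕ.* l ℕ.* mean (class ρ ξ₀ S) (2 ℕ.+ n) w)) (length-downFrom p))))
        (λ le → ℕ.≤-trans le (ℕ.≤-reflexive (≡.trans
          (cong (λ l → 4 ℕ.* (l ℕ.* l ℕ.* (suc n ℕ.* suc n ℕ.* (p ℕ.* p ℕ.* X)))) (length-downFrom p))
          (≡.trans (lem p (suc n) X) (cong (ℕ._* X) (≡.sym c≡))))))
        (diagonal-or-off-diagonal (downFrom p) f g gs F w n p
          (partition ρ p S bounded)
          (λ ξ → lst-filter (λ i → ρ i ℕ.≟ ξ) S)
          (λ ξ → partition ρ p (rest ξ) (All-resp-⊆ (rest⊆ ξ) bounded))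
          (λ ξ → length-range (λ ζ → lst (J ξ ζ)) p)
          (proj₂ (proj₂ diagonal-max))
          (All.map (λ {ξ} le → all-map (λ ζ → lst (J ξ ζ)) (All.map (λ le′ → ℕ.≤-trans le′ le) (proj₂ (proj₂ (row-max ξ))))) (proj₂ (proj₂ off-max))))
        where
        lem : ∀ p s X → 4 ℕ.* (p ℕ.* p ℕ.* (s ℕ.* s ℕ.* (p ℕ.* p ℕ.* X))) ≡ 4 ℕ.* (p ℕ.* p ℕ.* (s ℕ.* s ℕ.* (p ℕ.* p))) ℕ.* X
        lem = ℕ-solve-∀
      X^≤ : X ℕ.^ suc n ≤ Q ℕ.^ n ℕ.* K₁
      X^≤ = off-diagonal-hölder w n (sublist-⊑ (class-⊆ ρ ξ₁ S))
      Q≤K₁ : Q ≤ c ℕ.* X → Q ≤ c ℕ.^ suc n ℕ.* K₁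
      Q≤K₁ le = cancel
        where
        open ℕ.≤-Reasoning
        Q^≤ : Q ℕ.^ n ℕ.* Q ≤ Q ℕ.^ n ℕ.* (c ℕ.^ suc n ℕ.* K₁)
        Q^≤ = begin
          Q ℕ.^ n ℕ.* Q ≡⟨ ℕ.*-comm (Q ℕ.^ n) Q ⟩
          Q ℕ.^ suc n ≤⟨ ℕ.^-monoˡ-≤ (suc n) le ⟩
          (c ℕ.* X) ℕ.^ suc n ≡⟨ distrib-^-* c X (suc n) ⟩
          c ℕ.^ suc n ℕ.* X ℕ.^ suc n ≤⟨ ℕ.*-monoʳ-≤ (c ℕ.^ suc n) X^≤ ⟩
          c ℕ.^ suc n ℕ.* (Q ℕ.^ n ℕ.* K₁) ≡⟨ lem (c ℕ.^ suc n) (Q ℕ.^ n) K₁ ⟩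
          Q ℕ.^ n ℕ.* (c ℕ.^ suc n ℕ.* K₁) ∎
          where
          lem : ∀ a b c → a ℕ.* (b ℕ.* c) ≡ b ℕ.* (a ℕ.* c)
          lem = ℕ-solve-∀
        cancel : Q ≤ c ℕ.^ suc n ℕ.* K₁
        cancel = cancel-power Q n _ Q^≤
      -- Nothing of the class ξ₁ is left in `rest ξ₁`, so for equal labels the mixed moment and with
      -- it Q is zero, and the narrow alternative holds trivially.
      J-empty : ξ₁ ≡ ζ₁ → J ξ₁ ζ₁ ≡ []
      J-empty eq = ≡.trans (cong (λ z → class ρ z (rest ξ₁)) (≡.sym eq))
        (filter-none (λ i → ρ i ℕ.≟ ξ₁) (All.all-filter (¬? ∘ (λ i → ρ i ℕ.≟ ξ₁)) S))
      K₁≡0 : ξ₁ ≡ ζ₁ → K₁ ≡ 0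
      K₁≡0 eq = ≡.trans (cong (λ J → mixed (f ξ₁) (lst J) w 1 (suc n)) (J-empty eq))
        (mixed-zeroʳ (f ξ₁) w 1 n)
      Goal : Set
      Goal = (∃ λ ζ → mean S (2 ℕ.+ n) w ≤ 4 ℕ.* (p ℕ.* p ℕ.* mean (class ρ ζ S) (2 ℕ.+ n) w)) ⊎
        (∃₂ λ ξ ζ → ξ ≢ ζ × ∃ λ J → J ⊆ S × All (λ i → ρ i ≡ ζ) J ×
          mean S (2 ℕ.+ n) w ≤ c ℕ.^ suc n ℕ.* mixed (lst (class ρ ξ S)) (lst J) w 1 (suc n))
      off-case : Q ≤ c ℕ.* X → Dec (ξ₁ ≡ ζ₁) → Goal
      off-case le (no ≢) = inj₂ (ξ₁ , ζ₁ , ≢ , J ξ₁ ζ₁ , ⊆-trans (class-⊆ ρ ζ₁ (rest ξ₁)) (rest⊆ ξ₁) ,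
        class-all ρ ζ₁ (rest ξ₁) , Q≤K₁ le)
      off-case le (yes eq) = inj₁ (ξ₀ , ℕ.≤-trans (Q≤K₁ le) (ℕ.≤-trans (ℕ.≤-reflexive
        (≡.trans (cong (c ℕ.^ suc n ℕ.*_) (K₁≡0 eq)) (ℕ.*-zeroʳ (c ℕ.^ suc n)))) z≤n))
      goal : Goal
      goal = Sum.[ (λ le → inj₁ (ξ₀ , le)) , (λ le → off-case le (ξ₁ ℕ.≟ ζ₁)) ]′ dichotomy

-- Residue classes modulo powers of p and congruences forced by coincidences.

module ConfinedSets where

  open import Algebra.Structures using (IsMonoid)
  open import Data.Integer using (ℤ; _+_; _-_; _*_; -_; ∣_∣; 0ℤ; 1ℤ; _%ℕ_; _/ℕ_) renaming (+_ to int; _^_ to _^ℤ_)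
  import Data.Integer as ℤ
  import Data.Integer.DivMod as ℤ
  import Data.Integer.Properties as ℤ
  open import Data.Integer.Divisibility.Signed
  open import Data.Integer.Tactic.RingSolver using (solve-∀)
  open import Data.List using (List; []; _∷_; _++_; length)
  open import Data.List.Properties using (length-++)
  open import Data.List.Membership.Propositional using (_∈_)
  open import Data.List.Relation.Binary.Sublist.Propositional using (_⊆_; lookup)
  open import Data.List.Relation.Unary.All as All using (All; []; _∷_)
  import Data.List.Relation.Unary.All.Properties as All
  open import Data.List.Relation.Unary.Any using (here)
  open import Data.Nat as ℕ using (ℕ; zero; suc; _≤_; _<_; _∸_; _!)
  import Data.Nat.Coprimality as ℕ
  import Data.Nat.Divisibility as ℕ
  import Data.Nat.GCD as ℕ
  import Data.Nat.Primality as ℕ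
  import Data.Nat.Properties as ℕ
  open import Data.Nat.Primality using (Prime)
  open import Data.Product using (∃; _×_; _,_; proj₁; proj₂)
  open import Data.Sum using (inj₁; inj₂)
  open import Relation.Binary.PropositionalEquality
  open import Relation.Nullary using (¬_; yes; no; contradiction)
  open Curves
  open MeanValues
  open TraceSemirings

  congruent-residues : ∀ {r s n} → r < n → s < n → int n ∣ int r - int s → r ≡ s
  congruent-residues {r} {s} {n} r<n s<n d with ∣ int r - int s ∣ in eq | ∣⇒∣ᵤ d
  ... | zero | _ = ℤ.+-injective (ℤ.i-j≡0⇒i≡j (int r) (int s) (ℤ.∣i∣≡0⇒i≡0 eq))
  ... | suc t | n∣ = contradiction (ℕ.∣⇒≤ n∣) (ℕ.<⇒≱ (ℕ.≤-<-trans
    (subst (_≤ r ℕ.⊔ s) eq (subst (λ z → ∣ z ∣ ≤ r ℕ.⊔ s) (sym (ℤ.m-n≡m⊖n r s)) (ℤ.∣m⊝n∣≤m⊔n r s)))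
    (ℕ.⊔-pres-<m r<n s<n)))

  -- k (k + 1) / 2, half of the critical order.
  tri : ℕ → ℕ
  tri zero = 0
  tri (suc k) = suc k ℕ.+ tri k

  pos-^ : ∀ p n → int (p ℕ.^ n) ≡ int p ^ℤ n
  pos-^ p zero = refl
  pos-^ p (suc n) = trans (ℤ.pos-* p (p ℕ.^ n)) (cong (int p *_) (pos-^ p n))

  module PrimeModulus (p : ℕ) (p-prime : Prime p) where

    P : ℤ
    P = int p

    instance
      p≢0 : ℕ.NonZero p
      p≢0 = ℕ.prime⇒nonZero p-prime

      P≢0 : ℤ.NonZero P
      P≢0 = p≢0

    p^≢0 : ∀ n → ℕ.NonZero (p ℕ.^ n)
    p^≢0 n = ℕ.m^n≢0 p n

    open Reduction P public

    coprime⇒unit : ∀ {n} → ¬ p ℕ.∣ n → Unit (int n)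
    coprime⇒unit {n} p∤n with ℕ.coprime-Bézout (ℕ.sym (coprime p∤n))
      where
      coprime : ∀ {n} → ¬ p ℕ.∣ n → ℕ.Coprime p n
      coprime p∤n {d} (d∣p , d∣n) with ℕ.prime⇒irreducible p-prime d∣p
      ... | inj₁ refl = refl
      ... | inj₂ refl = contradiction d∣n p∤n
    ... | ℕ.Bézout.+- x y eq = unit (int x) (int y) (trans (sym (ℤ.pos-* n x)) (trans (cong int (trans (ℕ.*-comm n x) (sym eq)))
      (trans (ℤ.pos-+ 1 (y ℕ.* p)) (cong (1ℤ +_) (trans (ℤ.pos-* y p) (ℤ.*-comm (int y) P))))))
    ... | ℕ.Bézout.-+ x y eq = unit (- int x) (- int y) (begin
      int n * - int x               ≡⟨ lem (int n) (int x) ⟩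
      1ℤ - (1ℤ + int x * int n)     ≡⟨ cong (λ z → 1ℤ - (1ℤ + z)) (ℤ.pos-* x n) ⟨
      1ℤ - int (1 ℕ.+ x ℕ.* n)      ≡⟨ cong (λ z → 1ℤ - int z) eq ⟩
      1ℤ - int (y ℕ.* p)            ≡⟨ cong (λ z → 1ℤ - z) (ℤ.pos-* y p) ⟩
      1ℤ - int y * P                ≡⟨ lem′ (int y) P ⟩
      1ℤ + P * - int y              ∎)
      where
      open ≡-Reasoning
      lem : ∀ n x → n * - x ≡ 1ℤ - (1ℤ + x * n)
      lem = solve-∀
      lem′ : ∀ y p → 1ℤ - y * p ≡ 1ℤ + p * - y
      lem′ = solve-∀

    nondivisible⇒unit : ∀ {u} → ¬ P ∣ u → Unit u
    nondivisible⇒unit {int n} P∤u = coprime⇒unit (λ d → P∤u (∣ᵤ⇒∣ d))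
    nondivisible⇒unit {ℤ.-[1+ n ]} P∤u with coprime⇒unit {suc n} (λ d → P∤u (∣ᵤ⇒∣ d))
    ... | unit a s eq = unit (- a) s (trans (lem (int (suc n)) a) eq)
      where
      lem : ∀ u a → - u * - a ≡ u * a
      lem = solve-∀

    !-unit : ∀ k → k < p → Unit (int (k !))
    !-unit zero _ = unit-1
    !-unit (suc k) k<p = subst Unit (sym (ℤ.pos-* (suc k) (k !)))
      (unit-* (coprime⇒unit (λ d → contradiction (ℕ.∣⇒≤ {suc k} {p} d) (ℕ.<⇒≱ k<p))) (!-unit k (ℕ.≤-trans (ℕ.n≤1+n _) k<p)))

    -- Exact division made total with the value 0, so that `coordinate` is defined on all of ι.
    quot : ℤ → ℤ → ℤ
    quot m x with m ∣? x
    ... | yes d = _∣_.quotient d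
    ... | no _ = 0ℤ

    quot-eq : ∀ m {x} → m ∣ x → x ≡ m * quot m x
    quot-eq m {x} m∣x with m ∣? x
    ... | yes (divides q eq) = trans eq (ℤ.*-comm q m)
    ... | no m∤x = contradiction m∣x m∤x

  module Confinement {G : Set} {_∙_ : G → G → G} {ε : G} (isMonoid : IsMonoid _≡_ _∙_ ε)
    (T : GroupTrace _∙_ ε) {ι : Set} (e : ι → G) (p : ℕ) (p-prime : Prime p) where

    open PrimeModulus p p-prime public
    open Means isMonoid T e public using (Carrier; _∋_; ∋-*; ∋-power; lst; total; total-++; Tuple)
    private module M = Means isMonoid T e

    sumℤ : (ι → ℤ) → List ι → ℤ
    sumℤ f [] = 0ℤ
    sumℤ f (x ∷ xs) = f x + sumℤ f xs

    private
      sumℤ-cong : ∀ {S f g} xs → All (_∈ S) xs → (∀ {i} → i ∈ S → f i ≡ g i) → sumℤ f xs ≡ sumℤ g xs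
      sumℤ-cong [] [] eq = refl
      sumℤ-cong (x ∷ xs) (x∈ ∷ xs∈) eq = cong₂ _+_ (eq x∈) (sumℤ-cong xs xs∈ eq)

      sumℤ-+ : ∀ f g xs → sumℤ (λ i → f i + g i) xs ≡ sumℤ f xs + sumℤ g xs
      sumℤ-+ f g [] = refl
      sumℤ-+ f g (x ∷ xs) = trans (cong (f x + g x +_) (sumℤ-+ f g xs)) (lem (f x) (g x) (sumℤ f xs) (sumℤ g xs))
        where
        lem : ∀ a b c d → a + b + (c + d) ≡ a + c + (b + d)
        lem = solve-∀

      sumℤ-scale : ∀ c f xs → sumℤ (λ i → c * f i) xs ≡ c * sumℤ f xs
      sumℤ-scale c f [] = sym (ℤ.*-zeroʳ c)
      sumℤ-scale c f (x ∷ xs) = trans (cong (c * f x +_) (sumℤ-scale c f xs)) (sym (ℤ.*-distribˡ-+ c (f x) (sumℤ f xs)))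

      sumℤ-const : ∀ c xs → sumℤ (λ _ → c) xs ≡ int (length xs) * c
      sumℤ-const c [] = refl
      sumℤ-const c (x ∷ xs) = trans (cong (c +_) (sumℤ-const c xs)) (lem c (int (length xs)))
        where
        lem : ∀ c n → c + n * c ≡ (1ℤ + n) * c
        lem = solve-∀

      sumℤ-++ : ∀ f xs ys → sumℤ f (xs ++ ys) ≡ sumℤ f xs + sumℤ f ys
      sumℤ-++ f [] ys = sym (ℤ.+-identityˡ _)
      sumℤ-++ f (x ∷ xs) ys = trans (cong (f x +_) (sumℤ-++ f xs ys)) (sym (ℤ.+-assoc (f x) (sumℤ f xs) (sumℤ f ys)))

    difference : ∀ (pos : ι → ℤ) {n S S′ xs ys} → Tuple n S xs → Tuple n S′ ys → Functional
    difference pos {n} {xs = xs} {ys} (len , _) (len′ , _) = record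
      { ap = λ f → sumℤ (λ i → f (pos i)) xs - sumℤ (λ i → f (pos i)) ys
      ; ap-cong = λ eq → cong₂ _-_ (pointwise eq xs) (pointwise eq ys)
      ; ap-+ = λ f g → trans (cong₂ _-_ (sumℤ-+ _ _ xs) (sumℤ-+ _ _ ys))
          (lem (sumℤ (λ i → f (pos i)) xs) (sumℤ (λ i → g (pos i)) xs) (sumℤ (λ i → f (pos i)) ys) (sumℤ (λ i → g (pos i)) ys))
      ; ap-scale = λ c f → trans (cong₂ _-_ (sumℤ-scale c _ xs) (sumℤ-scale c _ ys))
          (lem′ c (sumℤ (λ i → f (pos i)) xs) (sumℤ (λ i → f (pos i)) ys))
      ; ap-const = λ c → trans (cong₂ _-_ (sumℤ-const c xs) (sumℤ-const c ys))
          (trans (cong₂ (λ u v → int u * c - int v * c) len len′) (ℤ.+-inverseʳ (int n * c)))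
      }
      where
      pointwise : ∀ {f g : ℤ → ℤ} → (∀ z → f z ≡ g z) → ∀ xs → sumℤ (λ i → f (pos i)) xs ≡ sumℤ (λ i → g (pos i)) xs
      pointwise eq [] = refl
      pointwise eq (x ∷ xs) = cong₂ _+_ (eq (pos x)) (pointwise eq xs)
      lem : ∀ a b c d → a + b - (c + d) ≡ (a - c) + (b - d)
      lem = solve-∀
      lem′ : ∀ c a b → c * a - c * b ≡ c * (a - b)
      lem′ = solve-∀

    -- The moment of order 2 `tri k` with weight `L` counts exactly such coincidences. The modulus
    -- P^(k N) is the precision at which the k-th coordinate is seen at scale p ^ -N.
    record Confined (k N : ℕ) (pos : ι → ℤ) (q : ℕ → Poly) (S : List ι) (L : Carrier) : Set where
     constructor confined
     field
      confines : ∀ {xs ys y y′} (tx : Tuple (tri k) S xs) (ty : Tuple (tri k) S ys) → L ∋ y → L ∋ y′ →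
       total xs ∙ y ≡ total ys ∙ y′ → ∀ i → 1 ≤ i → i ≤ k → P ^ℤ (k ℕ.* N) ∣ ap (difference pos tx ty) (curve q i)
    open Confined public

    Located : (ι → ℤ) → ℕ → ℤ → List ι → Set
    Located pos N ζ S = ∀ {i} → i ∈ S → P ^ℤ N ∣ pos i - ζ

    coordinate : (ι → ℤ) → ℕ → ℤ → ι → ℤ
    coordinate pos a ξ i = quot (P ^ℤ a) (pos i - ξ)

    coordinate-eq : ∀ pos a ξ {S i} → Located pos a ξ S → i ∈ S → pos i ≡ ξ + P ^ℤ a * coordinate pos a ξ i
    coordinate-eq pos a ξ {i = i} loc i∈ = trans (lem (pos i) ξ) (cong (ξ +_) (quot-eq (P ^ℤ a) (loc i∈)))
      where
      lem : ∀ x ξ → x ≡ ξ + (x - ξ)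
      lem = solve-∀

    located-nested : ∀ pos a ξ {S S₀ N ζ} → Located pos a ξ S → S₀ ⊆ S → a ≤ N →
      Located (coordinate pos a ξ) (N ∸ a) ζ S₀ → Located pos N (ξ + P ^ℤ a * ζ) S₀
    located-nested pos a ξ {N = N} {ζ} loc sub a≤N loc₀ {i} i∈ = subst₂ _∣_
      (trans (sym (ℤ.^-distribˡ-+-* P a (N ∸ a))) (cong (P ^ℤ_) (ℕ.m+[n∸m]≡n a≤N)))
      (trans (lem ξ (P ^ℤ a) (coordinate pos a ξ i) ζ) (cong (_- (ξ + P ^ℤ a * ζ)) (sym (coordinate-eq pos a ξ loc (lookup sub i∈)))))
      (*-monoʳ-∣ (P ^ℤ a) (loc₀ i∈))
      where
      lem : ∀ ξ m x ζ → m * (x - ζ) ≡ ξ + m * x - (ξ + m * ζ)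
      lem = solve-∀

    private
      difference-coordinate : ∀ pos a ξ {n S S₁ xs ys} (f : ℤ → ℤ) → Located pos a ξ S₁ → S₁ ⊆ S →
        (tx : Tuple n S xs) (ty : Tuple n S ys) (tx₁ : Tuple n S₁ xs) (ty₁ : Tuple n S₁ ys) →
        ap (difference pos tx ty) f ≡ ap (difference (coordinate pos a ξ) tx₁ ty₁) (λ z → f (ξ + P ^ℤ a * z))
      difference-coordinate pos a ξ {xs = xs} {ys} f loc sub _ _ (_ , xs∈) (_ , ys∈) = cong₂ _-_
        (sumℤ-cong xs xs∈ (λ i∈ → cong f (coordinate-eq pos a ξ loc i∈))) (sumℤ-cong ys ys∈ (λ i∈ → cong f (coordinate-eq pos a ξ loc i∈)))

    tuple-mono : ∀ {n S S₁ xs} → S₁ ⊆ S → Tuple n S₁ xs → Tuple n S xs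
    tuple-mono sub (len , all) = len , All.map (lookup sub) all

    tuple-++ : ∀ {m n S xs ys} → Tuple m S xs → Tuple n S ys → Tuple (m ℕ.+ n) S (xs ++ ys)
    tuple-++ {xs = xs} (len , all) (len′ , all′) = trans (length-++ xs) (cong₂ ℕ._+_ len len′) , All.++⁺ all all′

    private
      -- The i-th coordinate loses a i ≤ a k of its k N digits, so k (N - a) survive.
      shrink : ∀ k i {a N} → i ≤ k → a ≤ N → k ℕ.* (N ∸ a) ℕ.+ a ℕ.* i ≤ k ℕ.* N
      shrink k i {a} {N} i≤k a≤N = ℕ.≤-trans (ℕ.+-monoʳ-≤ (k ℕ.* (N ∸ a)) (ℕ.*-monoʳ-≤ a i≤k))
        (ℕ.≤-reflexive (trans (cong (k ℕ.* (N ∸ a) ℕ.+_) (ℕ.*-comm a k))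
          (trans (sym (ℕ.*-distribˡ-+ k (N ∸ a) a)) (cong (k ℕ.*_) (ℕ.m∸n+n≡m a≤N)))))

    confined-rescale : ∀ {k N pos q S L S₁ a ξ} → Confined k N pos q S L → S₁ ⊆ S → Located pos a ξ S₁ →
      1 ≤ a → a ≤ N → ∃ λ ψ → Confined k (N ∸ a) (coordinate pos a ξ) ψ S₁ L
    confined-rescale {k} {N} {pos} {q} {S} {L} {S₁} {a} {ξ} conf sub loc 1≤a a≤N = proj₁ C , confined
      λ tx ty y∈ y′∈ eq i lo hi → proj₂ C (difference (coordinate pos a ξ) tx ty)
        (λ j lo′ hi′ → subst (P ^ℤ (k ℕ.* N) ∣_)
          (difference-coordinate pos a ξ (curve q j) loc sub (tuple-mono sub tx) (tuple-mono sub ty) tx ty)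
          (confines conf (tuple-mono sub tx) (tuple-mono sub ty) y∈ y′∈ eq j lo′ hi′))
        i lo hi (k ℕ.* (N ∸ a)) (shrink k i hi a≤N)
      where
      C = curve-rescale q k ξ a (k ℕ.* N) 1≤a

    -- A frequency of the new weight is the total of a v-tuple from `S₂` combined with a frequency
    -- of `L`. A coincidence for the new weight is thus one of longer tuples for the old weight, and
    -- `curve-project` removes the part from `S₂`.
    confined-project : ∀ {m r v N pos q S L S₁ S₂ a b c ξ η} → m ℕ.+ r < p → tri r ℕ.+ v ≡ tri (m ℕ.+ r) →
      Confined (m ℕ.+ r) N pos q S L → S₁ ⊆ S → S₂ ⊆ S → Located pos a ξ S₁ → Located pos b η S₂ →
      1 ≤ a → 1 ≤ r → a ≤ c → b ≤ N → r ℕ.* c ≤ suc m ℕ.* b → Unit (ξ - η) →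
      ∃ λ ψ → Confined r (c ∸ a) (coordinate pos a ξ) ψ S₁ (lst S₂ M.^ v M.* L)
    confined-project {m} {r} {v} {N} {pos} {q} {S} {L} {S₁} {S₂} {a} {b} {c} {ξ} {η}
      k<p tri≡ conf sub₁ sub₂ loc₁ loc₂ 1≤a 1≤r a≤c b≤N rc≤ ξ-η-unit = proj₁ C , confined spec
      where
      k = m ℕ.+ r
      -- The common denominator Λ is k!, which every j ≤ k divides and which is a unit modulo p
      -- because k < p.
      Λ/ : ℕ → ℤ
      Λ/ j = quot (int j) (int (k !))
      Λ/-eq : ∀ j → 1 ≤ j → j ≤ k → int j * Λ/ j ≡ int (k !)
      Λ/-eq j@(suc _) _ j≤k = sym (quot-eq (int j) (∣ᵤ⇒∣ (ℕ.∣-trans (ℕ.m∣m*n ((ℕ.pred j) !)) (ℕ.m≤n⇒m!∣n! j≤k))))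
      C = curve-project k (int (k !)) Λ/ (!-unit k k<p) Λ/-eq q m r ξ η a b (k ℕ.* N) 1≤a 1≤r ℕ.≤-refl
        (ℕ.*-mono-≤ (subst (_≤ k) (ℕ.+-comm m 1) (ℕ.+-monoʳ-≤ m 1≤r)) b≤N) ξ-η-unit
      spec : ∀ {xs ys y y′} (tx : Tuple (tri r) S₁ xs) (ty : Tuple (tri r) S₁ ys) → lst S₂ M.^ v M.* L ∋ y → lst S₂ M.^ v M.* L ∋ y′ →
        total xs ∙ y ≡ total ys ∙ y′ → ∀ i → 1 ≤ i → i ≤ r →
        P ^ℤ (r ℕ.* (c ∸ a)) ∣ ap (difference (coordinate pos a ξ) tx ty) (curve (proj₁ C) i)
      spec {xs} {ys} {y} {y′} tx ty y∈ y′∈ eq i lo hi =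
        let t , y₀ , t∈ , y₀∈ , y≡ = ∋-* (lst S₂ M.^ v) L y∈
            t′ , y₀′ , t′∈ , y₀′∈ , y′≡ = ∋-* (lst S₂ M.^ v) L y′∈
            ws , tw , t≡ = ∋-power S₂ v t∈
            ws′ , tw′ , t′≡ = ∋-power S₂ v t′∈
        in proj₂ C (difference (coordinate pos a ξ) tx ty) (difference (coordinate pos b η) tw tw′)
          (λ j lo′ hi′ → subst (P ^ℤ (k ℕ.* N) ∣_) (split-difference tw tw′ j)
            (confines conf (join tx tw) (join ty tw′) y₀∈ y₀′∈
              (trans (total-++ xs ws y₀) (trans (cong (total xs ∙_) (sym (trans y≡ (cong (_∙ y₀) t≡))))
                (trans eq (trans (cong (total ys ∙_) (trans y′≡ (cong (_∙ y₀′) t′≡))) (sym (total-++ ys ws′ y₀′))))))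
              j lo′ hi′))
          i lo hi (r ℕ.* (c ∸ a)) (ℕ.≤-trans (shrink r i hi a≤c) rc≤)
        where
        join : ∀ {xs ws} → Tuple (tri r) S₁ xs → Tuple v S₂ ws → Tuple (tri k) S (xs ++ ws)
        join {xs} {ws} tx tw = subst (λ n → Tuple n S (xs ++ ws)) tri≡ (tuple-++ (tuple-mono sub₁ tx) (tuple-mono sub₂ tw))
        split-difference : ∀ {ws ws′} (tw : Tuple v S₂ ws) (tw′ : Tuple v S₂ ws′) j →
          ap (difference pos (join tx tw) (join ty tw′)) (curve q j) ≡
          ap (difference (coordinate pos a ξ) tx ty) (λ z → curve q j (ξ + P ^ℤ a * z)) +
          ap (difference (coordinate pos b η) tw tw′) (λ z → curve q j (η + P ^ℤ b * z))
        split-difference {ws} {ws′} tw tw′ j = trans (cong₂ _-_ (sumℤ-++ f xs ws) (sumℤ-++ f ys ws′))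
          (trans (lem (sumℤ f xs) (sumℤ f ws) (sumℤ f ys) (sumℤ f ws′))
          (cong₂ _+_ (difference-coordinate pos a ξ (curve q j) loc₁ sub₁ (tuple-mono sub₁ tx) (tuple-mono sub₁ ty) tx ty)
            (difference-coordinate pos b η (curve q j) loc₂ sub₂ (tuple-mono sub₂ tw) (tuple-mono sub₂ tw′) tw tw′)))
          where
          f = λ i → curve q j (pos i)
          lem : ∀ a b c d → a + b - (c + d) ≡ (a - c) + (b - d)
          lem = solve-∀

    residue : (ι → ℤ) → ℕ → ι → ℕ
    residue pos N i = (pos i %ℕ (p ℕ.^ N)) {{p^≢0 N}}

    residue< : ∀ pos N i → residue pos N i < p ℕ.^ N
    residue< pos N i = ℤ.n%ℕd<d (pos i) (p ℕ.^ N) {{p^≢0 N}}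

    residue-located : ∀ pos N {ζ S} → All (λ i → residue pos N i ≡ ζ) S → Located pos N (int ζ) S
    residue-located pos N {ζ} all {i} i∈ = divides w (begin
      pos i - int ζ
        ≡⟨ cong₂ (λ u v → u - int v) (ℤ.a≡a%ℕn+[a/ℕn]*n (pos i) (p ℕ.^ N) {{p^≢0 N}}) (sym (All.lookup all i∈)) ⟩
      int (residue pos N i) + w * int (p ℕ.^ N) - int (residue pos N i)
        ≡⟨ lem (int (residue pos N i)) (w * int (p ℕ.^ N)) ⟩
      w * int (p ℕ.^ N)
        ≡⟨ cong (w *_) (pos-^ p N) ⟩
      w * P ^ℤ N ∎)
      where
      open ≡-Reasoning
      w = (pos i /ℕ (p ℕ.^ N)) {{p^≢0 N}}
      lem : ∀ a b → a + b - a ≡ b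
      lem = solve-∀

    -- In degree one the tuples are single elements, and by `curve-injective` the only coordinate
    -- determines the residue.
    confined-orthogonal : ∀ {N pos q S L} → Confined 1 N pos q S L → ∀ x x′ y y′ → x ∈ S → x′ ∈ S → L ∋ y → L ∋ y′ →
      e x ∙ y ≡ e x′ ∙ y′ → residue pos N x ≡ residue pos N x′
    confined-orthogonal {N} {pos} {q} conf x x′ y y′ x∈ x′∈ y∈ y′∈ eq = congruent-residues (residue< pos N x) (residue< pos N x′)
      (subst (_∣ int (residue pos N x) - int (residue pos N x′)) (sym (pos-^ p N))
        (subst (P ^ℤ N ∣_) (lem (pos x) (pos x′) (int (residue pos N x)) (int (residue pos N x′)))
          (∣m∣n⇒∣m-n (∣m∣n⇒∣m+n congruent (residue-located pos N {S = x′ ∷ []} (refl ∷ []) (here refl)))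
            (residue-located pos N {S = x ∷ []} (refl ∷ []) (here refl)))))
      where
      tuple : ∀ {x S} → x ∈ S → Tuple 1 S (x ∷ [])
      tuple x∈ = refl , x∈ ∷ []
      single : ∀ x y → total (x ∷ []) ∙ y ≡ e x ∙ y
      single x y = cong (_∙ y) (IsMonoid.identityʳ isMonoid (e x))
      congruent : P ^ℤ N ∣ pos x - pos x′
      congruent = curve-injective q N (pos x) (pos x′) (subst₂ _∣_ (cong (P ^ℤ_) (ℕ.*-identityˡ N))
        (cong₂ _-_ (ℤ.+-identityʳ (curve q 1 (pos x))) (ℤ.+-identityʳ (curve q 1 (pos x′))))
        (confines conf (tuple x∈) (tuple x′∈) y∈ y′∈ (trans (single x y) (trans eq (sym (single x′ y′)))) 1 ℕ.≤-refl ℕ.≤-refl))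
      lem : ∀ a b r s → (a - b) + (b - s) - (a - r) ≡ r - s
      lem = solve-∀

-- Exchanging two separated classes and accumulating the gain.

module DecouplingIteration where

  open import Algebra.Structures using (IsMonoid)
  open import Data.Integer using (ℤ) renaming (+_ to int; _^_ to _^ℤ_; _-_ to _-ℤ_; _+_ to _+ℤ_; _*_ to _*ℤ_)
  import Data.Integer.Properties as ℤ
  import Data.Integer as ℤ using (0ℤ)
  open import Data.Integer.Divisibility.Signed using (_∣_; divides; ∣m∣n⇒∣m-n; ∣m⇒∣m*n; ∣-trans; ∣-refl)
  import Data.Integer.Tactic.RingSolver as ℤS
  open import Data.List using (List)
  open import Data.List.Relation.Binary.Sublist.Propositional using (_⊆_; ⊆-trans)
  open import Data.List.Relation.Unary.All as All using (All)
  open import Data.Nat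
  import Data.Nat.Divisibility as ℕ
  open import Data.Nat.Primality using (Prime)
  open import Data.Nat.Properties
  open import Data.Nat.Tactic.RingSolver using (solve-∀)
  open import Data.Product using (∃; ∃₂; _×_; _,_; proj₁; proj₂)
  open import Relation.Binary.PropositionalEquality
  open import Relation.Nullary using (¬_)
  open ConfinedSets
  open Curves using (Poly)
  open MeanValues
  open PowerInequalities
  open TraceSemirings

  tri-+ : ∀ r m → tri (r + m) ≡ tri r + (r * m + tri m)
  tri-+ zero m = refl
  tri-+ (suc r) m = trans (cong (suc (r + m) +_) (tri-+ r m)) (lem r m (tri r) (tri m))
    where
    lem : ∀ r m a b → suc (r + m) + (a + (r * m + b)) ≡ suc r + a + (m + r * m + b)
    lem = solve-∀

  !-multiple : ∀ r k → suc r ≤ k → ∃ λ t → k ! ≡ t * suc r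
  !-multiple r k r<k = ℕ.quotient d , ℕ._∣_.equality d
    where
    d : suc r ℕ.∣ k !
    d = ℕ.∣-trans (ℕ.m∣m*n {suc r} (r !)) (ℕ.m≤n⇒m!∣n! r<k)

  module Decoupling {G : Set} {_∙_ : G → G → G} {ε : G} (isMonoid : IsMonoid _≡_ _∙_ ε)
    (T : GroupTrace _∙_ ε) {ι : Set} (e : ι → G) (p : ℕ) (p-prime : Prime p) where

    open Confinement isMonoid T e p p-prime
    private module M = Means isMonoid T e
    open M using (mean; mixed; class; class-⊆; class-all)

    -- The ℓ^∞ decoupling inequality for the moment 2 tri k at scale p ^ −N, with
    -- the loss p ^ (m / q) per scale; raising to the power q clears the root.
    Decouples : ℕ → ℕ → ℕ → ℕ → Set
    Decouples k q m C = ∀ {N pos φ S L} D B → Confined k N pos φ S L →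
      (∀ {S₀ ζ} → S₀ ⊆ S → Located pos N ζ S₀ → D * mean S₀ (tri k) L ^ q ≤ B) →
      D * mean S (tri k) L ^ q ≤ C * p ^ ((tri k * q + m) * N) * B

    decouples-weaken : ∀ {k q m C C′} → C ≤ C′ → Decouples k q m C → Decouples k q m C′
    decouples-weaken C≤ dec {N} D B conf hyp = ≤-trans (dec D B conf hyp) (*-monoˡ-≤ B (*-monoˡ-≤ _ C≤))

    p>0 : 1 ≤ p
    p>0 = >-nonZero⁻¹ p

    p^-mono : ∀ {m n} → m ≤ n → p ^ m ≤ p ^ n
    p^-mono = ^-monoʳ-≤ p

    -- Orthogonality of the classes loses only p ^ N, so there is no excess and every `m` is
    -- admissible.
    decouples-1 : ∀ q m → Decouples 1 q m 1
    decouples-1 q m {N} {pos} {φ} {S} {L} D B conf hyp =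
      let S₀ , ζ , S₀⊆ , all , bound = M.orthogonal-classes (residue pos N) (p ^ N) S L
            (All.tabulate (λ {i} _ → residue< pos N i)) (confined-orthogonal conf)
      in begin
        D * mean S 1 L ^ q                       ≤⟨ *-monoʳ-≤ D (^-monoˡ-≤ q bound) ⟩
        D * (p ^ N * mean S₀ 1 L) ^ q            ≡⟨ cong (D *_) (distrib-^-* (p ^ N) (mean S₀ 1 L) q) ⟩
        D * ((p ^ N) ^ q * mean S₀ 1 L ^ q)      ≡⟨ lem D ((p ^ N) ^ q) (mean S₀ 1 L ^ q) ⟩
        (p ^ N) ^ q * (D * mean S₀ 1 L ^ q)      ≤⟨ *-mono-≤ scale (hyp S₀⊆ (residue-located pos N all)) ⟩
        1 * p ^ ((1 * q + m) * N) * B            ∎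
      where
      open ≤-Reasoning
      lem : ∀ a b c → a * (b * c) ≡ b * (a * c)
      lem = solve-∀
      scale : (p ^ N) ^ q ≤ 1 * p ^ ((1 * q + m) * N)
      scale = ≤-trans (≤-reflexive (^-*-assoc p N q)) (≤-trans
        (p^-mono (≤-trans (≤-reflexive (*-comm N q)) (*-monoˡ-≤ N (≤-trans (≤-reflexive (sym (*-identityˡ q))) (m≤m+n (1 * q) m)))))
        (≤-reflexive (sym (*-identityˡ _))))

    largest-piece : ∀ pos N S w v → ∃₂ λ S₀ ζ → S₀ ⊆ S × Located pos N ζ S₀ × mean S (suc v) w ≤ p ^ (2 * N * suc v) * mean S₀ (suc v) w
    largest-piece pos N S w v =
      let ζ , bound = M.largest-class (residue pos N) (p ^ N) S w v (m^n>0 p N) (All.tabulate (λ {i} _ → residue< pos N i))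
      in class (residue pos N) ζ S , int ζ , class-⊆ _ ζ S , residue-located pos N (class-all _ ζ S) ,
         ≤-trans bound (≤-reflexive (cong (_* mean (class (residue pos N) ζ S) (suc v) w)
           (trans (cong (_^ suc v) (trans (sym (^-distribˡ-+-* p N N)) (cong (p ^_) (cong (N +_) (sym (+-identityʳ N)))))) (^-*-assoc p (2 * N) (suc v)))))

    -- The triangle inequality, which amounts to m = `tri k * q`; the descent in m starts here.
    decouples-trivial : ∀ k q N pos {S L} D B → 1 ≤ k →
      (∀ {S₀ ζ} → S₀ ⊆ S → Located pos N ζ S₀ → D * mean S₀ (tri k) L ^ q ≤ B) →
      D * mean S (tri k) L ^ q ≤ p ^ (2 * N * tri k * q) * B
    decouples-trivial k@(suc k′) q N pos {S} {L} D B _ hyp =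
      let S₀ , ζ , S₀⊆ , loc , bound = largest-piece pos N S L (k′ + tri k′)
      in begin
        D * mean S (tri k) L ^ q                            ≤⟨ *-monoʳ-≤ D (^-monoˡ-≤ q bound) ⟩
        D * (p ^ (2 * N * tri k) * mean S₀ (tri k) L) ^ q   ≡⟨ cong (D *_) (distrib-^-* (p ^ (2 * N * tri k)) _ q) ⟩
        D * ((p ^ (2 * N * tri k)) ^ q * mean S₀ (tri k) L ^ q)
          ≡⟨ lem D ((p ^ (2 * N * tri k)) ^ q) (mean S₀ (tri k) L ^ q) ⟩
        (p ^ (2 * N * tri k)) ^ q * (D * mean S₀ (tri k) L ^ q)
          ≤⟨ *-mono-≤ (≤-reflexive (^-*-assoc p (2 * N * tri k) q)) (hyp S₀⊆ loc) ⟩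
        p ^ (2 * N * tri k * q) * B ∎
      where
      open ≤-Reasoning
      lem : ∀ a b c → a * (b * c) ≡ b * (a * c)
      lem = solve-∀

    decouples-located : ∀ k q m C {N pos φ S L S₁ a ξ} D B → Decouples k q m C → Confined k N pos φ S L →
      (∀ {S₀ ζ} → S₀ ⊆ S → Located pos N ζ S₀ → D * mean S₀ (tri k) L ^ q ≤ B) →
      S₁ ⊆ S → Located pos a ξ S₁ → 1 ≤ a → a ≤ N →
      D * mean S₁ (tri k) L ^ q ≤ C * p ^ ((tri k * q + m) * (N ∸ a)) * B
    decouples-located k q m C {pos = pos} {a = a} {ξ} D B dec conf hyp sub loc 1≤a a≤N =
      dec D B (proj₂ (confined-rescale conf sub loc 1≤a a≤N))
        (λ S₀⊆ loc₀ → hyp (⊆-trans S₀⊆ sub) (located-nested pos a ξ loc S₀⊆ a≤N loc₀))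

    -- A set at scale p ^ -a has only N - a scales to go. Multiplication by the power for the first
    -- a scales gives the same right side for all a, as `interpolated` requires.
    located-multiplied : ∀ k q m C {N pos φ S L S₁ a ξ} D B → Decouples k q m C → Confined k N pos φ S L →
      (∀ {S₀ ζ} → S₀ ⊆ S → Located pos N ζ S₀ → D * mean S₀ (tri k) L ^ q ≤ B) →
      S₁ ⊆ S → Located pos a ξ S₁ → 1 ≤ a → a ≤ N →
      D * (p ^ ((tri k * q + m) * a) * mean S₁ (tri k) L ^ q) ≤ C * p ^ ((tri k * q + m) * N) * B
    located-multiplied k q m C {N} {L = L} {S₁} {a} D B dec conf hyp sub loc 1≤a a≤N = begin
      D * (p ^ (E * a) * mean S₁ (tri k) L ^ q)       ≡⟨ lem D (p ^ (E * a)) (mean S₁ (tri k) L ^ q) ⟩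
      p ^ (E * a) * (D * mean S₁ (tri k) L ^ q)       ≤⟨ *-monoʳ-≤ (p ^ (E * a)) (decouples-located k q m C D B dec conf hyp sub loc 1≤a a≤N) ⟩
      p ^ (E * a) * (C * p ^ (E * (N ∸ a)) * B)       ≡⟨ lem′ (p ^ (E * a)) C (p ^ (E * (N ∸ a))) B ⟩
      C * (p ^ (E * a) * p ^ (E * (N ∸ a))) * B       ≡⟨ cong (λ z → C * z * B) (sym (^-distribˡ-+-* p (E * a) (E * (N ∸ a)))) ⟩
      C * p ^ (E * a + E * (N ∸ a)) * B               ≡⟨ cong (λ z → C * p ^ z * B) (trans (sym (*-distribˡ-+ E a (N ∸ a))) (cong (E *_) (m+[n∸m]≡n a≤N))) ⟩
      C * p ^ (E * N) * B                             ∎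
      where
      open ≤-Reasoning
      E = tri k * q + m
      lem : ∀ a b c → a * (b * c) ≡ b * (a * c)
      lem = solve-∀
      lem′ : ∀ a c b d → a * (c * b * d) ≡ c * (a * b) * d
      lem′ = solve-∀

    raise-power : ∀ D K {α α′ X} → α ≤ α′ → D * (p ^ α′ * K) ≤ X → D * (p ^ α * K) ≤ X
    raise-power D K le bound = ≤-trans (*-monoʳ-≤ D (*-monoˡ-≤ K (p^-mono le))) bound

    -- For S₁ at scale p ^ −a and S₂ at scale p ^ −b, separated modulo p, the mixed
    -- moment of exponents tri r and tri k − tri r gains over the trivial bound:
    -- after n rounds by p ^ (m n r (k − r) b / k² q), up to p ^ (n k N / q).
    module Iteration (k q m C₀ C₁ : ℕ) (k<p : k < p) (1≤C₁ : 1 ≤ C₁) (dec : Decouples k q m C₀)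
      (lower : ∀ r → 1 ≤ r → r < k → Decouples r q 1 C₁) where

      s f : ℕ
      s = tri k
      f = k !

      -- The constant after r steps inside a round: `C₀` for the start at r = 0, `c` for the
      -- previous round, and a factor `C₁` for every decoupling of lower degree.
      Γ : ℕ → ℕ → ℕ
      Γ c zero = C₀ + c
      Γ c (suc r) = C₁ * Γ c r

      gainConst : ℕ → ℕ
      gainConst zero = C₀
      gainConst (suc n) = Γ (gainConst n) k

      Γ-mono : ∀ c {r r′} → r ≤ r′ → Γ c r ≤ Γ c r′
      Γ-mono c {r} {r′} r≤r′ = subst (λ z → Γ c r ≤ Γ c z) (m+[n∸m]≡n r≤r′) (go (r′ ∸ r))
        where
        go : ∀ d → Γ c r ≤ Γ c (r + d)
        go zero = ≤-reflexive (cong (Γ c) (sym (+-identityʳ r)))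
        go (suc d) = ≤-trans (go d) (≤-trans (≤-trans (≤-reflexive (sym (*-identityˡ _))) (*-monoˡ-≤ (Γ c (r + d)) 1≤C₁))
          (≤-reflexive (cong (Γ c) (sym (+-suc r d)))))

      -- The exponent due to square-root cancellation up to the scales a and b: the moment exponents
      -- are tri r and r r′ + tri r′ = tri k - tri r.
      weight : ℕ → ℕ → ℕ → ℕ → ℕ
      weight r r′ a b = q * (tri r * a + (r * r′ + tri r′) * b)

      error : ℕ → ℕ
      error n = q * s + m + n * k

      module WithData {N : ℕ} {pos : ι → ℤ} {φ : ℕ → Poly} {S : List ι} {L : Carrier} (D B : ℕ) (conf : Confined k N pos φ S L)
        (hyp : ∀ {S₀ ζ} → S₀ ⊆ S → Located pos N ζ S₀ → D * mean S₀ (tri k) L ^ q ≤ B) where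

        K : List ι → List ι → ℕ → ℕ → ℕ
        K S₁ S₂ r r′ = mixed (lst S₁) (lst S₂) L (tri r) (r * r′ + tri r′)

        -- A round passes from β to γ with (1 + r) γ = (1 + r′) β, so n rounds need the factor (k
        -- !)^n in β. The factor k² in b matches the gain of `inner-zero`. `kb≤` leaves room for n
        -- rounds, each enlarging the scale at most k-fold, and `ra≤` keeps a below the next scale.
        record Pair (r r′ a b β n : ℕ) (S₁ S₂ : List ι) (ξ η : ℤ) : Set where
          field
            r+r′≡k : r + r′ ≡ k
            1≤r′   : 1 ≤ r′
            sub₁   : S₁ ⊆ S
            sub₂   : S₂ ⊆ S
            loc₁   : Located pos a ξ S₁
            loc₂   : Located pos b η S₂
            1≤a    : 1 ≤ a
            β₀     : ℕ
            1≤β₀   : 1 ≤ β₀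
            β≡     : β ≡ f ^ n * β₀
            b≡     : b ≡ k * k * β
            apart  : ¬ P ∣ ξ -ℤ η
            ra≤    : r * a ≤ suc r′ * b
            kb≤    : k ^ suc n * b ≤ N
        open Pair

        Gain : ℕ → Set
        Gain n = ∀ {r r′ a b β S₁ S₂ ξ η} → 1 ≤ r → Pair r r′ a b β n S₁ S₂ ξ η →
          D * (p ^ (weight r r′ a b + m * (n * (r * r′) * β)) * K S₁ S₂ r r′ ^ q) ≤ gainConst n * p ^ (error n * N) * B

        k≥1 : ∀ {r r′ a b β n S₁ S₂ ξ η} → Pair r r′ a b β n S₁ S₂ ξ η → 1 ≤ k
        k≥1 {r} {r′} pr = ≤-trans (1≤r′ pr) (subst (r′ ≤_) (r+r′≡k pr) (m≤n+m r′ r))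

        b≤N : ∀ {r r′ a b β n S₁ S₂ ξ η} → Pair r r′ a b β n S₁ S₂ ξ η → k * b ≤ N × b ≤ N
        b≤N {b = b} {n = n} pr = kb , ≤-trans (m≤n*m b k {{>-nonZero (k≥1 pr)}}) kb
          where
          kb : k * b ≤ N
          kb = ≤-trans (*-monoˡ-≤ b (≤-trans (≤-reflexive (sym (*-identityʳ k))) (*-monoʳ-≤ k (^-pos n (k≥1 pr))))) (kb≤ pr)

        1≤b : ∀ {r r′ a b β n S₁ S₂ ξ η} → Pair r r′ a b β n S₁ S₂ ξ η → 1 ≤ b
        1≤b {n = n} pr = subst (1 ≤_) (sym (trans (b≡ pr) (cong (k * k *_) (β≡ pr))))
          (*-mono-≤ (*-mono-≤ (k≥1 pr) (k≥1 pr)) (*-mono-≤ (^-pos n (1≤n! k)) (1≤β₀ pr)))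

        -- Hölder between the two pure moments of order 2 s, each bounded by the inequality to be
        -- improved; the savings p^(m a) and p^(m b) are given away.
        base : Gain 0
        base {r} {r′} {a} {b} {β} {S₁} {S₂} {ξ} {η} 1≤r pr = subst₂ _≤_
          (cong (λ z → D * (p ^ z * K S₁ S₂ r r′ ^ q)) (trans (sym (+-identityʳ _)) (cong (weight r r′ a b +_) (sym (*-zeroʳ m)))))
          (cong (λ z → C₀ * p ^ (z * N) * B) (lem₀ s q m))
          (interpolated q v u {mean S₂ s L} {mean S₁ s L} {K S₁ S₂ r r′} {D} {p} {q * s * b} {q * s * a} {weight r r′ a b}
            (≤-trans (≤-trans 1≤r (r≤tri r)) (m≤n+m u v))
            (subst (λ z → K S₁ S₂ r r′ ^ (v + u) ≤ mean S₂ z L ^ v * mean S₁ z L ^ u) u+v≡s (M.hölder-ends (lst S₁) (lst S₂) L u v))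
            (trans (lem u v q a b) (cong₂ (λ x y → v * (q * x * b) + u * (q * y * a)) u+v≡s u+v≡s))
            (piece S₂ b (sub₂ pr) (loc₂ pr) (1≤b pr) (proj₂ (b≤N pr)))
            (piece S₁ a (sub₁ pr) (loc₁ pr) (1≤a pr) a≤N))
          where
          u = tri r
          v = r * r′ + tri r′
          u+v≡s : u + v ≡ s
          u+v≡s = trans (sym (tri-+ r r′)) (cong tri (r+r′≡k pr))
          r≤tri : ∀ r → r ≤ tri r
          r≤tri zero = z≤n
          r≤tri (suc r) = m≤m+n (suc r) (tri r)
          lem₀ : ∀ s q m → s * q + m ≡ q * s + m + 0
          lem₀ = solve-∀
          lem : ∀ u v q a b → (v + u) * (q * (u * a + v * b)) ≡ v * (q * (u + v) * b) + u * (q * (u + v) * a)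
          lem = solve-∀
          a≤N : a ≤ N
          a≤N = ≤-trans (m≤n*m a r {{>-nonZero 1≤r}}) (≤-trans (ra≤ pr) (≤-trans
            (*-monoˡ-≤ b (subst (suc r′ ≤_) (r+r′≡k pr) (+-monoˡ-≤ r′ 1≤r))) (proj₁ (b≤N pr))))
          piece : ∀ S₁ a {ξ} → S₁ ⊆ S → Located pos a ξ S₁ → 1 ≤ a → a ≤ N →
            D * (p ^ (q * s * a) * mean S₁ s L ^ q) ≤ C₀ * p ^ ((s * q + m) * N) * B
          piece S₁ a sub loc 1≤a a≤N = raise-power D (mean S₁ s L ^ q) (*-monoˡ-≤ a (≤-trans (≤-reflexive (*-comm q s)) (m≤m+n (s * q) m)))
            (located-multiplied k q m C₀ D B dec conf hyp sub loc 1≤a a≤N)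

        -- The exponent pair on the left exceeds (tri r, tri r′) by 1 + r and (1 + r) r′. Hölder
        -- takes these as weights, and their common factor 1 + r is removed by a root.
        K-hölder : ∀ S₁ S₂ r r′ → K S₁ S₂ (suc r) r′ ^ (r′ + 1) ≤ K S₁ S₂ r (suc r′) ^ r′ * K S₂ S₁ r′ (suc r) ^ 1
        K-hölder S₁ S₂ r r′ = ^-cancelʳ-≤ (suc r) (s≤s z≤n) (subst₂ _≤_
          (trans (cong (K₀ ^_) (lem₁ r r′)) (sym (^-*-assoc K₀ (r′ + 1) (suc r))))
          (trans (cong₂ _*_ (trans (cong₂ _^_ (cong (mixed F₁ F₂ L (tri r)) (lem₂ r r′ (tri r′))) (*-comm (suc r) r′)) (sym (^-*-assoc A r′ (suc r))))
                    (cong (_^ suc r) (trans (M.mixed-sym F₁ F₂ L (suc r + suc r * r′ + tri r) (tri r′)) (trans (cong (mixed F₂ F₁ L (tri r′)) (lem₃ r r′ (tri r))) (sym (^-identityʳ A′))))))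
            (sym (distrib-^-* (A ^ r′) (A′ ^ 1) (suc r))))
          (M.hölder F₁ F₂ L (tri r) (tri r′) (suc r) (suc r * r′)))
          where
          F₁ = lst S₁
          F₂ = lst S₂
          K₀ = K S₁ S₂ (suc r) r′
          A = K S₁ S₂ r (suc r′)
          A′ = K S₂ S₁ r′ (suc r)
          lem₁ : ∀ r r′ → suc r + suc r * r′ ≡ (r′ + 1) * suc r
          lem₁ = solve-∀
          lem₂ : ∀ r r′ t → suc r + suc r * r′ + t ≡ r * suc r′ + (suc r′ + t)
          lem₂ = solve-∀
          lem₃ : ∀ r r′ t → suc r + suc r * r′ + t ≡ r′ * suc r + (suc r + t)
          lem₃ = solve-∀

        -- k r′ β is the gain won in the current round. At r = 0 and r′ = k it equals b, and each
        -- interpolation step passes it on in proportion to r′.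
        innerExponent : ℕ → ℕ → ℕ → ℕ → ℕ → ℕ → ℕ
        innerExponent n r r′ a b β = weight r r′ a b + m * (n * (r * r′) * β + k * r′ * β)

        Inner : ℕ → ℕ → Set
        Inner n r = ∀ {r′ a b β S₁ S₂ ξ η} → Pair r r′ a b β (suc n) S₁ S₂ ξ η →
          D * (p ^ innerExponent n r r′ a b β * K S₁ S₂ r r′ ^ q) ≤ Γ (gainConst n) r * p ^ ((error n + r) * N) * B

        -- The round wins its gain here. With exponent zero on `S₁` only the moment of `S₂` remains,
        -- and decoupling it over N - b scales saves p^(m b), where b = k² β.
        inner-zero : ∀ n → Inner n 0
        inner-zero n {r′} {a} {b} {β} {S₁} {S₂} pr with r+r′≡k pr
        ... | refl = begin
          D * (p ^ innerExponent n 0 k a b β * K S₁ S₂ 0 k ^ q)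
            ≡⟨ cong₂ (λ x y → D * (p ^ x * y ^ q)) (trans (lem q s b m n β k) (cong (λ z → s * q * b + m * z) (sym (b≡ pr)))) (M.mixed₀ (lst S₁) (lst S₂) L s) ⟩
          D * (p ^ (s * q * b + m * b) * mean S₂ s L ^ q)
            ≡⟨ cong (λ x → D * (p ^ x * mean S₂ s L ^ q)) (sym (*-distribʳ-+ b (s * q) m)) ⟩
          D * (p ^ ((s * q + m) * b) * mean S₂ s L ^ q)
            ≤⟨ located-multiplied k q m C₀ D B dec conf hyp (sub₂ pr) (loc₂ pr) (1≤b pr) (proj₂ (b≤N pr)) ⟩
          C₀ * p ^ ((s * q + m) * N) * B
            ≤⟨ *-monoˡ-≤ B (*-mono-≤ (m≤m+n C₀ (gainConst n)) (p^-mono (*-monoˡ-≤ N (≤-trans (≤-reflexive (cong (_+ m) (*-comm s q)))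
                 (≤-trans (m≤m+n (q * s + m) (n * k)) (m≤m+n (error n) 0)))))) ⟩
          Γ (gainConst n) 0 * p ^ ((error n + 0) * N) * B ∎
          where
          open ≤-Reasoning
          lem : ∀ q s b m n β k → q * (0 * a + (0 * k + s) * b) + m * (n * (0 * k) * β + k * k * β) ≡ s * q * b + m * (k * k * β)
          lem = solve-∀

        private
          -- The relation between β and γ makes the gains of both Hölder factors average exactly to
          -- the claimed one.
          exponent-identity : ∀ q m n k r r′ t t′ b c β γ → suc r * γ ≡ suc r′ * β →
            (r′ + 1) * (q * ((suc r + t) * c + (suc r * r′ + t′) * b) + m * (n * (suc r * r′) * β + k * r′ * β)) ≡
            r′ * (q * (t * c + (r * suc r′ + (suc r′ + t′)) * b) + m * (n * (r * suc r′) * β + k * suc r′ * β)) +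
            1 * (q * (t′ * b + (r′ * suc r + (suc r + t)) * c) + m * (n * (r′ * suc r) * γ))
          exponent-identity q m n k r r′ t t′ b c β γ eq = begin
            (r′ + 1) * (q * ((suc r + t) * c + (suc r * r′ + t′) * b) + m * (n * (suc r * r′) * β + k * r′ * β))
              ≡⟨ lem₁ q m n k r r′ t t′ b c β ⟩
            r′ * A + 1 * (W + m * (n * r′ * (suc r′ * β)))
              ≡⟨ cong (λ z → r′ * A + 1 * (W + m * (n * r′ * z))) eq ⟨
            r′ * A + 1 * (W + m * (n * r′ * (suc r * γ)))
              ≡⟨ cong (λ z → r′ * A + 1 * (W + m * z)) (lem₂ n r r′ γ) ⟩
            r′ * A + 1 * (W + m * (n * (r′ * suc r) * γ)) ∎
            where
            open ≡-Reasoning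
            A = q * (t * c + (r * suc r′ + (suc r′ + t′)) * b) + m * (n * (r * suc r′) * β + k * suc r′ * β)
            W = q * (t′ * b + (r′ * suc r + (suc r + t)) * c)
            lem₁ : ∀ q m n k r r′ t t′ b c β →
              (r′ + 1) * (q * ((suc r + t) * c + (suc r * r′ + t′) * b) + m * (n * (suc r * r′) * β + k * r′ * β)) ≡
              r′ * (q * (t * c + (r * suc r′ + (suc r′ + t′)) * b) + m * (n * (r * suc r′) * β + k * suc r′ * β)) +
              1 * (q * (t′ * b + (r′ * suc r + (suc r + t)) * c) + m * (n * r′ * (suc r′ * β)))
            lem₁ = solve-∀
            lem₂ : ∀ n r r′ γ → n * r′ * (suc r * γ) ≡ n * (r′ * suc r) * γ
            lem₂ = solve-∀

          decoupled-exponent : ∀ q u v m X a d b → q * (u * (a + d) + v * b) + m * X ≡ q * (u * a + v * b) + m * X + u * q * d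
          decoupled-exponent = solve-∀

        -- Decouple S₁ from scale a to the scale c with (1 + r) c = (1 + r′) b by the
        -- inequality of degree 1 + r, then interpolate between r and the pair with roles exchanged.
        inner-suc : ∀ n r → Gain n → Inner n r → Inner n (suc r)
        inner-suc n r gain inner {r′} {a} {b} {β} {S₁} {S₂} {ξ} {η} pr = conclude
          where
          open ≤-Reasoning
          f/r : ∃ λ t → f ≡ t * suc r
          f/r = !-multiple r k (subst (suc r ≤_) (r+r′≡k pr) (m≤m+n (suc r) r′))
          t = proj₁ f/r
          -- Since k! = t (1 + r), one factor k! of β pays for the division by 1 + r, and γ keeps
          -- the remaining (k !)^n.
          γ₀ = suc r′ * t * β₀ pr
          γ = f ^ n * γ₀
          c = k * k * γ
          rγ : suc r * γ ≡ suc r′ * β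
          rγ = trans (lem (suc r) (f ^ n) (suc r′) t (β₀ pr)) (trans (cong (λ z → suc r′ * (z * f ^ n * β₀ pr)) (sym (proj₂ f/r)))
            (cong (suc r′ *_) (sym (β≡ pr))))
            where
            lem : ∀ r fn r′ t b → r * (fn * (r′ * t * b)) ≡ r′ * (t * r * fn * b)
            lem = solve-∀
          rc : suc r * c ≡ suc r′ * b
          rc = trans (lem (suc r) (k * k) γ) (trans (cong (k * k *_) rγ) (trans (lem (k * k) (suc r′) β) (cong (suc r′ *_) (sym (b≡ pr)))))
            where
            lem : ∀ x y z → x * (y * z) ≡ y * (x * z)
            lem = solve-∀
          r′<k : suc r′ ≤ k
          r′<k = subst (suc r′ ≤_) (r+r′≡k pr) (s≤s (m≤n+m r′ r))
          a≤c : a ≤ c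
          a≤c = *-cancelˡ-≤ (suc r) (≤-trans (ra≤ pr) (≤-reflexive (sym rc)))
          c≤kb : c ≤ k * b
          c≤kb = *-cancelˡ-≤ (suc r) (≤-trans (≤-reflexive rc) (≤-trans (*-monoˡ-≤ b r′<k) (m≤n*m (k * b) (suc r))))
          c≤N : c ≤ N
          c≤N = ≤-trans c≤kb (proj₁ (b≤N pr))
          1≤γ₀ : 1 ≤ γ₀
          1≤γ₀ = *-mono-≤ {1} {suc r′ * t} {1} {β₀ pr} (*-mono-≤ {1} {suc r′} {1} {t} (s≤s z≤n) t≥1) (1≤β₀ pr)
            where
            t≥1 : 1 ≤ t
            t≥1 = >-nonZero⁻¹ t {{m*n≢0⇒m≢0 t {suc r} {{subst NonZero (proj₂ f/r) (k !≢0)}}}}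
          d = c ∸ a
          ψ-conf = confined-project {m = r′} {suc r} {suc r * r′ + tri r′} {a = a} {b = b} {c = c} {ξ} {η}
            (subst (_< p) (sym r′+r) k<p) (trans (sym (tri-+ (suc r) r′)) (cong tri (+-comm (suc r) r′)))
            (subst (λ k → Confined k N pos φ S L) (sym r′+r) conf)
            (sub₁ pr) (sub₂ pr) (loc₁ pr) (loc₂ pr) (1≤a pr) (s≤s z≤n) a≤c (proj₂ (b≤N pr)) (≤-reflexive rc) (nondivisible⇒unit (apart pr))
            where
            r′+r : r′ + suc r ≡ k
            r′+r = trans (+-comm r′ (suc r)) (r+r′≡k pr)
          Y = Γ (gainConst n) r * p ^ ((error n + r) * N) * B
          α : ℕ → ℕ
          α a = innerExponent n (suc r) r′ a b β
          at-scale-c : ∀ {S₀ ζ} → S₀ ⊆ S₁ → Located (coordinate pos a ξ) d ζ S₀ → D * (p ^ α c * K S₀ S₂ (suc r) r′ ^ q) ≤ Y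
          at-scale-c {S₀} {ζ} S₀⊆ loc₀ = interpolated q r′ 1 {K S₀ S₂ r (suc r′)} {K S₂ S₀ r′ (suc r)} {K S₀ S₂ (suc r) r′} {D} {p}
            {innerExponent n r (suc r′) c b β} {weight r′ (suc r) b c + m * (n * (r′ * suc r) * γ)} {α c} {Y}
            (≤-trans (s≤s z≤n) (m≤n+m 1 r′)) (K-hölder S₀ S₂ r r′)
            (exponent-identity q m n k r r′ (tri r) (tri r′) b c β γ rγ)
            (inner pair₁)
            (≤-trans (gain (1≤r′ pr) pair₂) (*-monoˡ-≤ B (*-mono-≤ (≤-trans (m≤n+m (gainConst n) C₀) (Γ-mono (gainConst n) {0} {r} z≤n))
              (p^-mono (*-monoˡ-≤ N (m≤m+n (error n) r))))))
            where
            ξ′ = ξ +ℤ P ^ℤ a *ℤ ζ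
            loc₁′ : Located pos c ξ′ S₀
            loc₁′ = located-nested pos a ξ (loc₁ pr) S₀⊆ a≤c loc₀
            P∣P^a : P ∣ P ^ℤ a *ℤ ζ
            P∣P^a = ∣m⇒∣m*n ζ (subst (P ∣_) (cong (P ^ℤ_) (m+[n∸m]≡n (1≤a pr))) (∣m⇒∣m*n (P ^ℤ (a ∸ 1)) ∣-refl))
            apart′ : ¬ P ∣ ξ′ -ℤ η
            apart′ P∣ = apart pr (subst (P ∣_) (lem ξ (P ^ℤ a *ℤ ζ) η) (∣m∣n⇒∣m-n P∣ P∣P^a))
              where
              lem : ∀ x y z → (x +ℤ y -ℤ z) -ℤ y ≡ x -ℤ z
              lem = ℤS.solve-∀
            pair₁ : Pair r (suc r′) c b β (suc n) S₀ S₂ ξ′ η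
            pair₁ = record
              { r+r′≡k = trans (+-suc r r′) (r+r′≡k pr)
              ; 1≤r′ = s≤s z≤n
              ; sub₁ = ⊆-trans S₀⊆ (sub₁ pr) ; sub₂ = sub₂ pr
              ; loc₁ = loc₁′ ; loc₂ = loc₂ pr
              ; 1≤a = ≤-trans (1≤a pr) a≤c
              ; β₀ = β₀ pr ; 1≤β₀ = 1≤β₀ pr ; β≡ = β≡ pr ; b≡ = b≡ pr
              ; apart = apart′
              ; ra≤ = ≤-trans (*-monoˡ-≤ c (n≤1+n r)) (≤-trans (≤-reflexive rc) (*-monoˡ-≤ b (n≤1+n (suc r′))))
              ; kb≤ = kb≤ pr }
            pair₂ : Pair r′ (suc r) b c γ n S₂ S₀ η ξ′
            pair₂ = record
              { r+r′≡k = trans (+-comm r′ (suc r)) (r+r′≡k pr)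
              ; 1≤r′ = s≤s z≤n
              ; sub₁ = sub₂ pr ; sub₂ = ⊆-trans S₀⊆ (sub₁ pr)
              ; loc₁ = loc₂ pr ; loc₂ = loc₁′
              ; 1≤a = 1≤b pr
              ; β₀ = γ₀ ; 1≤β₀ = 1≤γ₀ ; β≡ = refl ; b≡ = refl
              ; apart = λ P∣ → apart′ (subst (P ∣_) (lem η ξ′) (∣m∣n⇒∣m-n (divides ℤ.0ℤ refl) P∣))
              ; ra≤ = ≤-trans (*-monoˡ-≤ b (n≤1+n r′)) (≤-trans (≤-reflexive (sym rc)) (*-monoˡ-≤ c (n≤1+n (suc r))))
              ; kb≤ = ≤-trans (*-monoʳ-≤ (k ^ suc n) c≤kb) (≤-trans (≤-reflexive (lem′ (k ^ suc n) k b)) (kb≤ pr)) }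
              where
              lem : ∀ x y → ℤ.0ℤ -ℤ (x -ℤ y) ≡ y -ℤ x
              lem = ℤS.solve-∀
              lem′ : ∀ x y z → x * (y * z) ≡ y * x * z
              lem′ = solve-∀
          K≡mean : ∀ S₀ → K S₀ S₂ (suc r) r′ ≡ mean S₀ (tri (suc r)) (lst S₂ M.^ (suc r * r′ + tri r′) M.* L)
          K≡mean S₀ = M.mixed-absorb (lst S₀) (lst S₂) L (tri (suc r)) (suc r * r′ + tri r′)
          decoupled : (D * p ^ α c) * K S₁ S₂ (suc r) r′ ^ q ≤ C₁ * p ^ ((tri (suc r) * q + 1) * d) * Y
          decoupled = subst (λ z → (D * p ^ α c) * z ^ q ≤ C₁ * p ^ ((tri (suc r) * q + 1) * d) * Y) (sym (K≡mean S₁))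
            -- r′ ≥ 1 puts the degree 1 + r below k. The free factor in the decoupling inequality
            -- absorbs p^(α c).
            (lower (suc r) (s≤s z≤n) (subst (suc r <_) (r+r′≡k pr) (≤-trans (≤-reflexive (+-comm 1 (suc r))) (+-monoʳ-≤ (suc r) (1≤r′ pr))))
              (D * p ^ α c) Y (proj₂ ψ-conf)
              (λ {S₀} S₀⊆ loc₀ → subst (λ z → (D * p ^ α c) * z ^ q ≤ Y) (K≡mean S₀)
                (≤-trans (≤-reflexive (*-assoc D (p ^ α c) _)) (at-scale-c S₀⊆ loc₀))))
          u = tri (suc r)
          K^q = K S₁ S₂ (suc r) r′ ^ q
          α-split : α c ≡ α a + u * q * d
          α-split = trans (cong α (sym (m+[n∸m]≡n a≤c)))
            (decoupled-exponent q u (suc r * r′ + tri r′) m (n * (suc r * r′) * β + k * r′ * β) a d b)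
          conclude : D * (p ^ α a * K^q) ≤ Γ (gainConst n) (suc r) * p ^ ((error n + suc r) * N) * B
          conclude = *-cancel-≤-pos (p ^ (u * q * d)) (m^n>0 p (u * q * d)) (begin
            p ^ (u * q * d) * (D * (p ^ α a * K^q))
              ≡⟨ lem₁ (p ^ (u * q * d)) D (p ^ α a) K^q ⟩
            D * (p ^ α a * p ^ (u * q * d)) * K^q
              ≡⟨ cong (λ z → D * z * K^q) (trans (cong (p ^_) α-split) (^-distribˡ-+-* p (α a) (u * q * d))) ⟨
            D * p ^ α c * K^q
              ≤⟨ decoupled ⟩
            C₁ * p ^ ((u * q + 1) * d) * (Γ (gainConst n) r * p ^ ((error n + r) * N) * B)
              ≡⟨ cong (λ z → C₁ * z * Y) (trans (cong (p ^_) (lem₂ (u * q) d)) (^-distribˡ-+-* p (u * q * d) d)) ⟩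
            C₁ * (p ^ (u * q * d) * p ^ d) * (Γ (gainConst n) r * p ^ ((error n + r) * N) * B)
              ≡⟨ lem₃ C₁ (p ^ (u * q * d)) (p ^ d) (Γ (gainConst n) r) (p ^ ((error n + r) * N)) B ⟩
            p ^ (u * q * d) * (C₁ * Γ (gainConst n) r * (p ^ d * p ^ ((error n + r) * N)) * B)
              ≤⟨ *-monoʳ-≤ (p ^ (u * q * d)) (*-monoˡ-≤ B (*-monoʳ-≤ (C₁ * Γ (gainConst n) r) (*-monoˡ-≤ _ (p^-mono (≤-trans (m∸n≤m c a) c≤N))))) ⟩
            p ^ (u * q * d) * (C₁ * Γ (gainConst n) r * (p ^ N * p ^ ((error n + r) * N)) * B)
              ≡⟨ cong (λ z → p ^ (u * q * d) * (C₁ * Γ (gainConst n) r * z * B))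
                   (trans (sym (^-distribˡ-+-* p N _)) (cong (p ^_) (lem₄ N (error n) r))) ⟩
            p ^ (u * q * d) * (Γ (gainConst n) (suc r) * p ^ ((error n + suc r) * N) * B) ∎)
            where
            lem₁ : ∀ x d a k → x * (d * (a * k)) ≡ d * (a * x) * k
            lem₁ = solve-∀
            lem₂ : ∀ x d → (x + 1) * d ≡ x * d + d
            lem₂ = solve-∀
            lem₃ : ∀ c x y g e b → c * (x * y) * (g * e * b) ≡ x * (c * g * (y * e) * b)
            lem₃ = solve-∀
            lem₄ : ∀ N e r → N + (e + r) * N ≡ (e + suc r) * N
            lem₄ = solve-∀

        inner-all : ∀ n → Gain n → ∀ r → Inner n r
        inner-all n gain zero = inner-zero n
        inner-all n gain (suc r) = inner-suc n r gain (inner-all n gain r)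

        -- The round has won k r′ β ≥ r r′ β, which is one more unit of the claimed gain.
        step : ∀ n → Gain n → Gain (suc n)
        step n gain {r} {r′} {a} {b} {β} {S₁} {S₂} 1≤r pr = ≤-trans
          (raise-power D (K S₁ S₂ r r′ ^ q) (+-monoʳ-≤ (weight r r′ a b) (*-monoʳ-≤ m (≤-trans (≤-reflexive (lem n r r′ β))
            (+-monoʳ-≤ (n * (r * r′) * β) (*-monoˡ-≤ β (*-monoˡ-≤ r′ r≤k))))))
            (inner-all n gain r pr))
          (*-monoˡ-≤ B (*-mono-≤ (Γ-mono (gainConst n) r≤k) (p^-mono (*-monoˡ-≤ N
            (≤-trans (+-monoʳ-≤ (error n) r≤k) (≤-reflexive (lem′ (q * s + m) n k)))))))
          where
          r≤k : r ≤ k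
          r≤k = subst (r ≤_) (r+r′≡k pr) (m≤m+n r r′)
          lem : ∀ n r r′ β → suc n * (r * r′) * β ≡ n * (r * r′) * β + r * r′ * β
          lem = solve-∀
          lem′ : ∀ x n k → x + n * k + k ≡ x + suc n * k
          lem′ = solve-∀

        gain-all : ∀ n → Gain n
        gain-all zero = base
        gain-all (suc n) = step n (gain-all n)

-- Lowering the loss exponent and induction on the degree.

module DecouplingInduction where

  open import Algebra.Structures using (IsMonoid)
  open import Data.Integer using (ℤ) renaming (+_ to int; _^_ to _^ℤ_; _-_ to _-ℤ_; _+_ to _+ℤ_)
  import Data.Integer.Properties as ℤ
  open import Data.Integer.Divisibility.Signed using (_∣_; _∣?_; ∣m∣n⇒∣m+n; ∣m∣n⇒∣m-n; ∣m⇒∣m*n; ∣-trans; ∣-refl)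
  import Data.Integer.Tactic.RingSolver as ℤS
  open import Data.List using (List; []; _∷_)
  open import Data.List.Relation.Binary.Sublist.Propositional using (_⊆_; lookup; ⊆-trans)
  open import Data.List.Relation.Unary.All as All using (All; []; _∷_)
  open import Data.List.Relation.Unary.Any using (here)
  open import Data.Nat
  open import Data.Nat.DivMod using (m≡m%n+[m/n]*n; m%n<n; m/n*n≤m; m≥n⇒m/n>0)
  open import Data.Nat.Induction using (<-rec)
  open import Data.Nat.Primality using (Prime)
  open import Data.Nat.Properties
  open import Data.Nat.Tactic.RingSolver using (solve-∀)
  open import Data.Product using (∃; ∃₂; _×_; _,_; proj₁; proj₂)
  open import Data.Sum using (_⊎_; inj₁; inj₂; [_,_]′)
  open import Relation.Binary.PropositionalEquality
  open import Relation.Nullary using (¬_; Dec; yes; no; contradiction)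
  open ConfinedSets
  open DecouplingIteration
  open Curves using (Poly)
  open MeanValues
  open PowerInequalities
  open TraceSemirings

  -- With n = q* s k² and q = q* q′, the gain m n β outweighs both the loss q V b from
  -- passing to scale p ^ −b and the accumulated errors (n k + 1) N.
  exponent-budget : ∀ q* q′ k k′ s V m n fⁿ β₀ N → 1 ≤ k′ → q′ ≤ m → s ≡ suc V → n ≡ q* * s * (k * k) → 1 ≤ q* →
    q′ ≡ (n * k + 1) * k ^ suc n → N ≤ k ^ suc n * (k * k * fⁿ) * suc β₀ →
    q* * q′ * V * (k * k * (fⁿ * β₀)) + (N + n * k * N) ≤ m * (n * (1 * k′) * (fⁿ * β₀)) + (n * k + 1) * (k ^ suc n * (k * k * fⁿ))
  exponent-budget q* q′ k k′ s V m n fⁿ β₀ N 1≤k′ q′≤m s≡ n≡ 1≤q* q′≡ N≤ = begin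
    q* * q′ * V * b + (N + n * k * N)
      ≡⟨ cong (q* * q′ * V * b +_) (lem₁ N (n * k)) ⟩
    q* * q′ * V * b + (n * k + 1) * N
      ≤⟨ +-monoʳ-≤ (q* * q′ * V * b) (*-monoʳ-≤ (n * k + 1) N≤) ⟩
    q* * q′ * V * b + (n * k + 1) * (k ^ suc n * (k * k * fⁿ) * suc β₀)
      ≡⟨ lem₂ (q* * q′ * V * b) (n * k + 1) (k ^ suc n) (k * k) fⁿ β₀ ⟩
    q* * q′ * V * b + (n * k + 1) * k ^ suc n * b + h
      ≡⟨ cong (λ z → q* * q′ * V * b + z * b + h) q′≡ ⟨
    q* * q′ * V * b + q′ * b + h
      ≤⟨ +-monoˡ-≤ h (+-monoʳ-≤ (q* * q′ * V * b) (*-monoˡ-≤ b (m≤n*m q′ q* {{>-nonZero 1≤q*}}))) ⟩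
    q* * q′ * V * b + q* * q′ * b + h
      ≡⟨ cong (_+ h) (trans (lem₃ (q* * q′) V b) (cong (λ z → q* * q′ * z * b) (sym s≡))) ⟩
    q* * q′ * s * b + h
      ≡⟨ cong (_+ h) (trans (lem₄ q* q′ s (k * k) (fⁿ * β₀)) (cong (λ z → q′ * (z * (1 * 1) * (fⁿ * β₀))) (sym n≡))) ⟩
    q′ * (n * (1 * 1) * (fⁿ * β₀)) + h
      ≤⟨ +-monoˡ-≤ h (*-mono-≤ q′≤m (*-monoˡ-≤ (fⁿ * β₀) (*-monoʳ-≤ n (*-monoʳ-≤ 1 1≤k′)))) ⟩
    m * (n * (1 * k′) * (fⁿ * β₀)) + h ∎
    where
    open ≤-Reasoning
    b = k * k * (fⁿ * β₀)
    h = (n * k + 1) * (k ^ suc n * (k * k * fⁿ))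
    lem₁ : ∀ N x → N + x * N ≡ (x + 1) * N
    lem₁ = solve-∀
    lem₂ : ∀ a x y z f β → a + x * (y * (z * f) * suc β) ≡ a + x * y * (z * (f * β)) + x * (y * (z * f))
    lem₂ = solve-∀
    lem₃ : ∀ q V b → q * V * b + q * b ≡ q * suc V * b
    lem₃ = solve-∀
    lem₄ : ∀ a b s k β → a * b * s * (k * β) ≡ b * (a * s * k * (1 * 1) * β)
    lem₄ = solve-∀

  module Improvement {G : Set} {_∙_ : G → G → G} {ε : G} (isMonoid : IsMonoid _≡_ _∙_ ε)
    (T : GroupTrace _∙_ ε) {ι : Set} (e : ι → G) (p : ℕ) (p-prime : Prime p) (4≤p : 4 ≤ p) where

    open Confinement isMonoid T e p p-prime
    open Decoupling isMonoid T e p p-prime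
    private module M = Means isMonoid T e
    open M using (mean; mixed; class; class-⊆; class-all)

    module Step (k₂ q* m₁ C₀ C₁ : ℕ) (1≤q* : 1 ≤ q*) (k<p : 2 + k₂ < p) (1≤C₁ : 1 ≤ C₁) where
      k′ k s n₂ V n q′ q m H b-unit : ℕ
      k′ = suc k₂
      k = suc k′
      s = tri k
      n₂ = k₂ + tri k′
      V = suc n₂
      n = q* * s * (k * k)
      -- The broad case works at a scale b close to N / k^(n + 1), so the errors (n k + 1) N are
      -- about q′ b.
      q′ = (n * k + 1) * k ^ suc n
      q = q* * q′
      m = suc m₁
      b-unit = k * k * (k !) ^ n
      -- With b = k² (k !)^n β₀, the condition k^(n + 1) b ≤ N reads β₀ H ≤ N; hence β₀ = N / H,
      -- which is positive once H ≤ N.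
      H = k ^ suc n * b-unit

      module Proof (q′≤m : q′ ≤ m) (dec : Decouples k q m C₀) (lower : ∀ r → 1 ≤ r → r < k → Decouples r q 1 C₁) where

        open Iteration k q m C₀ C₁ k<p 1≤C₁ dec lower using (gainConst; weight; error; module WithData)

        1≤q′ : 1 ≤ q′
        1≤q′ = *-mono-≤ {1} {n * k + 1} {1} {k ^ suc n} (m≤n+m 1 (n * k)) (^-pos (suc n) (s≤s z≤n))

        1≤q : 1 ≤ q
        1≤q = *-mono-≤ {1} {q*} {1} {q′} 1≤q* 1≤q′

        1≤H : 1 ≤ H
        1≤H = *-mono-≤ {1} {k ^ suc n} {1} {b-unit} (^-pos (suc n) (s≤s z≤n))
          (*-mono-≤ {1} {k * k} {1} {(k !) ^ n} (*-mono-≤ {1} {k} {1} {k} (s≤s z≤n) (s≤s z≤n)) (^-pos n (1≤n! k)))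

        module _ {N : ℕ} {pos : ι → ℤ} {φ : ℕ → Poly} {S : List ι} {L : Carrier} (D B : ℕ) (conf : Confined k N pos φ S L)
          (hyp : ∀ {S₀ ζ} → S₀ ⊆ S → Located pos N ζ S₀ → D * mean S₀ (tri k) L ^ q ≤ B) (H≤N : H ≤ N) where

          private
            open WithData D B conf hyp using (gain-all)
            instance
              H≢0 : NonZero H
              H≢0 = >-nonZero 1≤H
            β₀ = N / H
            β = (k !) ^ n * β₀
            b = k * k * β
            X = m * (n * (1 * k′) * β)

            b-small : k ^ suc n * b ≤ N
            b-small = ≤-trans (≤-reflexive (lem (k ^ suc n) (k * k) ((k !) ^ n) β₀)) (m/n*n≤m N H)
              where
              lem : ∀ x y f β → x * (y * (f * β)) ≡ β * (x * (y * f))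
              lem = solve-∀

            N≤ : N ≤ k ^ suc n * (k * k * (k !) ^ n) * suc β₀
            N≤ = ≤-trans (≤-reflexive (m≡m%n+[m/n]*n N H)) (≤-trans (+-monoˡ-≤ (β₀ * H) (<⇒≤ (m%n<n N H)))
              (≤-reflexive (*-comm (suc β₀) H)))

            1≤β₀ : 1 ≤ β₀
            1≤β₀ = m≥n⇒m/n>0 {N} {H} H≤N

            1≤b : 1 ≤ b
            1≤b = *-mono-≤ {1} {k * k} {1} {β} (*-mono-≤ {1} {k} {1} {k} (s≤s z≤n) (s≤s z≤n))
              (*-mono-≤ {1} {(k !) ^ n} {1} {β₀} (^-pos n (1≤n! k)) 1≤β₀)

            v≡V : 1 * k′ + tri k′ ≡ V
            v≡V = cong (_+ tri k′) (*-identityˡ k′)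

            GainBound : List ι → List ι → Set
            GainBound I J = D * (p ^ (q * (V * b) + X) * mixed (lst I) (lst J) L 1 V ^ q) ≤ gainConst n * p ^ (error n * N) * B

            zero-bound : ∀ I J → mixed (lst I) (lst J) L 1 V ≡ 0 → GainBound I J
            zero-bound I J eq = subst (_≤ gainConst n * p ^ (error n * N) * B) (sym (begin-equality
              D * (p ^ (q * (V * b) + X) * mixed (lst I) (lst J) L 1 V ^ q) ≡⟨ cong (λ z → D * (p ^ (q * (V * b) + X) * z ^ q)) eq ⟩
              D * (p ^ (q * (V * b) + X) * 0 ^ q)  ≡⟨ cong (λ z → D * (p ^ (q * (V * b) + X) * z)) (zero-power q 1≤q) ⟩
              D * (p ^ (q * (V * b) + X) * 0)      ≡⟨ cong (D *_) (*-zeroʳ (p ^ (q * (V * b) + X))) ⟩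
              D * 0                                ≡⟨ *-zeroʳ D ⟩
              0                                    ∎)) z≤n
              where
              open ≤-Reasoning
              zero-power : ∀ q → 1 ≤ q → 0 ^ q ≡ 0
              zero-power (suc q) _ = refl

            apart-bound : ∀ {I J ξ η} → I ⊆ S → J ⊆ S → Located pos 1 ξ I → Located pos b η J → ¬ P ∣ ξ -ℤ η → GainBound I J
            apart-bound {I} {J} {ξ} {η} I⊆ J⊆ locI locJ apart =
              raise-power D (mixed (lst I) (lst J) L 1 V ^ q) (+-monoˡ-≤ X (*-monoʳ-≤ q
                (≤-trans (≤-reflexive (cong (_* b) (sym v≡V))) (m≤n+m ((1 * k′ + tri k′) * b) (1 * 1)))))
                (subst (λ v → D * (p ^ (weight 1 k′ 1 b + X) * mixed (lst I) (lst J) L 1 v ^ q) ≤ gainConst n * p ^ (error n * N) * B) v≡V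
                  (gain-all n {1} {k′} {1} {b} {β} {I} {J} {ξ} {η} ≤-refl record
                    { r+r′≡k = refl ; 1≤r′ = s≤s z≤n ; sub₁ = I⊆ ; sub₂ = J⊆ ; loc₁ = locI ; loc₂ = locJ ; 1≤a = ≤-refl
                    ; β₀ = β₀ ; 1≤β₀ = 1≤β₀ ; β≡ = refl ; b≡ = refl ; apart = apart
                    ; ra≤ = *-mono-≤ {1} {suc k′} {1} {b} (s≤s z≤n) 1≤b ; kb≤ = b-small }))

            -- If η ≡ ξ modulo p, then one of the lists is empty, since members of both would give ξ
            -- ≡ η ≡ ζ; an empty list makes the mixed moment zero.
            located-bound : ∀ {ξ ζ η} I J → I ⊆ S → J ⊆ S → All (λ i → residue pos 1 i ≡ ξ) I → All (λ i → residue pos 1 i ≡ ζ) J →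
              ξ ≢ ζ → Located pos b η J → Dec (P ∣ int ξ -ℤ η) → GainBound I J
            located-bound I J I⊆ J⊆ allI allJ ξ≢ζ locJ (no apart) = apart-bound I⊆ J⊆ (residue-located pos 1 allI) locJ apart
            located-bound [] J _ _ _ _ _ _ (yes _) = zero-bound [] J (M.mixed-zeroˡ (lst J) L 0 V)
            located-bound I@(_ ∷ _) [] _ _ _ _ _ _ (yes _) = zero-bound I [] (M.mixed-zeroʳ (lst I) L 1 n₂)
            located-bound {ξ} {ζ} {η} (i ∷ _) (j ∷ _) _ _ (eqI ∷ _) allJ@(eqJ ∷ _) ξ≢ζ locJ (yes close) = contradiction
              (congruent-residues (subst (_< p ^ 1) eqI (residue< pos 1 i)) (subst (_< p ^ 1) eqJ (residue< pos 1 j))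
                (subst (λ z → int z ∣ int ξ -ℤ int ζ) (sym (^-identityʳ p))
                  (subst (P ∣_) (lem (int ξ) (int ζ) η (pos j))
                    (∣m∣n⇒∣m+n (∣m∣n⇒∣m-n close (∣-trans P∣P^b (locJ (here refl))))
                      (subst (_∣ pos j -ℤ int ζ) (ℤ.^-identityʳ P) (residue-located pos 1 allJ (here refl)))))))
              ξ≢ζ
              where
              P∣P^b : P ∣ P ^ℤ b
              P∣P^b = subst (P ∣_) (cong (P ^ℤ_) (m+[n∸m]≡n 1≤b)) (∣m⇒∣m*n (P ^ℤ (b ∸ 1)) ∣-refl)
              lem : ∀ x z y j → (x -ℤ y) -ℤ (j -ℤ y) +ℤ (j -ℤ z) ≡ x -ℤ z
              lem = ℤS.solve-∀

          -- The second class is first cut down to scale p ^ -b at the trivial cost p^(2 b V q).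
          -- Half of this is returned by the weight q V b; the other half and the errors are paid by
          -- the gain through `exponent-budget`.
          broad-bound : ∀ {ξ ζ} I J → I ⊆ S → J ⊆ S → All (λ i → residue pos 1 i ≡ ξ) I → All (λ i → residue pos 1 i ≡ ζ) J → ξ ≢ ζ →
            D * mixed (lst I) (lst J) L 1 V ^ q ≤ gainConst n * p ^ ((n * k + 1) * H) * p ^ ((s * q + m₁) * N) * B
          broad-bound {ξ} I J I⊆ J⊆ allI allJ ξ≢ζ =
            let J₀ , η , J₀⊆ , locJ₀ , refine = largest-piece pos b J (lst I M.^ 1 M.* L) n₂
            in finish J₀ refine (located-bound I J₀ I⊆ (⊆-trans J₀⊆ J⊆) allI (All-resp J₀⊆ allJ) ξ≢ζ locJ₀ (P ∣? (int ξ -ℤ η)))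
            where
            open ≤-Reasoning
            All-resp : ∀ {ζ J₀ J} → J₀ ⊆ J → All (λ i → residue pos 1 i ≡ ζ) J → All (λ i → residue pos 1 i ≡ ζ) J₀
            All-resp sub all = All.tabulate (λ i∈ → All.lookup all (lookup sub i∈))
            swap : ∀ J → mixed (lst I) (lst J) L 1 V ≡ mean J V (lst I M.^ 1 M.* L)
            swap J = trans (M.mixed-sym (lst I) (lst J) L 1 V) (M.mixed-absorb (lst J) (lst I) L V 1)
            R = p ^ (q * (V * b) + X)
            finish : ∀ J₀ → mean J V (lst I M.^ 1 M.* L) ≤ p ^ (2 * b * V) * mean J₀ V (lst I M.^ 1 M.* L) → GainBound I J₀ →
              D * mixed (lst I) (lst J) L 1 V ^ q ≤ gainConst n * p ^ ((n * k + 1) * H) * p ^ ((s * q + m₁) * N) * B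
            finish J₀ refine bound = *-cancel-≤-pos R (m^n>0 p (q * (V * b) + X)) (begin
              R * (D * mixed (lst I) (lst J) L 1 V ^ q)
                ≤⟨ *-monoʳ-≤ R (*-monoʳ-≤ D (^-monoˡ-≤ q (subst₂ (λ x y → x ≤ p ^ (2 * b * V) * y) (sym (swap J)) (sym (swap J₀)) refine))) ⟩
              R * (D * (p ^ (2 * b * V) * K₀) ^ q)
                ≡⟨ cong (λ z → R * (D * z)) (trans (distrib-^-* (p ^ (2 * b * V)) K₀ q) (cong (_* K₀ ^ q) (^-*-assoc p (2 * b * V) q))) ⟩
              R * (D * (p ^ (2 * b * V * q) * K₀ ^ q))
                ≡⟨ lem₁ R D (p ^ (2 * b * V * q)) (K₀ ^ q) ⟩
              p ^ (2 * b * V * q) * (D * (R * K₀ ^ q))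
                ≤⟨ *-monoʳ-≤ (p ^ (2 * b * V * q)) bound ⟩
              p ^ (2 * b * V * q) * (gainConst n * p ^ (error n * N) * B)
                ≡⟨ lem₂ (p ^ (2 * b * V * q)) (gainConst n) (p ^ (error n * N)) B ⟩
              gainConst n * (p ^ (2 * b * V * q) * p ^ (error n * N)) * B
                ≤⟨ *-monoˡ-≤ B (*-monoʳ-≤ (gainConst n) powers) ⟩
              gainConst n * (R * (p ^ ((n * k + 1) * H) * p ^ ((s * q + m₁) * N))) * B
                ≡⟨ lem₃ (gainConst n) R (p ^ ((n * k + 1) * H)) (p ^ ((s * q + m₁) * N)) B ⟩
              R * (gainConst n * p ^ ((n * k + 1) * H) * p ^ ((s * q + m₁) * N) * B) ∎)
              where
              K₀ = mixed (lst I) (lst J₀) L 1 V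
              lem₁ : ∀ r d x y → r * (d * (x * y)) ≡ x * (d * (r * y))
              lem₁ = solve-∀
              lem₂ : ∀ x g y b → x * (g * y * b) ≡ g * (x * y) * b
              lem₂ = solve-∀
              lem₃ : ∀ g r x y b → g * (r * (x * y)) * b ≡ r * (g * x * y * b)
              lem₃ = solve-∀
              lem₄ : ∀ q V b s m nk N → 2 * b * V * q + (q * s + suc m + nk) * N ≡ q * V * b + (N + nk * N) + (q * (V * b) + (s * q + m) * N)
              lem₄ = solve-∀
              lem₅ : ∀ X h y z → X + h + (y + z) ≡ y + X + (h + z)
              lem₅ = solve-∀
              powers : p ^ (2 * b * V * q) * p ^ (error n * N) ≤ R * (p ^ ((n * k + 1) * H) * p ^ ((s * q + m₁) * N))
              powers = begin
                p ^ (2 * b * V * q) * p ^ (error n * N)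
                  ≡⟨ ^-distribˡ-+-* p (2 * b * V * q) (error n * N) ⟨
                p ^ (2 * b * V * q + error n * N)
                  ≡⟨ cong (p ^_) (lem₄ q V b s m₁ (n * k) N) ⟩
                p ^ (q * V * b + (N + n * k * N) + (q * (V * b) + (s * q + m₁) * N))
                  ≤⟨ p^-mono (+-monoˡ-≤ (q * (V * b) + (s * q + m₁) * N)
                       (exponent-budget q* q′ k k′ s V m n ((k !) ^ n) β₀ N (s≤s z≤n) q′≤m refl refl 1≤q* refl N≤)) ⟩
                p ^ (X + (n * k + 1) * H + (q * (V * b) + (s * q + m₁) * N))
                  ≡⟨ cong (p ^_) (lem₅ X ((n * k + 1) * H) (q * (V * b)) ((s * q + m₁) * N)) ⟩
                p ^ (q * (V * b) + X + ((n * k + 1) * H + (s * q + m₁) * N))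
                  ≡⟨ trans (^-distribˡ-+-* p (q * (V * b) + X) _) (cong (R *_) (^-distribˡ-+-* p ((n * k + 1) * H) _)) ⟩
                R * (p ^ ((n * k + 1) * H) * p ^ ((s * q + m₁) * N)) ∎

        private
          p¹ = p ^ 1
          c₀ broadConst trivialConst C′ : ℕ
          c₀ = 4 * (p¹ * p¹ * (suc n₂ * suc n₂ * (p¹ * p¹)))
          broadConst = (c₀ ^ V) ^ q * (gainConst n * p ^ ((n * k + 1) * H))
          trivialConst = p ^ (2 * H * s * q)
          C′ = trivialConst + broadConst

          -- As p ≥ 4 and s ≥ 3, the constant 4 p² fits into p^s, the loss permitted for one scale;
          -- so nothing accumulates over many narrow steps.
          narrow-loss : ∀ X → 4 * (p¹ * p¹ * X) ≤ p ^ s * X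
          narrow-loss X = ≤-trans (≤-reflexive (lem p¹ X)) (*-monoˡ-≤ X (≤-trans
            (*-mono-≤ 4≤p (≤-reflexive (sym (^-distribˡ-+-* p 1 1)))) (p^-mono {3} {s} (+-mono-≤ {2} {k} {1} {tri k′} (s≤s (s≤s z≤n)) (s≤s z≤n)))))
            where
            lem : ∀ p X → 4 * (p * p * X) ≡ 4 * (p * p) * X
            lem = solve-∀

        -- Recursion on N: a narrow step rescales a class modulo p and lowers N by one with the same
        -- constant, a broad step ends the recursion, and N ≤ H is absorbed into the constant.
        improved : Decouples k q m₁ C′
        improved {N} {pos} {φ} {S} {L} D B conf hyp = at N conf hyp
          where
          open ≤-Reasoning
          E = s * q + m₁
          at : ∀ N {pos φ S} → Confined k N pos φ S L →
            (∀ {S₀ ζ} → S₀ ⊆ S → Located pos N ζ S₀ → D * mean S₀ s L ^ q ≤ B) → D * mean S s L ^ q ≤ C′ * p ^ (E * N) * B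
          large : ∀ N {pos φ S} → Confined k (suc N) pos φ S L →
            (∀ {S₀ ζ} → S₀ ⊆ S → Located pos (suc N) ζ S₀ → D * mean S₀ s L ^ q ≤ B) → H ≤ suc N →
            D * mean S s L ^ q ≤ C′ * p ^ (E * suc N) * B
          small : ∀ N {pos φ S} → Confined k N pos φ S L →
            (∀ {S₀ ζ} → S₀ ⊆ S → Located pos N ζ S₀ → D * mean S₀ s L ^ q ≤ B) → N ≤ H → D * mean S s L ^ q ≤ C′ * p ^ (E * N) * B
          small N {pos} conf hyp N≤H = ≤-trans (decouples-trivial k q N pos D B (s≤s z≤n) hyp) (*-monoˡ-≤ B (begin
            p ^ (2 * N * s * q)       ≤⟨ p^-mono (*-monoˡ-≤ q (*-monoˡ-≤ s (*-monoʳ-≤ 2 N≤H))) ⟩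
            trivialConst              ≤⟨ m≤m+n trivialConst broadConst ⟩
            C′                        ≤⟨ m≤m*n C′ (p ^ (E * N)) {{m^n≢0 p (E * N)}} ⟩
            C′ * p ^ (E * N)          ∎))
          at zero conf hyp = small 0 conf hyp z≤n
          at (suc N) conf hyp = [ large N conf hyp , small (suc N) conf hyp ]′ (≤-total H (suc N))
          large N {pos} {φ} {S} conf hyp H≤N = [ narrow , broad ]′
            (M.narrow-or-broad (residue pos 1) p¹ S L n₂ c₀ (m^n>0 p 1) (All.tabulate (λ {i} _ → residue< pos 1 i)) refl)
            where
            Q = mean S s L
            narrow : ∃ (λ ζ → Q ≤ 4 * (p¹ * p¹ * mean (class (residue pos 1) ζ S) s L)) → D * Q ^ q ≤ C′ * p ^ (E * suc N) * B
            narrow (ζ , Q≤) = begin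
              D * Q ^ q                    ≤⟨ *-monoʳ-≤ D (^-monoˡ-≤ q (≤-trans Q≤ (narrow-loss Y))) ⟩
              D * (p ^ s * Y) ^ q          ≡⟨ cong (D *_) (trans (distrib-^-* (p ^ s) Y q) (cong (_* Y ^ q) (^-*-assoc p s q))) ⟩
              D * (p ^ (s * q) * Y ^ q)    ≡⟨ lem₁ D (p ^ (s * q)) (Y ^ q) ⟩
              p ^ (s * q) * (D * Y ^ q)    ≤⟨ *-mono-≤ (p^-mono (m≤m+n (s * q) m₁)) piece ⟩
              p ^ E * (C′ * p ^ (E * N) * B)
                ≡⟨ lem₂ (p ^ E) C′ (p ^ (E * N)) B ⟩
              C′ * (p ^ E * p ^ (E * N)) * B
                ≡⟨ cong (λ z → C′ * z * B) (trans (sym (^-distribˡ-+-* p E (E * N))) (cong (p ^_) (sym (*-suc E N)))) ⟩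
              C′ * p ^ (E * suc N) * B     ∎
              where
              S₁ = class (residue pos 1) ζ S
              Y = mean S₁ s L
              loc₁ = residue-located pos 1 (class-all (residue pos 1) ζ S)
              sub₁ = class-⊆ (residue pos 1) ζ S
              piece : D * Y ^ q ≤ C′ * p ^ (E * N) * B
              piece = at N (proj₂ (confined-rescale conf sub₁ loc₁ ≤-refl (s≤s z≤n)))
                (λ S₀⊆ loc₀ → hyp (⊆-trans S₀⊆ sub₁) (located-nested pos 1 (int ζ) {N = suc N} loc₁ S₀⊆ (s≤s z≤n) loc₀))
              lem₁ : ∀ d x y → d * (x * y) ≡ x * (d * y)
              lem₁ = solve-∀
              lem₂ : ∀ x c y b → x * (c * y * b) ≡ c * (x * y) * b
              lem₂ = solve-∀
            broad : (∃₂ λ ξ ζ → ξ ≢ ζ × ∃ λ J → J ⊆ S × All (λ i → residue pos 1 i ≡ ζ) J ×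
              Q ≤ c₀ ^ suc n₂ * mixed (lst (class (residue pos 1) ξ S)) (lst J) L 1 (suc n₂)) → D * Q ^ q ≤ C′ * p ^ (E * suc N) * B
            broad (ξ , ζ , ξ≢ζ , J , J⊆ , allJ , Q≤) = begin
              D * Q ^ q                    ≤⟨ *-monoʳ-≤ D (^-monoˡ-≤ q Q≤) ⟩
              D * (c₀ ^ V * K₁) ^ q        ≡⟨ cong (D *_) (distrib-^-* (c₀ ^ V) K₁ q) ⟩
              D * ((c₀ ^ V) ^ q * K₁ ^ q)  ≡⟨ lem₁ D ((c₀ ^ V) ^ q) (K₁ ^ q) ⟩
              (c₀ ^ V) ^ q * (D * K₁ ^ q)  ≤⟨ *-monoʳ-≤ ((c₀ ^ V) ^ q) (broad-bound D B conf hyp H≤N I J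
                                                (class-⊆ (residue pos 1) ξ S) J⊆ (class-all (residue pos 1) ξ S) allJ ξ≢ζ) ⟩
              (c₀ ^ V) ^ q * (gainConst n * p ^ ((n * k + 1) * H) * p ^ (E * suc N) * B)
                ≡⟨ lem₂ ((c₀ ^ V) ^ q) (gainConst n * p ^ ((n * k + 1) * H)) (p ^ (E * suc N)) B ⟩
              broadConst * p ^ (E * suc N) * B
                ≤⟨ *-monoˡ-≤ B (*-monoˡ-≤ (p ^ (E * suc N)) (m≤n+m broadConst trivialConst)) ⟩
              C′ * p ^ (E * suc N) * B     ∎
              where
              I = class (residue pos 1) ξ S
              K₁ = mixed (lst I) (lst J) L 1 V
              lem₁ : ∀ d x y → d * (x * y) ≡ x * (d * y)
              lem₁ = solve-∀
              lem₂ : ∀ x g y b → x * (g * y * b) ≡ x * g * y * b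
              lem₂ = solve-∀

        improvement : ∃ λ C → Decouples k q m₁ C
        improvement = C′ , improved

    -- Applied to the q′-th powers of `D` and `B`, the loss q′ / (q q′) per scale becomes 1 / q.
    decouples-root : ∀ k q q′ C → 1 ≤ q′ → Decouples k (q * q′) q′ C → Decouples k q 1 (suc C)
    decouples-root k q q′ C 1≤q′ dec {N} {S = S} {L} D B conf hyp = ^-cancelʳ-≤ q′ 1≤q′ (begin
      (D * Q ^ q) ^ q′                                  ≡⟨ root D Q ⟩
      D ^ q′ * Q ^ (q * q′)                             ≤⟨ dec (D ^ q′) (B ^ q′) conf (λ {S₀} S₀⊆ loc → ≤-trans
                                                             (≤-reflexive (sym (root D (mean S₀ (tri k) L)))) (^-monoˡ-≤ q′ (hyp S₀⊆ loc))) ⟩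
      C * p ^ ((tri k * (q * q′) + q′) * N) * B ^ q′    ≤⟨ *-monoˡ-≤ (B ^ q′) (*-mono-≤ C≤ (≤-reflexive
                                                             (trans (cong (p ^_) (lem (tri k) q q′ N)) (sym (^-*-assoc p ((tri k * q + 1) * N) q′))))) ⟩
      suc C ^ q′ * (p ^ ((tri k * q + 1) * N)) ^ q′ * B ^ q′
        ≡⟨ trans (distrib-^-* (suc C * p ^ ((tri k * q + 1) * N)) B q′) (cong (_* B ^ q′) (distrib-^-* (suc C) _ q′)) ⟨
      (suc C * p ^ ((tri k * q + 1) * N) * B) ^ q′      ∎)
      where
      open ≤-Reasoning
      Q = mean S (tri k) L
      root : ∀ D Q → (D * Q ^ q) ^ q′ ≡ D ^ q′ * Q ^ (q * q′)
      root D Q = trans (distrib-^-* D (Q ^ q) q′) (cong (D ^ q′ *_) (^-*-assoc Q q q′))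
      C≤ : C ≤ suc C ^ q′
      C≤ = ≤-trans (n≤1+n C) (≤-trans (≤-reflexive (sym (^-identityʳ (suc C)))) (^-monoʳ-≤ (suc C) 1≤q′))
      lem : ∀ s q q′ N → (s * (q * q′) + q′) * N ≡ (s * q + 1) * N * q′
      lem = solve-∀

    private
      uniform : ∀ {Q : ℕ → ℕ → Set} → (∀ {r C C′} → C ≤ C′ → Q r C → Q r C′) → ∀ k → (∀ r → r < k → ∃ (Q r)) →
        ∃ λ C → 1 ≤ C × (∀ r → r < k → Q r C)
      uniform weaken zero f = 1 , ≤-refl , λ r ()
      uniform {Q} weaken (suc k) f with uniform {Q} weaken k (λ r r<k → f r (m≤n⇒m≤1+n r<k)) | f k ≤-refl
      ... | C , 1≤C , all | C′ , last = C + C′ , ≤-trans 1≤C (m≤m+n C C′) , λ r r≤k → either (m<1+n⇒m<n∨m≡n r≤k)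
        where
        either : ∀ {r} → r < k ⊎ r ≡ k → Q r (C + C′)
        either (inj₁ r<k) = weaken (m≤m+n C C′) (all _ r<k)
        either (inj₂ refl) = weaken (m≤n+m C′ C) last

    -- The root q is quantified inside the induction, because degree k with root q* calls all lower
    -- degrees with the larger root q* q′.
    decouples : ∀ k → 1 ≤ k → k < p → ∀ q → 1 ≤ q → ∃ λ C → Decouples k q 1 C
    decouples = <-rec (λ k → 1 ≤ k → k < p → ∀ q → 1 ≤ q → ∃ λ C → Decouples k q 1 C) induct
      where
      induct : ∀ k → (∀ {r} → r < k → 1 ≤ r → r < p → ∀ q → 1 ≤ q → ∃ λ C → Decouples r q 1 C) →
        1 ≤ k → k < p → ∀ q → 1 ≤ q → ∃ λ C → Decouples k q 1 C
      induct 1 _ _ _ q _ = 1 , decouples-1 q 1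
      induct k@(suc (suc k₂)) ih _ k<p q* 1≤q* = suc (proj₁ final) , decouples-root k q* q′ (proj₁ final) 1≤q′ (proj₂ final)
        where
        -- q, q′ and n depend on `k₂` and `q*` alone, so they are fixed before m starts to descend.
        module Params = Step k₂ q* 0 0 1 1≤q* k<p ≤-refl
        s = tri k
        q = Params.q
        q′ = Params.q′
        1≤q′ : 1 ≤ q′
        1≤q′ = *-mono-≤ {1} {Params.n * k + 1} {1} {k ^ suc Params.n} (m≤n+m 1 (Params.n * k)) (^-pos (suc Params.n) (s≤s z≤n))
        1≤q : 1 ≤ q
        1≤q = *-mono-≤ {1} {q*} {1} {q′} 1≤q* 1≤q′
        lowers = uniform {λ r C → 1 ≤ r → Decouples r q 1 C} (λ {r} {C} {C′} le dec lo → decouples-weaken {r} {q} {1} {C} {C′} le (dec lo)) k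
          (λ { zero _ → 0 , λ () ; r@(suc _) r<k → let C , dec = ih r<k (s≤s z≤n) (<-trans r<k k<p) q 1≤q in C , λ _ → dec })
        -- The descent ends at m = q′, the last value reached from an m to which `exponent-budget`
        -- applies; there the loss is q′ / q = 1 / q*.
        descend : ∀ d → ∃ (λ C → Decouples k q (q′ + d) C) → ∃ (λ C → Decouples k q q′ C)
        descend zero (C , dec) = C , subst (λ m → Decouples k q m C) (+-identityʳ q′) dec
        descend (suc d) (C , dec) = descend d (S.Proof.improvement (m≤n⇒m≤1+n (m≤m+n q′ d))
          (subst (λ m → Decouples k q m C) (+-suc q′ d) dec) (λ r lo r<k → proj₂ (proj₂ lowers) r r<k lo))
          where
          module S = Step k₂ q* (q′ + d) C (proj₁ lowers) 1≤q* k<p (proj₁ (proj₂ lowers))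
        q′≤sq : q′ ≤ s * q
        q′≤sq = ≤-trans (m≤n*m q′ q* {{>-nonZero 1≤q*}}) (m≤n*m q s)
        trivial : Decouples k q (q′ + (s * q ∸ q′)) 1
        trivial {N} {pos} D B conf hyp = ≤-trans (decouples-trivial k q N pos D B (s≤s z≤n) hyp)
          (*-monoˡ-≤ B (≤-reflexive (trans (cong (p ^_) (trans (lem N s q) (cong (λ z → (s * q + z) * N) (sym (m+[n∸m]≡n q′≤sq)))))
            (sym (*-identityˡ _)))))
          where
          lem : ∀ N s q → 2 * N * s * q ≡ (s * q + s * q) * N
          lem = solve-∀
        final = descend (s * q ∸ q′) (1 , trivial)

-- From decoupling to the number of solutions up to M.

module SolutionCounting where

  open import Algebra.Structures using (IsAbelianGroup; IsMonoid)
  import Data.Integer as ℤ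
  open import Data.Integer using (ℤ) renaming (+_ to int)
  import Data.Integer.Properties as ℤ
  open import Data.Integer.Divisibility.Signed using (divides; ∣m∣n⇒∣m-n)
  import Data.Integer.Divisibility.Signed as ℤ
  import Data.Integer.Tactic.RingSolver as ℤS
  open import Data.Fin using (Fin; toℕ; fromℕ<)
  open import Data.Fin.Properties using (toℕ-fromℕ<; toℕ<n)
  open import Data.List using (List; []; _∷_; _++_; length; map; downFrom; cartesianProduct; cartesianProductWith)
  open import Data.List.Properties using (length-map; length-downFrom)
  open import Data.List.Membership.Propositional using (_∈_)
  open import Data.List.Membership.Propositional.Properties
    using (∈-∃++; ∈-++⁺ˡ; ∈-++⁺ʳ; ∈-++⁻; ∈-map⁺; ∈-map⁻; ∈-downFrom⁺; ∈-downFrom⁻; ∈-cartesianProduct⁺; ∈-cartesianProductWith⁺)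
  open import Data.List.Relation.Binary.Sublist.Propositional using (_⊆_; []; _∷_; _∷ʳ_; lookup)
  open import Data.List.Relation.Binary.Sublist.Propositional.Properties using (All-resp-⊆)
  open import Data.List.Relation.Unary.All as All using ([]; _∷_)
  open import Data.List.Relation.Unary.AllPairs using ([]; _∷_)
  open import Data.List.Relation.Unary.Any using (here; there)
  open import Data.List.Relation.Unary.Unique.Propositional using (Unique)
  import Data.List.Relation.Unary.Unique.Propositional.Properties as Unique
  open import Data.Nat
  open import Data.Nat.Divisibility using (∣⇒≤; ∣m+n∣m⇒∣n; ∣-trans; m∣m*n)
  import Data.Nat.Divisibility as ℕ
  open import Data.Nat.ListAction using (product)
  open import Data.Nat.Primality using (Prime; prime⇒nonTrivial)
  open import Data.Nat.Primality.Factorisation using (factorise)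
  open import Data.Nat.Properties
  open import Data.Nat.Tactic.RingSolver using (solve-∀)
  open import Data.Product using (∃; _×_; _,_; proj₁; proj₂)
  open import Data.Sum using (inj₁; inj₂)
  open import Data.Vec as Vec using (Vec; []; _∷_)
  import Data.Vec.Properties as Vec
  open import Data.Vec.Relation.Unary.All as VAll using ([]; _∷_)
  open import Relation.Binary.PropositionalEquality
  open import Relation.Binary.PropositionalEquality.Algebra using (isMagma)
  open import Relation.Nullary using (yes; no; contradiction)
  open import Defs using (powerSum)
  open ConfinedSets
  open Curves using (con; ap)
  open GroupSemirings
  open DecouplingInduction
  open MeanValues
  open PowerInequalities

  private
    ∃-prime : ∀ n → 1 ≤ n → ∃ λ p → Prime p × n < p
    ∃-prime n 1≤n with factorise (suc (n !))
    ... | record { factors = [] ; isFactorisation = eq } = contradiction (suc-injective eq) (≢-nonZero⁻¹ (n !) {{n !≢0}})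
    ... | record { factors = p ∷ ps ; isFactorisation = eq ; factorsPrime = p-prime ∷ _ } = p , p-prime , ≰⇒> λ p≤n →
      let p∣n! = ℕ.∣-trans (divides! p p>0) (ℕ.m≤n⇒m!∣n! p≤n)
          p∣1 = ∣m+n∣m⇒∣n (subst (p ℕ.∣_) (trans (sym eq) (+-comm 1 (n !))) (m∣m*n (product ps))) p∣n!
      in contradiction (∣⇒≤ p∣1) (<⇒≱ (nonTrivial⇒n>1 p {{prime⇒nonTrivial p-prime}}))
      where
      p>0 : 1 ≤ p
      p>0 = <⇒≤ (nonTrivial⇒n>1 p {{prime⇒nonTrivial p-prime}})
      divides! : ∀ p → 1 ≤ p → p ℕ.∣ p !
      divides! (suc p) _ = m∣m*n (p !)

  module PowerVectors (k : ℕ) where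

    _∙_ : Vec ℤ k → Vec ℤ k → Vec ℤ k
    _∙_ = Vec.zipWith ℤ._+_

    ε : Vec ℤ k
    ε = Vec.replicate k ℤ.0ℤ

    isAbelianGroup : IsAbelianGroup _≡_ _∙_ ε (Vec.map (ℤ.-_))
    isAbelianGroup = record
      { isGroup = record
        { isMonoid = record
          { isSemigroup = record
            { isMagma = isMagma _∙_
            ; assoc = Vec.zipWith-assoc ℤ.+-assoc }
          ; identity = Vec.zipWith-identityˡ ℤ.+-identityˡ , Vec.zipWith-identityʳ ℤ.+-identityʳ }
        ; inverse = Vec.zipWith-inverseˡ ℤ.+-inverseˡ , Vec.zipWith-inverseʳ ℤ.+-inverseʳ
        ; ⁻¹-cong = cong _ }
      ; comm = Vec.zipWith-comm ℤ.+-comm }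

    powers : ℤ → Vec ℤ k
    powers x = Vec.tabulate (λ j → x ℤ.^ suc (toℕ j))

    vec-ext : ∀ {v w : Vec ℤ k} → (∀ j → Vec.lookup v j ≡ Vec.lookup w j) → v ≡ w
    vec-ext {v} {w} eq = trans (sym (Vec.tabulate∘lookup v)) (trans (Vec.tabulate-cong eq) (Vec.tabulate∘lookup w))

    isMonoid : IsMonoid _≡_ _∙_ ε
    isMonoid = IsAbelianGroup.isMonoid isAbelianGroup

    private module GS = GroupSemiring _∙_ ε (Vec.map (ℤ.-_)) isAbelianGroup (Vec.≡-dec ℤ._≟_)
    open GS public using (groupTrace; κ; κ-refl; ∑-⋆; τ-inner)
    private module M = Means isMonoid groupTrace powers
    open M public using (mean; mean-+; mean-[]; mean-singleton; lst; total; 1#)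

    vtotal : ∀ {s} → Vec ℤ s → Vec ℤ k
    vtotal [] = ε
    vtotal (x ∷ v) = powers x ∙ vtotal v

    lookup-vtotal : ∀ {s} (v : Vec ℤ s) j → Vec.lookup (vtotal v) j ≡ powerSum (suc (toℕ j)) v
    lookup-vtotal [] j = Vec.lookup-replicate j ℤ.0ℤ
    lookup-vtotal (x ∷ v) j = trans (Vec.lookup-zipWith ℤ._+_ j (powers x) (vtotal v))
      (cong₂ ℤ._+_ (Vec.lookup∘tabulate (λ j → x ℤ.^ suc (toℕ j)) j) (lookup-vtotal v j))

    tuples : List ℤ → ∀ s → List (Vec ℤ s)
    tuples S zero = [] ∷ []
    tuples S (suc s) = cartesianProductWith _∷_ S (tuples S s)

    ∈-tuples : ∀ {S s} {v : Vec ℤ s} → VAll.All (_∈ S) v → v ∈ tuples S s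
    ∈-tuples [] = here refl
    ∈-tuples (x∈ ∷ v∈) = ∈-cartesianProductWith⁺ _∷_ x∈ (∈-tuples v∈)

    private
      ∑-lst : ∀ S w → ∑ (lst S) w ≡ ∑ S (λ x → w (powers x))
      ∑-lst [] w = refl
      ∑-lst (x ∷ S) w = cong (w (powers x) +_) (∑-lst S w)

      ∑-cartesianProductWith : ∀ {A B C : Set} (f : A → B → C) xs ys w → ∑ (cartesianProductWith f xs ys) w ≡ ∑ xs (λ x → ∑ ys (λ y → w (f x y)))
      ∑-cartesianProductWith f [] ys w = refl
      ∑-cartesianProductWith f (x ∷ xs) ys w = trans (∑-++ (map (f x) ys) _ w) (cong₂ _+_ (∑-map (f x) ys w) (∑-cartesianProductWith f xs ys w))

      ∑-power : ∀ S s w → ∑ (lst S M.^ s) w ≡ ∑ (tuples S s) (λ v → w (vtotal v))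
      ∑-power S zero w = refl
      ∑-power S (suc s) w = trans (∑-⋆ (lst S) (lst S M.^ s) w) (trans (∑-lst S _)
        (trans (∑-cong S (λ x → ∑-power S s (λ y → w (powers x ∙ y)))) (sym (∑-cartesianProductWith _∷_ S (tuples S s) _))))

    mean-counts : ∀ S s → mean S s 1# ≡ ∑ (cartesianProduct (tuples S s) (tuples S s)) (λ (x , y) → κ (vtotal x) (vtotal y))
    mean-counts S s = trans (M.mean-1# S s)
      (trans (τ-inner (lst S M.^ s) (lst S M.^ s)) (trans (∑-power S s _)
      (trans (∑-cong (tuples S s) (λ x → ∑-power S s (κ (vtotal x)))) (sym (∑-cartesianProductWith _,_ (tuples S s) (tuples S s) _)))))

  private
    ∑-unique-⊆ : ∀ {A : Set} {xs} (ys : List A) w → Unique xs → (∀ {x} → x ∈ xs → x ∈ ys) → ∑ xs w ≤ ∑ ys w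
    ∑-unique-⊆ {xs = []} ys w _ _ = z≤n
    ∑-unique-⊆ {xs = x ∷ xs} ys w (x∉ ∷ unique) sub with ∈-∃++ (sub (here refl))
    ... | as , bs , refl = ≤-trans (+-monoʳ-≤ (w x) (∑-unique-⊆ (as ++ bs) w unique sub′)) (≤-reflexive (sym
      (trans (∑-++ as (x ∷ bs) w) (trans (lem (∑ as w) (w x) (∑ bs w)) (cong (w x +_) (sym (∑-++ as bs w)))))))
      where
      lem : ∀ a b c → a + (b + c) ≡ b + (a + c)
      lem = solve-∀
      sub′ : ∀ {y} → y ∈ xs → y ∈ as ++ bs
      sub′ {y} y∈ with ∈-++⁻ as (sub (there y∈))
      ... | inj₁ p = ∈-++⁺ˡ p
      ... | inj₂ (here refl) = contradiction refl (All.lookup x∉ y∈)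
      ... | inj₂ (there p) = ∈-++⁺ʳ as p

    ∑-ones : ∀ {A : Set} (xs : List A) w → (∀ {x} → x ∈ xs → w x ≡ 1) → ∑ xs w ≡ length xs
    ∑-ones [] w _ = refl
    ∑-ones (x ∷ xs) w one = cong₂ _+_ (one (here refl)) (∑-ones xs w (λ x∈ → one (there x∈)))

    -- Embeds 1, ..., M into a full residue system modulo p ^ N at the bounded cost p.
    scale : ∀ p M → 2 ≤ p → 1 ≤ M → ∃ λ N → M < p ^ N × p ^ N ≤ p * M
    scale p 1 2≤p _ = 1 , subst (1 <_) (sym (^-identityʳ p)) 2≤p , ≤-refl
    scale p (suc M@(suc _)) 2≤p _ with scale p M 2≤p (s≤s z≤n)
    ... | N , M< , ≤pM with suc M <? p ^ N
    ...   | yes lt = N , lt , ≤-trans ≤pM (*-monoʳ-≤ p (n≤1+n M))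
    ...   | no ≮ = suc N , subst (λ z → suc M < p * z) p^N≡ (m<m*n′ 2≤p) , ≤-reflexive (cong (p *_) (sym p^N≡))
      where
      p^N≡ : suc M ≡ p ^ N
      p^N≡ = ≤-antisym M< (≮⇒≥ ≮)
      m<m*n′ : 2 ≤ p → suc M < p * suc M
      m<m*n′ 2≤p = ≤-trans (≤-trans (s≤s (s≤s (m≤n+m M M))) (≤-reflexive (lem M))) (*-monoˡ-≤ (suc M) 2≤p)
        where
        lem : ∀ M → suc (suc (M + M)) ≡ 2 * suc M
        lem = solve-∀

  Solves : ∀ {s} → ℕ → ℕ → Vec ℤ s × Vec ℤ s → Set
  Solves k M (x , y) = (∀ j → 1 ≤ j → j ≤ k → powerSum j x ≡ powerSum j y) × VAll.All Bounded x × VAll.All Bounded y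
    where
    Bounded : ℤ → Set
    Bounded a = ∃ λ r → a ≡ int r × r ≤ M

  -- The bound M^(2 s - tri k + 1 / q), up to a constant, with the root and the negative exponent
  -- cleared. It concerns any duplicate-free list of solutions.
  MeanValueBound : ℕ → ℕ → ℕ → ℕ → Set
  MeanValueBound s k q C = ∀ M → 1 ≤ M → (xs : List (Vec ℤ s × Vec ℤ s)) → Unique xs → (∀ {z} → z ∈ xs → Solves k M z) →
    length xs ^ q * M ^ (tri k * q) ≤ C * M ^ (2 * s * q + 1)

  private
    positive-constant : ∀ {s k q} → ∃ (MeanValueBound s k q) → ∃ λ C → 1 ≤ C × MeanValueBound s k q C
    positive-constant {s} {k} {q} (C , bound) = suc C , s≤s z≤n , λ M 1≤M xs unique sol →
      ≤-trans (bound M 1≤M xs unique sol) (*-monoˡ-≤ (M ^ (2 * s * q + 1)) (n≤1+n C))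

  module Count (s k q : ℕ) (1≤k : 1 ≤ k) (k≤s : tri k ≤ s) (1≤q : 1 ≤ q) where

    private
      -- p > k makes k! a unit, and p ≥ 4 serves `narrow-loss`.
      bigPrime = ∃-prime (k + 4) (≤-trans 1≤k (m≤m+n k 4))
      p = proj₁ bigPrime
      p-prime = proj₁ (proj₂ bigPrime)
      k+4<p = proj₂ (proj₂ bigPrime)
      open PowerVectors k
      4≤p : 4 ≤ p
      4≤p = ≤-trans (m≤n+m 4 k) (<⇒≤ k+4<p)
      module I = Improvement isMonoid groupTrace powers p p-prime 4≤p
      module Cf = Confinement isMonoid groupTrace powers p p-prime
      decoupled = I.decouples k 1≤k (≤-trans (s≤s (m≤m+n k 4)) k+4<p) q 1≤q
      C = proj₁ decoupled

      range : ℕ → List ℤ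
      range N = map int (downFrom (p ^ N))

      length-range : ∀ N → length (range N) ≡ p ^ N
      length-range N = trans (length-map int (downFrom (p ^ N))) (length-downFrom (p ^ N))

      -- With trivial weight a coincidence is an equality of all power sums, so the differences
      -- vanish and are divisible by any modulus.
      range-confined : ∀ N → Cf.Confined k N (λ x → x) (λ _ → con ℤ.0ℤ) (range N) 1#
      range-confined N = Cf.confined confines
        where
        sum-curve : ∀ j xs → Cf.sumℤ (λ x → Cf.curve (λ _ → con ℤ.0ℤ) (suc (toℕ j)) x) xs ≡ Vec.lookup (total xs) j
        sum-curve j [] = sym (Vec.lookup-replicate j ℤ.0ℤ)
        sum-curve j (x ∷ xs) = trans (cong₂ ℤ._+_ (trans (cong (λ z → x ℤ.^ suc (toℕ j) ℤ.+ z) (ℤ.*-zeroʳ Cf.P)) (ℤ.+-identityʳ (x ℤ.^ suc (toℕ j)))) (sum-curve j xs))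
          (sym (trans (Vec.lookup-zipWith ℤ._+_ j (powers x) (total xs)) (cong (ℤ._+ Vec.lookup (total xs) j) (Vec.lookup∘tabulate (λ j → x ℤ.^ suc (toℕ j)) j))))
        confines : ∀ {xs ys y y′} (tx : Cf.Tuple (tri k) (range N) xs) (ty : Cf.Tuple (tri k) (range N) ys) →
          1# Cf.∋ y → 1# Cf.∋ y′ → total xs ∙ y ≡ total ys ∙ y′ → ∀ i → 1 ≤ i → i ≤ k →
          Cf.P ℤ.^ (k * N) ℤ.∣ ap (Cf.difference (λ x → x) tx ty) (Cf.curve (λ _ → con ℤ.0ℤ) i)
        confines {xs} {ys} tx ty (here refl) (here refl) eq (suc i) _ i<k = divides ℤ.0ℤ (ℤ.i≡j⇒i-j≡0 (begin
          Cf.sumℤ (Cf.curve (λ _ → con ℤ.0ℤ) (suc i)) xs              ≡⟨ cong (λ z → Cf.sumℤ (Cf.curve (λ _ → con ℤ.0ℤ) (suc z)) xs) (toℕ-fromℕ< i<k) ⟨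
          Cf.sumℤ (Cf.curve (λ _ → con ℤ.0ℤ) (suc (toℕ j))) xs        ≡⟨ sum-curve j xs ⟩
          Vec.lookup (total xs) j                                   ≡⟨ cong (λ z → Vec.lookup z j) totals ⟩
          Vec.lookup (total ys) j                                   ≡⟨ sum-curve j ys ⟨
          Cf.sumℤ (Cf.curve (λ _ → con ℤ.0ℤ) (suc (toℕ j))) ys        ≡⟨ cong (λ z → Cf.sumℤ (Cf.curve (λ _ → con ℤ.0ℤ) (suc z)) ys) (toℕ-fromℕ< i<k) ⟩
          Cf.sumℤ (Cf.curve (λ _ → con ℤ.0ℤ) (suc i)) ys              ∎))
          where
          open ≡-Reasoning
          j = fromℕ< i<k
          totals : total xs ≡ total ys
          totals = trans (sym (IsMonoid.identityʳ isMonoid (total xs))) (trans eq (IsMonoid.identityʳ isMonoid (total ys)))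

      -- A class modulo p ^ N meets the range in at most one integer, whose moment is 1; this is
      -- where the decoupling ends.
      point-mean : ∀ N {S₀ ζ} → S₀ ⊆ range N → Cf.Located (λ x → x) N ζ S₀ → 1 * mean S₀ (tri k) 1# ^ q ≤ 1
      point-mean N {S₀} {ζ} sub loc = ≤-trans (≤-reflexive (*-identityˡ _)) (≤-trans (^-monoˡ-≤ q (small S₀ sub loc)) (≤-reflexive (^-zeroˡ q)))
        where
        unique-⊆ : ∀ {xs ys : List ℤ} → xs ⊆ ys → Unique ys → Unique xs
        unique-⊆ [] [] = []
        unique-⊆ (_ ∷ʳ sub) (_ ∷ u) = unique-⊆ sub u
        unique-⊆ (refl ∷ sub) (x∉ ∷ u) = All-resp-⊆ sub x∉ ∷ unique-⊆ sub u
        tri-suc : ∀ k → 1 ≤ k → ∃ λ t → tri k ≡ suc t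
        tri-suc (suc k) _ = k + tri k , refl
        range-unique : Unique (range N)
        range-unique = Unique.map⁺ ℤ.+-injective (Unique.downFrom⁺ (p ^ N))
        same-class : ∀ {x y} → x ∈ range N → y ∈ range N → Cf.P ℤ.^ N ℤ.∣ x ℤ.- ζ → Cf.P ℤ.^ N ℤ.∣ y ℤ.- ζ → x ≡ y
        same-class x∈ y∈ dx dy with ∈-map⁻ int x∈ | ∈-map⁻ int y∈
        ... | r , r∈ , refl | r′ , r′∈ , refl = cong int (congruent-residues (∈-downFrom⁻ r∈) (∈-downFrom⁻ r′∈)
          (subst₂ ℤ._∣_ (sym (pos-^ p N)) (lem (int r) (int r′) ζ) (∣m∣n⇒∣m-n dx dy)))
          where
          lem : ∀ x y z → (x ℤ.- z) ℤ.- (y ℤ.- z) ≡ x ℤ.- y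
          lem = ℤS.solve-∀
        small : ∀ S₀ → S₀ ⊆ range N → Cf.Located (λ x → x) N ζ S₀ → mean S₀ (tri k) 1# ≤ 1
        small [] sub loc = ≤-trans (≤-reflexive (trans (cong (λ u → mean [] u 1#) (proj₂ (tri-suc k 1≤k))) (mean-[] (proj₁ (tri-suc k 1≤k)) 1#))) z≤n
        small (x ∷ []) sub loc = ≤-reflexive (mean-singleton x (tri k))
        small (x ∷ y ∷ _) sub loc with unique-⊆ sub range-unique
        ... | (x≢y ∷ _) ∷ _ = contradiction (same-class (lookup sub (here refl)) (lookup sub (there (here refl))) (loc (here refl)) (loc (there (here refl)))) x≢y

      mean-bound : ∀ N → mean (range N) s 1# ^ q ≤ C * (p ^ N) ^ (2 * (s ∸ tri k) * q + (tri k * q + 1))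
      mean-bound N = begin
        mean (range N) s 1# ^ q
          ≡⟨ cong (λ z → mean (range N) z 1# ^ q) (m∸n+n≡m k≤s) ⟨
        mean (range N) (v + tri k) 1# ^ q
          ≤⟨ ^-monoˡ-≤ q (mean-+ (range N) v (tri k) 1#) ⟩
        ((length (range N) * length (range N)) ^ v * mean (range N) (tri k) 1#) ^ q
          ≡⟨ cong (λ l → ((l * l) ^ v * Y) ^ q) (length-range N) ⟩
        ((P * P) ^ v * Y) ^ q
          ≡⟨ trans (distrib-^-* ((P * P) ^ v) Y q) (cong (_* Y ^ q) square) ⟩
        P ^ (2 * v * q) * Y ^ q
          ≤⟨ *-monoʳ-≤ (P ^ (2 * v * q)) (≤-trans (≤-reflexive (sym (*-identityˡ _)))
               (≤-trans (proj₂ decoupled 1 1 (range-confined N) (λ {S₀} {ζ} → point-mean N {S₀} {ζ})) (≤-reflexive (*-identityʳ _)))) ⟩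
        P ^ (2 * v * q) * (C * p ^ ((tri k * q + 1) * N))
          ≡⟨ cong (λ z → P ^ (2 * v * q) * (C * z)) (trans (cong (p ^_) (*-comm (tri k * q + 1) N)) (sym (^-*-assoc p N _))) ⟩
        P ^ (2 * v * q) * (C * P ^ (tri k * q + 1))
          ≡⟨ lem (P ^ (2 * v * q)) C (P ^ (tri k * q + 1)) ⟩
        C * (P ^ (2 * v * q) * P ^ (tri k * q + 1))
          ≡⟨ cong (C *_) (^-distribˡ-+-* P (2 * v * q) (tri k * q + 1)) ⟨
        C * P ^ (2 * v * q + (tri k * q + 1)) ∎
        where
        open ≤-Reasoning
        v = s ∸ tri k
        P = p ^ N
        Y = mean (range N) (tri k) 1#
        lem : ∀ a c b → a * (c * b) ≡ c * (a * b)
        lem = solve-∀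
        square : ((P * P) ^ v) ^ q ≡ P ^ (2 * v * q)
        square = trans (cong (λ z → ((P * z) ^ v) ^ q) (sym (*-identityʳ P))) (trans (cong (_^ q) (^-*-assoc P 2 v)) (^-*-assoc P (2 * v) q))

    bound : MeanValueBound s k q (C * p ^ (2 * (s ∸ tri k) * q + (tri k * q + 1)))
    bound M 1≤M xs unique sol with scale p M (≤-trans (s≤s (s≤s z≤n)) 4≤p) 1≤M
    ... | N , M< , ≤pM = begin
      length xs ^ q * M ^ (tri k * q)
        ≤⟨ *-monoˡ-≤ (M ^ (tri k * q)) (^-monoˡ-≤ q counted) ⟩
      mean (range N) s 1# ^ q * M ^ (tri k * q)
        ≤⟨ *-monoˡ-≤ (M ^ (tri k * q)) (≤-trans (mean-bound N) (*-monoʳ-≤ C (^-monoˡ-≤ e ≤pM))) ⟩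
      C * (p * M) ^ e * M ^ (tri k * q)
        ≡⟨ cong (λ z → C * z * M ^ (tri k * q)) (distrib-^-* p M e) ⟩
      C * (p ^ e * M ^ e) * M ^ (tri k * q)
        ≡⟨ lem C (p ^ e) (M ^ e) (M ^ (tri k * q)) ⟩
      C * p ^ e * (M ^ e * M ^ (tri k * q))
        ≡⟨ cong (C * p ^ e *_) (trans (sym (^-distribˡ-+-* M e (tri k * q))) (cong (M ^_) exponents)) ⟩
      C * p ^ e * M ^ (2 * s * q + 1) ∎
      where
      open ≤-Reasoning
      e = 2 * (s ∸ tri k) * q + (tri k * q + 1)
      lem : ∀ a b c d → a * (b * c) * d ≡ a * b * (c * d)
      lem = solve-∀
      exponents : e + tri k * q ≡ 2 * s * q + 1
      exponents = trans (lem′ (s ∸ tri k) (tri k) q) (cong (λ z → 2 * z * q + 1) (m∸n+n≡m k≤s))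
        where
        lem′ : ∀ v t q → 2 * v * q + (t * q + 1) + t * q ≡ 2 * (v + t) * q + 1
        lem′ = solve-∀
      T = tuples (range N) s
      weight : Vec ℤ s × Vec ℤ s → ℕ
      weight (x , y) = κ (vtotal x) (vtotal y)
      in-range : ∀ {v : Vec ℤ s} → VAll.All (λ a → ∃ λ r → a ≡ int r × r ≤ M) v → VAll.All (_∈ range N) v
      in-range = VAll.map λ { (r , refl , r≤M) → ∈-map⁺ int (∈-downFrom⁺ (≤-trans (s≤s r≤M) M<)) }
      same-total : ∀ {x y : Vec ℤ s} → (∀ j → 1 ≤ j → j ≤ k → powerSum j x ≡ powerSum j y) → vtotal x ≡ vtotal y
      same-total {x} {y} eq = vec-ext λ j → trans (lookup-vtotal x j)
        (trans (eq (suc (toℕ j)) (s≤s z≤n) (toℕ<n j)) (sym (lookup-vtotal y j)))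
      counted : length xs ≤ mean (range N) s 1#
      counted = subst₂ _≤_ (∑-ones xs weight one) (sym (mean-counts (range N) s))
        (∑-unique-⊆ (cartesianProduct T T) weight unique λ z∈ → let _ , bx , by = sol z∈ in
          ∈-cartesianProduct⁺ (∈-tuples (in-range bx)) (∈-tuples (in-range by)))
        where
        one : ∀ {z} → z ∈ xs → weight z ≡ 1
        one {x , y} z∈ = trans (cong (κ (vtotal x)) (sym (same-total {x} {y} (proj₁ (sol z∈))))) (κ-refl (vtotal x))

    mean-value-bound : ∃ λ C → 1 ≤ C × MeanValueBound s k q C
    mean-value-bound = positive-constant {s} {k} {q} (C * p ^ (2 * (s ∸ tri k) * q + (tri k * q + 1)) , bound)

-- Real exponents: from integer inequalities to cuts.

module RealExponents where

  import Algebra.Properties.CommutativeSemiring.Exp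
  import Algebra.Bundles
  open import Data.Integer as ℤ using (ℤ; -[1+_]) renaming (+_ to int)
  import Data.Integer.Properties as ℤ
  open import Data.Nat as ℕ using (ℕ; zero; suc; z≤n; s≤s)
  open import Data.Nat.DivMod using (m≡m%n+[m/n]*n; m%n<n; m/n*n≤m; m≥n⇒m/n>0)
  import Data.Nat.Properties as ℕ
  open import Data.Nat.Tactic.RingSolver using (solve-∀)
  open import Data.Product using (∃; _×_; _,_; proj₁; proj₂)
  open import Data.Rational
  open import Data.Rational.Properties
  open import Data.Rational.Solver using (module +-*-Solver)
  open import Data.Rational.Unnormalised as ℚᵘ using (mkℚᵘ; *≡*; *≤*)
  import Data.Rational.Unnormalised.Properties as ℚᵘ
  open import Data.Sum using (inj₁; inj₂)
  open import Data.List using (length)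
  open import Data.Vec.Relation.Unary.All as VAll using ()
  open import Function.Bundles using (Equivalence)
  open import Relation.Binary.PropositionalEquality hiding (J)
  open import Relation.Nullary using (¬_; contradiction)
  import Defs
  open Defs using (ℝ; _<ʳ_; _ʳ<_; _≤ʳ_; _+ʳ_; J; _≪X^_; _^ʳ_<_; Solution) renaming (_^_ to infixr 8 _^^_)
  open ConfinedSets using (tri)
  open SolutionCounting
  open PowerInequalities
  open +-*-Solver using (solve; _:=_) renaming (_:+_ to _⊞_; _:*_ to _⊠_; _:-_ to _⊟_)

  private
    module Exp = Algebra.Properties.CommutativeSemiring.Exp (Algebra.Bundles.CommutativeRing.commutativeSemiring +-*-commutativeRing)

    <⇒≱ : ∀ {x y : ℚ} → x < y → ¬ y ≤ x
    <⇒≱ lt le = <-irrefl refl (<-≤-trans lt le)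

  ι : ℕ → ℚ
  ι n = int n / 1

  private
    toℚᵘ-/ : ∀ n d → toℚᵘ (int n / suc d) ℚᵘ.≃ mkℚᵘ (int n) d
    toℚᵘ-/ n d = toℚᵘ-fromℚᵘ (mkℚᵘ (int n) d)

  ι-* : ∀ a b → ι (a ℕ.* b) ≡ ι a * ι b
  ι-* a b = toℚᵘ-injective (ℚᵘ.≃-trans (toℚᵘ-/ (a ℕ.* b) 0) (ℚᵘ.≃-trans (*≡* (cong (ℤ._* int 1) (ℤ.pos-* a b)))
    (ℚᵘ.≃-sym (ℚᵘ.≃-trans (toℚᵘ-homo-* (ι a) (ι b)) (ℚᵘ.*-cong (toℚᵘ-/ a 0) (toℚᵘ-/ b 0))))))

  ι-+ : ∀ a b → ι (a ℕ.+ b) ≡ ι a + ι b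
  ι-+ a b = toℚᵘ-injective (ℚᵘ.≃-trans (toℚᵘ-/ (a ℕ.+ b) 0) (ℚᵘ.≃-trans
    (*≡* (cong (ℤ._* int 1) (trans (ℤ.pos-+ a b) (cong₂ ℤ._+_ (sym (ℤ.*-identityʳ (int a))) (sym (ℤ.*-identityʳ (int b)))))))
    (ℚᵘ.≃-sym (ℚᵘ.≃-trans (toℚᵘ-homo-+ (ι a) (ι b)) (ℚᵘ.+-cong (toℚᵘ-/ a 0) (toℚᵘ-/ b 0))))))

  ι-mono-≤ : ∀ {a b} → a ℕ.≤ b → ι a ≤ ι b
  ι-mono-≤ {a} {b} le = toℚᵘ-cancel-≤ (ℚᵘ.≤-respˡ-≃ (ℚᵘ.≃-sym (toℚᵘ-/ a 0)) (ℚᵘ.≤-respʳ-≃ (ℚᵘ.≃-sym (toℚᵘ-/ b 0))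
    (*≤* (ℤ.*-monoʳ-≤-nonNeg (int 1) (ℤ.+≤+ le)))))

  ι-cancel-≤ : ∀ {a b} → ι a ≤ ι b → a ℕ.≤ b
  ι-cancel-≤ {a} {b} le with ℚᵘ.≤-respˡ-≃ (toℚᵘ-/ a 0) (ℚᵘ.≤-respʳ-≃ (toℚᵘ-/ b 0) (toℚᵘ-mono-≤ le))
  ... | *≤* le′ = ℤ.drop‿+≤+ (ℤ.*-cancelʳ-≤-pos (int a) (int b) (int 1) le′)

  ι-mono-< : ∀ {a b} → a ℕ.< b → ι a < ι b
  ι-mono-< lt = ≰⇒> λ le → contradiction (ι-cancel-≤ le) (ℕ.<⇒≱ lt)

  ι-nonNeg : ∀ n → NonNegative (ι n)
  ι-nonNeg n = nonNegative (ι-mono-≤ {0} {n} z≤n)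

  ι-pos : ∀ {n} → 1 ℕ.≤ n → Positive (ι n)
  ι-pos le = positive (ι-mono-< le)

  /-* : ∀ n d .{{_ : ℕ.NonZero d}} → (int n / d) * ι d ≡ ι n
  /-* n d@(suc d-1) = toℚᵘ-injective (ℚᵘ.≃-trans (toℚᵘ-homo-* (int n / d) (ι d)) (ℚᵘ.≃-trans (ℚᵘ.*-cong (toℚᵘ-/ n d-1) (toℚᵘ-/ d 0))
    (ℚᵘ.≃-trans (*≡* (trans (ℤ.*-identityʳ (int n ℤ.* int d)) (cong (int n ℤ.*_) (cong int (sym (ℕ.*-identityʳ d)))))) (ℚᵘ.≃-sym (toℚᵘ-/ n 0)))))

  ^^-* : ∀ x y n → (x * y) ^^ n ≡ x ^^ n * y ^^ n
  ^^-* = Exp.^-distrib-*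

  ^^-assoc : ∀ x m n → (x ^^ m) ^^ n ≡ x ^^ (m ℕ.* n)
  ^^-assoc = Exp.^-assocʳ

  ι-^ : ∀ a n → ι (a ℕ.^ n) ≡ ι a ^^ n
  ι-^ a zero = refl
  ι-^ a (suc n) = trans (ι-* a (a ℕ.^ n)) (cong (ι a *_) (ι-^ a n))

  *-mono-nonNeg : ∀ {a b c d} → 0ℚ ≤ a → a ≤ b → 0ℚ ≤ c → c ≤ d → a * c ≤ b * d
  *-mono-nonNeg {a} {b} {c} {d} 0≤a a≤b 0≤c c≤d = ≤-trans
    (*-monoʳ-≤-nonNeg c {{nonNegative 0≤c}} a≤b) (*-monoˡ-≤-nonNeg b {{nonNegative (≤-trans 0≤a a≤b)}} c≤d)

  ^^-nonNeg : ∀ {x} n → 0ℚ ≤ x → 0ℚ ≤ x ^^ n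
  ^^-nonNeg zero _ = ι-mono-≤ {0} {1} z≤n
  ^^-nonNeg (suc n) 0≤x = *-mono-nonNeg ≤-refl 0≤x ≤-refl (^^-nonNeg n 0≤x)

  ^^-mono-≤ : ∀ {x y} n → 0ℚ ≤ x → x ≤ y → x ^^ n ≤ y ^^ n
  ^^-mono-≤ zero _ _ = ≤-refl
  ^^-mono-≤ (suc n) 0≤x x≤y = *-mono-nonNeg 0≤x x≤y (^^-nonNeg n 0≤x) (^^-mono-≤ n 0≤x x≤y)

  ^^-cancel-≤ : ∀ {x y} n → 1 ℕ.≤ n → 0ℚ ≤ x → 0ℚ ≤ y → x ^^ n ≤ y ^^ n → x ≤ y
  ^^-cancel-≤ {x} {y} (suc n) _ 0≤x 0≤y le = ≮⇒≥ λ y<x → <⇒≱ (strict n y<x) le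
    where
    ^^-pos : ∀ {x} n → 0ℚ < x → 0ℚ < x ^^ n
    ^^-pos zero _ = ι-mono-< {0} {1} (s≤s z≤n)
    ^^-pos {x} (suc n) 0<x = subst (_< x * x ^^ n) (*-zeroʳ x) (*-monoʳ-<-pos x {{positive 0<x}} (^^-pos n 0<x))
    strict : ∀ n → y < x → y ^^ suc n < x ^^ suc n
    strict n y<x = ≤-<-trans (*-monoˡ-≤-nonNeg y {{nonNegative 0≤y}} (^^-mono-≤ n 0≤y (<⇒≤ y<x)))
      (*-monoˡ-<-pos (x ^^ n) {{positive (^^-pos n (≤-<-trans 0≤y y<x))}} y<x)

  -- For b = n / d the number M is the quotient of n - 1 by d. It takes the place of the integer
  -- part of X, which cannot be computed from the cuts.
  predecessor : ∀ b → 1ℚ < b → ∃ λ M → 1 ℕ.≤ M × ι M < b × (∀ r → M ℕ.< r → b ≤ ι r)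
  predecessor b@(mkℚ -[1+ _ ] _ _) 1<b = contradiction (<-trans (ι-mono-< {0} {1} (s≤s z≤n)) 1<b) (<-asym (negative⁻¹ b))
  predecessor b@(mkℚ (int n) d-1 _) 1<b = M , m≥n⇒m/n>0 d≤ , below , above
    where
    d = suc d-1
    bd : b * ι d ≡ ι n
    bd = trans (cong (_* ι d) (sym (↥p/↧p≡p b))) (/-* n d)
    instance
      ιd-pos : Positive (ι d)
      ιd-pos = ι-pos {d} (s≤s z≤n)
      ιd-nonNeg : NonNegative (ι d)
      ιd-nonNeg = ι-nonNeg d
    d<n : d ℕ.< n
    d<n = ℕ.≰⇒> λ n≤d → <⇒≱ (subst₂ _<_ (*-identityˡ (ι d)) bd (*-monoˡ-<-pos (ι d) 1<b)) (ι-mono-≤ n≤d)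
    n-1 = ℕ.pred n
    n≡ : suc n-1 ≡ n
    n≡ = ℕ.suc-pred n {{ℕ.>-nonZero (ℕ.≤-trans (s≤s z≤n) d<n)}}
    d≤ : d ℕ.≤ n-1
    d≤ = ℕ.≤-pred (subst (d ℕ.<_) (sym n≡) d<n)
    M = n-1 ℕ./ d
    below : ι M < b
    below = *-cancelʳ-<-nonNeg (ι d) (subst₂ _<_ (ι-* M d) (sym bd) (ι-mono-< (subst (M ℕ.* d ℕ.<_) n≡ (s≤s (m/n*n≤m n-1 d)))))
    above : ∀ r → M ℕ.< r → b ≤ ι r
    above r M<r = *-cancelʳ-≤-pos (ι d) (subst₂ _≤_ (sym bd) (ι-* r d) (ι-mono-≤ (subst (ℕ._≤ r ℕ.* d) n≡
      (ℕ.≤-trans (subst (ℕ._< suc M ℕ.* d) (sym (m≡m%n+[m/n]*n n-1 d)) (ℕ.+-monoˡ-< (M ℕ.* d) (m%n<n n-1 d))) (ℕ.*-monoˡ-≤ d M<r)))))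

  2tri : ∀ k → 2 ℕ.* tri k ≡ k ℕ.* (k ℕ.+ 1)
  2tri zero = refl
  2tri (suc k) = trans (lem k (tri k)) (trans (cong (2 ℕ.* suc k ℕ.+_) (2tri k)) (lem′ k))
    where
    lem : ∀ k t → 2 ℕ.* (suc k ℕ.+ t) ≡ 2 ℕ.* suc k ℕ.+ 2 ℕ.* t
    lem = solve-∀
    lem′ : ∀ k → 2 ℕ.* suc k ℕ.+ k ℕ.* (k ℕ.+ 1) ≡ suc k ℕ.* (suc k ℕ.+ 1)
    lem′ = solve-∀

  -- Twice the difference is (k - 1) (k - 2), which is j² + j for k = 2 + j.
  tri≤ : ∀ k → 3 ℕ.≤ k → tri k ℕ.≤ k ℕ.^ 2 ℕ.∸ k ℕ.+ 1
  tri≤ (suc zero) (s≤s ())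
  tri≤ k@(suc (suc j)) _ = ℕ.*-cancelˡ-≤ 2 (begin
    2 ℕ.* tri k                                    ≡⟨ 2tri k ⟩
    k ℕ.* (k ℕ.+ 1)                                ≤⟨ ℕ.m≤m+n _ (j ℕ.* j ℕ.+ j) ⟩
    k ℕ.* (k ℕ.+ 1) ℕ.+ (j ℕ.* j ℕ.+ j)            ≡⟨ lem j ⟩
    2 ℕ.* (k ℕ.* suc j ℕ.+ 1)                      ≡⟨ cong (λ z → 2 ℕ.* (z ℕ.+ 1)) square ⟨
    2 ℕ.* (k ℕ.^ 2 ℕ.∸ k ℕ.+ 1)                    ∎)
    where
    open ℕ.≤-Reasoning
    lem : ∀ j → suc (suc j) ℕ.* (suc (suc j) ℕ.+ 1) ℕ.+ (j ℕ.* j ℕ.+ j) ≡ 2 ℕ.* (suc (suc j) ℕ.* suc j ℕ.+ 1)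
    lem = solve-∀
    square : k ℕ.^ 2 ℕ.∸ k ≡ k ℕ.* suc j
    square = trans (cong (ℕ._∸ k) (lem′ j)) (ℕ.m+n∸n≡m (k ℕ.* suc j) k)
      where
      lem′ : ∀ j → suc (suc j) ℕ.* (suc (suc j) ℕ.* 1) ≡ suc (suc j) ℕ.* suc j ℕ.+ suc (suc j)
      lem′ = solve-∀

  module Exponent (s k : ℕ) (tri≤s : tri k ℕ.≤ s) (q : ℕ) .{{q≢0 : ℕ.NonZero q}} where

    base : ℚ
    base = int (2 ℕ.* s) / 1 - int (k ℕ.* (k ℕ.+ 1)) / 2

    private
      h w : ℚ
      h = int (k ℕ.* (k ℕ.+ 1)) / 2
      w = int 1 / q
      1≤q : 1 ℕ.≤ q
      1≤q = ℕ.>-nonZero⁻¹ q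

      -- The hypothesis multiplied by 2 q, with the negative term moved across; all coefficients
      -- become integers.
      2≤ : ∀ {t} → base + w ≤ t → ι (4 ℕ.* s ℕ.* q ℕ.+ 2) ≤ ι (k ℕ.* (k ℕ.+ 1) ℕ.* q) + t * ι (2 ℕ.* q)
      2≤ {t} le = begin
        ι (4 ℕ.* s ℕ.* q ℕ.+ 2)
          ≡⟨ trans (ι-+ (4 ℕ.* s ℕ.* q) 2) (cong (_+ ι 2) (trans (cong ι (lem s q)) (trans (ι-* (2 ℕ.* s) (2 ℕ.* q)) (cong (ι (2 ℕ.* s) *_) (ι-* 2 q))))) ⟩
        ι (2 ℕ.* s) * (ι 2 * ι q) + ι 2
          ≡⟨ cong (ι (2 ℕ.* s) * (ι 2 * ι q) +_) (trans (sym (*-identityʳ (ι 2))) (cong (ι 2 *_) (sym (/-* 1 q)))) ⟩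
        ι (2 ℕ.* s) * (ι 2 * ι q) + ι 2 * (w * ι q)
          ≡⟨ solve 5 (λ a h w x y → a ⊠ (x ⊠ y) ⊞ x ⊠ (w ⊠ y) := (h ⊠ x) ⊠ y ⊞ (a ⊟ h ⊞ w) ⊠ (x ⊠ y)) refl (ι (2 ℕ.* s)) h w (ι 2) (ι q) ⟩
        (h * ι 2) * ι q + (base + w) * (ι 2 * ι q)
          ≡⟨ cong₂ _+_ (trans (cong (_* ι q) (/-* (k ℕ.* (k ℕ.+ 1)) 2)) (sym (ι-* (k ℕ.* (k ℕ.+ 1)) q))) (cong ((base + w) *_) (sym (ι-* 2 q))) ⟩
        ι (k ℕ.* (k ℕ.+ 1) ℕ.* q) + (base + w) * ι (2 ℕ.* q)
          ≤⟨ +-monoʳ-≤ (ι (k ℕ.* (k ℕ.+ 1) ℕ.* q)) (*-monoʳ-≤-nonNeg (ι (2 ℕ.* q)) {{ι-nonNeg (2 ℕ.* q)}} le) ⟩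
        ι (k ℕ.* (k ℕ.+ 1) ℕ.* q) + t * ι (2 ℕ.* q) ∎
        where
        open ≤-Reasoning
        lem : ∀ s q → 4 ℕ.* s ℕ.* q ≡ 2 ℕ.* s ℕ.* (2 ℕ.* q)
        lem = solve-∀

    exponent-positive : ∀ {t} → base + w ≤ t → 0ℚ < t
    exponent-positive {t} le = ≰⇒> λ t≤0 → contradiction (ι-cancel-≤ (≤-trans (2≤ le) (≤-trans
      (+-monoʳ-≤ (ι (k ℕ.* (k ℕ.+ 1) ℕ.* q)) (≤-trans (*-monoʳ-≤-nonNeg (ι (2 ℕ.* q)) {{ι-nonNeg (2 ℕ.* q)}} t≤0) (≤-reflexive (*-zeroˡ (ι (2 ℕ.* q))))))
      (≤-reflexive (+-identityʳ _))))) (ℕ.<⇒≱ (ℕ.≤-<-trans (ℕ.*-monoˡ-≤ q K≤) (ℕ.m<m+n (4 ℕ.* s ℕ.* q) {2} (s≤s z≤n))))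
      where
      K≤ : k ℕ.* (k ℕ.+ 1) ℕ.≤ 4 ℕ.* s
      K≤ = ℕ.≤-trans (ℕ.≤-reflexive (sym (2tri k))) (ℕ.*-mono-≤ {2} {4} (s≤s (s≤s z≤n)) tri≤s)

    exponent-bound : ∀ {t n} → base + w ≤ t → ↥ t ≡ int n → ↧ₙ t ℕ.* (2 ℕ.* s ℕ.* q ℕ.+ 1) ℕ.≤ n ℕ.* q ℕ.+ tri k ℕ.* q ℕ.* ↧ₙ t
    exponent-bound {t} {n} le eq = ℕ.*-cancelˡ-≤ 2 (ℕ.≤-trans (ℕ.≤-reflexive (lem d s q)) (ℕ.≤-trans (ι-cancel-≤ (begin
      ι ((4 ℕ.* s ℕ.* q ℕ.+ 2) ℕ.* d)
        ≡⟨ ι-* (4 ℕ.* s ℕ.* q ℕ.+ 2) d ⟩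
      ι (4 ℕ.* s ℕ.* q ℕ.+ 2) * ι d
        ≤⟨ *-monoʳ-≤-nonNeg (ι d) {{ι-nonNeg d}} (2≤ le) ⟩
      (ι (k ℕ.* (k ℕ.+ 1) ℕ.* q) + t * ι (2 ℕ.* q)) * ι d
        ≡⟨ solve 4 (λ a t x y → (a ⊞ t ⊠ x) ⊠ y := a ⊠ y ⊞ (t ⊠ y) ⊠ x) refl (ι (k ℕ.* (k ℕ.+ 1) ℕ.* q)) t (ι (2 ℕ.* q)) (ι d) ⟩
      ι (k ℕ.* (k ℕ.+ 1) ℕ.* q) * ι d + (t * ι d) * ι (2 ℕ.* q)
        ≡⟨ cong₂ _+_ (sym (ι-* (k ℕ.* (k ℕ.+ 1) ℕ.* q) d)) (trans (cong (_* ι (2 ℕ.* q)) td) (sym (ι-* n (2 ℕ.* q)))) ⟩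
      ι (k ℕ.* (k ℕ.+ 1) ℕ.* q ℕ.* d) + ι (n ℕ.* (2 ℕ.* q))
        ≡⟨ ι-+ (k ℕ.* (k ℕ.+ 1) ℕ.* q ℕ.* d) (n ℕ.* (2 ℕ.* q)) ⟨
      ι (k ℕ.* (k ℕ.+ 1) ℕ.* q ℕ.* d ℕ.+ n ℕ.* (2 ℕ.* q)) ∎))
      (ℕ.≤-reflexive (trans (cong (λ z → z ℕ.* q ℕ.* d ℕ.+ n ℕ.* (2 ℕ.* q)) (sym (2tri k))) (lem′ (tri k) q d n)))))
      where
      open ≤-Reasoning
      d = ↧ₙ t
      td : t * ι d ≡ ι n
      td = trans (cong (_* ι d) (trans (sym (↥p/↧p≡p t)) (cong (λ z → z / d) eq))) (/-* n d)
      lem : ∀ d s q → 2 ℕ.* (d ℕ.* (2 ℕ.* s ℕ.* q ℕ.+ 1)) ≡ (4 ℕ.* s ℕ.* q ℕ.+ 2) ℕ.* d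
      lem = solve-∀
      lem′ : ∀ x q d n → 2 ℕ.* x ℕ.* q ℕ.* d ℕ.+ n ℕ.* (2 ℕ.* q) ≡ 2 ℕ.* (n ℕ.* q ℕ.+ x ℕ.* q ℕ.* d)
      lem′ = solve-∀

  reciprocal-≤ : ∀ x → 0ℚ < x → int 1 / ↧ₙ x ≤ x
  reciprocal-≤ x@(mkℚ (int zero) _ _) 0<x with () ← positive 0<x
  reciprocal-≤ x@(mkℚ -[1+ _ ] _ _) 0<x with () ← positive 0<x
  reciprocal-≤ x@(mkℚ (int (suc n)) d-1 _) _ = *-cancelʳ-≤-pos (ι d) {{ι-pos {d} (s≤s z≤n)}} (≤-trans (≤-reflexive (/-* 1 d))
    (≤-trans (ι-mono-≤ {1} {suc n} (s≤s z≤n)) (≤-reflexive (sym (trans (cong (_* ι d) (sym (↥p/↧p≡p x))) (/-* (suc n) d))))))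
    where
    d = suc d-1

  -- The power q d makes all exponents integral. The factor M^(κ d) avoids a negative exponent and
  -- cancels at the end.
  root-bound : ∀ {N M C q d n κ e y} → 1 ℕ.≤ M → 1 ℕ.≤ q → 1 ℕ.≤ d → 1 ℕ.≤ C → 0ℚ ≤ y →
    N ℕ.^ q ℕ.* M ℕ.^ κ ℕ.≤ C ℕ.* M ℕ.^ e → d ℕ.* e ℕ.≤ n ℕ.* q ℕ.+ κ ℕ.* d → ι M ^^ n ≤ y ^^ d → ι N ≤ ι C * y
  root-bound {N} {M} {C} {q} {d} {n} {κ} {e} {y} 1≤M 1≤q 1≤d 1≤C 0≤y count exponents power =
    ^^-cancel-≤ (q ℕ.* d) (ℕ.*-mono-≤ 1≤q 1≤d) (ι-mono-≤ {0} {N} z≤n) (*-mono-nonNeg ≤-refl (ι-mono-≤ {0} {C} z≤n) ≤-refl 0≤y) (begin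
      ι N ^^ (q ℕ.* d)                           ≡⟨ ι-^ N (q ℕ.* d) ⟨
      ι (N ℕ.^ (q ℕ.* d))                        ≤⟨ ι-mono-≤ naturals ⟩
      ι (C ℕ.^ (q ℕ.* d) ℕ.* M ℕ.^ (n ℕ.* q))    ≡⟨ trans (ι-* (C ℕ.^ (q ℕ.* d)) (M ℕ.^ (n ℕ.* q))) (cong₂ _*_ (ι-^ C (q ℕ.* d)) (trans (ι-^ M (n ℕ.* q)) (sym (^^-assoc (ι M) n q)))) ⟩
      ι C ^^ (q ℕ.* d) * (ι M ^^ n) ^^ q         ≤⟨ *-monoˡ-≤-nonNeg (ι C ^^ (q ℕ.* d)) {{nonNegative (^^-nonNeg (q ℕ.* d) (ι-mono-≤ {0} {C} z≤n))}}
                                                      (^^-mono-≤ q (^^-nonNeg n (ι-mono-≤ {0} {M} z≤n)) power) ⟩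
      ι C ^^ (q ℕ.* d) * (y ^^ d) ^^ q           ≡⟨ cong (ι C ^^ (q ℕ.* d) *_) (trans (^^-assoc y d q) (cong (y ^^_) (ℕ.*-comm d q))) ⟩
      ι C ^^ (q ℕ.* d) * y ^^ (q ℕ.* d)          ≡⟨ ^^-* (ι C) y (q ℕ.* d) ⟨
      (ι C * y) ^^ (q ℕ.* d)                     ∎)
    where
    open ≤-Reasoning
    naturals : N ℕ.^ (q ℕ.* d) ℕ.≤ C ℕ.^ (q ℕ.* d) ℕ.* M ℕ.^ (n ℕ.* q)
    naturals = *-cancel-≤-pos (M ℕ.^ (κ ℕ.* d)) (^-pos (κ ℕ.* d) 1≤M) (N.begin
      M ℕ.^ (κ ℕ.* d) ℕ.* N ℕ.^ (q ℕ.* d)        N.≡⟨ trans (ℕ.*-comm (M ℕ.^ (κ ℕ.* d)) (N ℕ.^ (q ℕ.* d)))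
                                                      (trans (cong₂ ℕ._*_ (sym (ℕ.^-*-assoc N q d)) (sym (ℕ.^-*-assoc M κ d))) (sym (distrib-^-* (N ℕ.^ q) (M ℕ.^ κ) d))) ⟩
      (N ℕ.^ q ℕ.* M ℕ.^ κ) ℕ.^ d                N.≤⟨ ℕ.^-monoˡ-≤ d count ⟩
      (C ℕ.* M ℕ.^ e) ℕ.^ d                      N.≡⟨ trans (distrib-^-* C (M ℕ.^ e) d) (cong (C ℕ.^ d ℕ.*_) (trans (ℕ.^-*-assoc M e d) (cong (M ℕ.^_) (ℕ.*-comm e d)))) ⟩
      C ℕ.^ d ℕ.* M ℕ.^ (d ℕ.* e)                N.≤⟨ ℕ.*-mono-≤ (ℕ.^-monoʳ-≤ C {{ℕ.>-nonZero 1≤C}} (ℕ.m≤n*m d q {{ℕ.>-nonZero 1≤q}}))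
                                                      (ℕ.^-monoʳ-≤ M {{ℕ.>-nonZero 1≤M}} exponents) ⟩
      C ℕ.^ (q ℕ.* d) ℕ.* M ℕ.^ (n ℕ.* q ℕ.+ κ ℕ.* d)
        N.≡⟨ trans (cong (C ℕ.^ (q ℕ.* d) ℕ.*_) (ℕ.^-distribˡ-+-* M (n ℕ.* q) (κ ℕ.* d))) (lem (C ℕ.^ (q ℕ.* d)) (M ℕ.^ (n ℕ.* q)) (M ℕ.^ (κ ℕ.* d))) ⟩
      M ℕ.^ (κ ℕ.* d) ℕ.* (C ℕ.^ (q ℕ.* d) ℕ.* M ℕ.^ (n ℕ.* q)) N.∎)
      where
      module N = ℕ.≤-Reasoning
      lem : ∀ a b c → a ℕ.* (b ℕ.* c) ≡ c ℕ.* (a ℕ.* b)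
      lem = solve-∀

  ⊔-< : ∀ {a b c} → a < c → b < c → a ⊔ b < c
  ⊔-< {a} {b} {c} a<c b<c with ⊔-sel a b
  ... | inj₁ eq = subst (_< c) (sym eq) a<c
  ... | inj₂ eq = subst (_< c) (sym eq) b<c

  ^ℚ-positive : ∀ t u y → 0ℚ < t → u Defs.^ℚ t < y → ∃ λ n → ↥ t ≡ int n × u ^^ n ≤ y ^^ ↧ₙ t
  ^ℚ-positive (mkℚ (int n) _ _) u y _ (_ , lt) = n , refl , <⇒≤ lt
  ^ℚ-positive (mkℚ -[1+ _ ] _ _) u y 0<t _ with () ← positive 0<t

  <ʳ∧ʳ<⇒< : ∀ (X : ℝ) {a b} → a <ʳ X → X ʳ< b → a < b
  <ʳ∧ʳ<⇒< X {a} {b} a<X X<b = ≰⇒> λ b≤a →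
    let b′ , b′<b , X<b′ = ℝ.above-open X X<b in ℝ.disjoint X a<X (ℝ.above-closed X (<-≤-trans b′<b b≤a) X<b′)

  ≤ʳ∧ʳ<⇒< : ∀ (X : ℝ) {a b} → a ≤ʳ X → X ʳ< b → a < b
  ≤ʳ∧ʳ<⇒< X {a} {b} a≤X X<b = ≰⇒> λ b≤a →
    let b′ , b′<b , X<b′ = ℝ.above-open X X<b in a≤X (ℝ.above-closed X (<-≤-trans b′<b b≤a) X<b′)

  ⊔-<ʳ : ∀ (X : ℝ) {a b} → a <ʳ X → b <ʳ X → a ⊔ b <ʳ X
  ⊔-<ʳ X {a} {b} a<X b<X with ⊔-sel a b
  ... | inj₁ eq = subst (_<ʳ X) (sym eq) a<X
  ... | inj₂ eq = subst (_<ʳ X) (sym eq) b<X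

  module Bound (s k : ℕ) (tri≤s : tri k ℕ.≤ s) (ε : ℝ) (ε₀ : ℚ) (0<ε₀ : 0ℚ < ε₀) (ε₀<ε : ε₀ <ʳ ε)
    (C : ℕ) (1≤C : 1 ℕ.≤ C) (count : MeanValueBound s k (↧ₙ ε₀) C) where

    private
      q = ↧ₙ ε₀
      open Exponent s k tri≤s q using (base; exponent-positive; exponent-bound)
      θ = base +ʳ ε

      -- A rational below ε but above both c - base and ε₀ gives t on adding `base`: it stays below
      -- θ, hence below `d`.
      exponent : ∀ {c d} → c <ʳ θ → θ ʳ< d → ∃ λ t → c < t × t < d × base + int 1 / q ≤ t
      exponent {c} {d} c<θ θ<d = base + t₀ , c<t , t<d , +-monoʳ-≤ base (≤-trans (reciprocal-≤ ε₀ 0<ε₀) (<⇒≤ (≤-<-trans (p≤q⊔p (c - base) ε₀) m<t₀)))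
        where
        m<ε : (c - base) ⊔ ε₀ <ʳ ε
        m<ε = ⊔-<ʳ ε c<θ ε₀<ε
        open₁ = ℝ.below-open ε m<ε
        t₀ = proj₁ open₁
        m<t₀ = proj₁ (proj₂ open₁)
        open₂ = ℝ.below-open ε (proj₂ (proj₂ open₁))
        c<t : c < base + t₀
        c<t = subst (_< base + t₀) (solve 2 (λ b c → b ⊞ (c ⊟ b) := c) refl base c) (+-monoʳ-< base (≤-<-trans (p≤p⊔q (c - base) ε₀) m<t₀))
        t<d : base + t₀ < d
        t<d = ≰⇒> λ d≤t → ℝ.disjoint ε (proj₂ (proj₂ open₂)) (ℝ.above-closed ε (≤-<-trans
          (subst (d - base ≤_) (solve 2 (λ b t → b ⊞ t ⊟ b := t) refl base t₀) (+-monoˡ-≤ (- base) d≤t)) (proj₁ (proj₂ open₂))) θ<d)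

      solves : ∀ {X b M z} → X ʳ< b → (∀ r → M ℕ.< r → b ≤ ι r) → Solution s k X z → Solves k M z
      solves {X} {b} {M} X<b above (powerSums , x∈ , y∈) = powerSums , VAll.map bounded x∈ , VAll.map bounded y∈
        where
        bounded : ∀ {a} → int 1 ℤ.≤ a × a / 1 ≤ʳ X → ∃ λ r → a ≡ int r × r ℕ.≤ M
        bounded {int r} (_ , r≤X) = r , refl , ℕ.≮⇒≥ λ M<r → <⇒≱ (≤ʳ∧ʳ<⇒< X r≤X X<b) (above r M<r)

      rooted : ∀ {M u t y N} → ι M ≤ u → 1 ℕ.≤ M → base + int 1 / q ≤ t → u Defs.^ℚ t < y →
        N ℕ.^ q ℕ.* M ℕ.^ (tri k ℕ.* q) ℕ.≤ C ℕ.* M ℕ.^ (2 ℕ.* s ℕ.* q ℕ.+ 1) → ι N ≤ ι C * y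
      rooted {M} {u} {t} {y} {N} M≤u 1≤M base≤t u^t<y counted =
        let n , eq , power = ^ℚ-positive t u y (exponent-positive base≤t) u^t<y
        in root-bound {N} {M} {C} {q} {↧ₙ t} {n} {tri k ℕ.* q} {2 ℕ.* s ℕ.* q ℕ.+ 1} 1≤M (s≤s z≤n) (s≤s z≤n) 1≤C (<⇒≤ (proj₁ u^t<y))
          counted (exponent-bound base≤t eq) (≤-trans (^^-mono-≤ n (ι-mono-≤ {0} {M} z≤n) M≤u) power)

    -- The box on which the power is below y reaches up to b, so u can be taken above M, the last
    -- integer below b, even where M exceeds X. Integers up to X are at most M, so the count for M
    -- applies, and M ≤ u compares the powers.
    bound : ∀ X → 1ℚ ≤ʳ X → ∀ N → J s k X N → ∀ r → X ^ʳ θ < r → ι N ≤ ι C * r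
    bound X 1≤X N (xs , unique , member , refl) r (a , b , _ , a<X , X<b , c , d , c<θ , θ<d , y , y<r , box) =
      let M , 1≤M , M<b , above = predecessor b (≤ʳ∧ʳ<⇒< X 1≤X X<b)
          u , m<u , u<b = <-dense (⊔-< (<ʳ∧ʳ<⇒< X a<X X<b) M<b)
          t , c<t , t<d , base≤t = exponent c<θ θ<d
          u^t<y = box u t (≤-<-trans (p≤p⊔q a (ι M)) m<u) u<b c<t t<d
      in ≤-trans (rooted {M} {u} {t} {y} {length xs} (<⇒≤ (≤-<-trans (p≤q⊔p a (ι M)) m<u)) 1≤M base≤t u^t<y
           (count M 1≤M xs unique λ {z} z∈ → solves {X} {b} {M} {z} X<b above (Equivalence.to (member z) z∈)))
         (*-monoˡ-≤-nonNeg (ι C) {{ι-nonNeg C}} (<⇒≤ y<r))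

    power-bound : J s k ≪X^ θ
    power-bound = ι C , ι-mono-< {0} {C} 1≤C , 1ℚ , bound

  -- The root q is the denominator of a rational ε₀ with 0 < ε₀ < ε, so 1 / q ≤ ε₀.
  mean-value-theorem : ∀ s k → 1 ℕ.≤ k → tri k ℕ.≤ s → ∀ ε → 0ℚ <ʳ ε → J s k ≪X^ ((int (2 ℕ.* s) / 1 - int (k ℕ.* (k ℕ.+ 1)) / 2) +ʳ ε)
  mean-value-theorem s k 1≤k tri≤s ε 0<ε =
    let ε₀ , 0<ε₀ , ε₀<ε = ℝ.below-open ε 0<ε
        C , 1≤C , count = Count.mean-value-bound s k (↧ₙ ε₀) 1≤k tri≤s (s≤s z≤n)
    in Bound.power-bound s k tri≤s ε ε₀ 0<ε₀ ε₀<ε C 1≤C count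

open import Defs using (ℝ; _<ʳ_; _+ʳ_; J; _≪X^_)
open import Data.Integer using (+_)
open import Data.Nat using (ℕ; _+_; _*_; _∸_; _^_; _≤_)
open import Data.Nat.Properties using (≤-trans; m≤n+m)
open import Data.Rational using (0ℚ; _/_; _-_)
open RealExponents using (mean-value-theorem; tri≤)

corollary1p2 : (s k : ℕ) → 3 ≤ k → k ^ 2 ∸ k + 1 ≤ s →
    (ε : ℝ) → 0ℚ <ʳ ε →
    J s k ≪X^ ((+ (2 * s) / 1 - + (k * (k + 1)) / 2) +ʳ ε)
corollary1p2 s k 3≤k k²-k+1≤s = mean-value-theorem s k (≤-trans (m≤n+m 1 2) 3≤k) (≤-trans (tri≤ k 3≤k) k²-k+1≤s)
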